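{- Let $q \equiv 1 \pmod 4$ be a prime power, let $\chi_4\in\widehat{\mathbb{F}_q^*}$ be a character of order $4$, and let $A,B\in\widehat{\mathbb{F}_q^*}$ with $A^4 \neq \varepsilon$, $B^8 \neq \varepsilon$ and $A^2 \neq \varphi B^4$. Then $${}_{8}F_{8}\left( \begin{array}{cccccccc} A, & \varphi A, & \chi_4 A, & \overline{\chi_4} A, & B, & \varphi B, & \chi_4 B, & \overline{\chi_4} B\\ \varepsilon, & \varphi, & \chi_4, & \overline{\chi_4}, & A\overline{B}, & \varphi A\overline{B}, & \chi_4 A\overline{B}, & \overline{\chi_4} A\overline{B} \end{array} \Big| \; 1 \right)_{q}$$ $$= \frac{g(B^4)\,g(\overline{A}^4 B^8)}{g(\overline{A}^4 B^4)\,g(B^8)} + \sum_{R^2=A^4} \frac{g(\overline{A}^4)\,g(\overline{R} B^4)}{g(\overline{R})\,g(\overline{A}^4 B^4)} + \frac{g(\overline{A}^2) \, g(\overline{A}^2\varphi B^4) }{g(\overline{A}^2B^2) \, g( \overline{A}^2\varphi B^2)} \sum_{R^2=A^2} {}_{3}F_2\left( \begin{array}{ccc} R \varphi \overline{A}^2, & B^2, & \varphi B^2 \\ & R, & \varphi \end{array} \Big| \; 1 \right)_{q},$$ where the sums are over $R\in\widehat{\mathbb{F}_q^*}$ with $R^2=A^4$ and $R^2=A^2$, respectively.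
   Context: $\mathbb{F}_q$ is the finite field with $q$ elements and $\widehat{\mathbb{F}_q^*}$ the group of (complex) multiplicative characters of $\mathbb{F}_q^*$; every $\chi\in\widehat{\mathbb{F}_q^*}$, including the trivial character $\varepsilon$, is extended to $\mathbb{F}_q$ by $\chi(0):=0$; $\overline{\chi}$ is the inverse of $\chi$; $\varphi$ is the character of order two. Fix a non-trivial additive character $\theta$ of $\mathbb{F}_q$ and define the Gauss sum $g(\chi):=\sum_{x\in\mathbb{F}_q}\chi(x)\theta(x)$. For $A_i,B_i\in\widehat{\mathbb{F}_q^*}$ and $\lambda\in\mathbb{F}_q$, $${}_{m}F_{m}\left( \begin{array}{ccc} A_1, & \dots, & A_m \\ B_1, & \dots, & B_m \end{array} \Big| \; \lambda \right)_{q} := \frac{ -1}{q-1} \sum_{\chi \in \widehat{\mathbb{F}_q^{*}}} \prod_{i=1}^{m} \frac{g(A_i \chi)}{g(A_i)} \frac{g(\overline{B_i \chi})}{g(\overline{B_i})}\, \chi(-1)^{m} \chi(\lambda).$$ The notation ${}_{3}F_{2}\left(\begin{array}{ccc}A_1,&A_2,&A_3\\&B_2,&B_3\end{array}\Big|\;\lambda\right)_q$ means ${}_{3}F_{3}\left(\begin{array}{ccc}A_1,&A_2,&A_3\\ \varepsilon,&B_2,&B_3\end{array}\Big|\;\lambda\right)_q$. -}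

module Defs where

open import Algebra.Bundles using (AbelianGroup; CommutativeRing; Semiring)
import Algebra.Definitions.RawMonoid as RawMonoidDefinitions
import Algebra.Definitions.RawSemiring as RawSemiringDefinitions
open import Algebra.Morphism.Structures using (IsMonoidHomomorphism)
import Algebra.Properties.Ring as RingProperties
import Algebra.Properties.Semiring.Sum as SemiringSum
open import Data.Bool.Base using (if_then_else_)
open import Data.Fin.Base using (Fin; zero; suc)
open import Data.Fin.Permutation using (permutation)
import Data.Fin.Properties as Fin
import Data.Integer.Base as ℤ
open import Data.Nat.Base as ℕ using (ℕ; zero; suc)
open import Data.Nat.Primality using (Prime)
import Data.Nat.Properties as ℕ
open import Data.Product.Base using (∃-syntax; _×_; _,_; proj₁; proj₂)
open import Data.Rational.Base as ℚ using (ℚ; 0ℚ; 1ℚ; ½)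
import Data.Rational.Properties as ℚ
import Data.Rational.Solver as ℚ-Solver
open import Data.Sum.Base using (inj₁; inj₂)
open import Data.Vec.Base as Vec using (Vec; []; _∷_)
open import Function.Bundles using (Inverse)
open import Level using (Level; 0ℓ; _⊔_)
open import Relation.Binary.Definitions using (Decidable)
open import Relation.Binary.PropositionalEquality as ≡ using (_≡_; _≗_)
import Relation.Binary.Reasoning.Setoid as SetoidReasoning
open import Relation.Nullary using (¬_; yes; no; contradiction)
open import Relation.Nullary.Decidable using (does; map′)

module Estimates where

  open import Data.Rational.Base using (_+_; _*_; _-_; -_; _<_; _≤_; ∣_∣)

  private
    half+half : ∀ ε → ½ * ε + ½ * ε ≡ ε
    half+half ε = ≡.trans (≡.sym (ℚ.*-distribʳ-+ ε ½ ½)) (ℚ.*-identityˡ ε)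

  module Identities where

    open ℚ-Solver.+-*-Solver using (solve; _:=_; _:+_; _:*_; _:-_; :-_; con)

    id1 : ∀ x → x * x ≡ (- x) * (- x)
    id1 = solve 1 (λ x → x :* x := (:- x) :* (:- x)) ≡.refl

    id2 : ∀ p q → (p - q) + q ≡ p
    id2 = solve 2 (λ p q → (p :- q) :+ q := p) ≡.refl

    id3 : ∀ a b c d → (a - b) + (c - d) ≡ (a + c) - (b + d)
    id3 = solve 4 (λ a b c d → (a :- b) :+ (c :- d) := (a :+ c) :- (b :+ d)) ≡.refl

    id4 : ∀ a b → - (a - b) ≡ (- a) - (- b)
    id4 = solve 2 (λ a b → :- (a :- b) := (:- a) :- (:- b)) ≡.refl

    id5 : ∀ a b c d → a * (c - d) + d * (a - b) ≡ a * c - b * d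
    id5 = solve 4 (λ a b c d → a :* (c :- d) :+ d :* (a :- b) := a :* c :- b :* d) ≡.refl

    id6 : ∀ a b → - (a - b) ≡ b - a
    id6 = solve 2 (λ a b → :- (a :- b) := b :- a) ≡.refl

    id7 : ∀ a b c → (a - b) + (b - c) ≡ a - c
    id7 = solve 3 (λ a b c → (a :- b) :+ (b :- c) := a :- c) ≡.refl

    id8 : ∀ a b → (a - b) + b ≡ a
    id8 = solve 2 (λ a b → (a :- b) :+ b := a) ≡.refl

    id9 : ∀ a b → (b - a) + a ≡ b
    id9 = solve 2 (λ a b → (b :- a) :+ a := b) ≡.refl

    id10 : ∀ a b c d e f → (a * c + - (b * d)) * e + - ((a * d + b * c) * f) ≡ a * (c * e + - (d * f)) + - (b * (c * f + d * e))
    id10 = solve 6 (λ a b c d e f → (a :* c :+ :- (b :* d)) :* e :+ :- ((a :* d :+ b :* c) :* f) := a :* (c :* e :+ :- (d :* f)) :+ :- (b :* (c :* f :+ d :* e))) ≡.refl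

    id11 : ∀ a b c d e f → (a * c + - (b * d)) * f + (a * d + b * c) * e ≡ a * (c * f + d * e) + b * (c * e + - (d * f))
    id11 = solve 6 (λ a b c d e f → (a :* c :+ :- (b :* d)) :* f :+ (a :* d :+ b :* c) :* e := a :* (c :* f :+ d :* e) :+ b :* (c :* e :+ :- (d :* f))) ≡.refl

    id12 : ∀ a b c d e f → (c + e) * a + - ((d + f) * b) ≡ (c * a + - (d * b)) + (e * a + - (f * b))
    id12 = solve 6 (λ a b c d e f → (c :+ e) :* a :+ :- ((d :+ f) :* b) := (c :* a :+ :- (d :* b)) :+ (e :* a :+ :- (f :* b))) ≡.refl

    id13 : ∀ a b c d e f → (c + e) * b + (d + f) * a ≡ (c * b + d * a) + (e * b + f * a)
    id13 = solve 6 (λ a b c d e f → (c :+ e) :* b :+ (d :+ f) :* a := (c :* b :+ d :* a) :+ (e :* b :+ f :* a)) ≡.refl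

    id14 : ∀ a b c d → a * c + - (b * d) ≡ c * a + - (d * b)
    id14 = solve 4 (λ a b c d → a :* c :+ :- (b :* d) := c :* a :+ :- (d :* b)) ≡.refl

    id15 : ∀ a b c d → a * d + b * c ≡ c * b + d * a
    id15 = solve 4 (λ a b c d → a :* d :+ b :* c := c :* b :+ d :* a) ≡.refl

    id16 : ∀ a b → 1ℚ * a + - (0ℚ * b) ≡ a
    id16 = solve 2 (λ a b → con 1ℚ :* a :+ :- (con 0ℚ :* b) := a) ≡.refl

    id17 : ∀ a b → 1ℚ * b + 0ℚ * a ≡ b
    id17 = solve 2 (λ a b → con 1ℚ :* b :+ con 0ℚ :* a := b) ≡.refl

    id18 : ∀ a b c d e f → a * (c + e) + - (b * (d + f)) ≡ (a * c + - (b * d)) + (a * e + - (b * f))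
    id18 = solve 6 (λ a b c d e f → a :* (c :+ e) :+ :- (b :* (d :+ f)) := (a :* c :+ :- (b :* d)) :+ (a :* e :+ :- (b :* f))) ≡.refl

    id19 : ∀ a b c d e f → a * (d + f) + b * (c + e) ≡ (a * d + b * c) + (a * f + b * e)
    id19 = solve 6 (λ a b c d e f → a :* (d :+ f) :+ b :* (c :+ e) := (a :* d :+ b :* c) :+ (a :* f :+ b :* e)) ≡.refl

    id20 : ∀ a b c d →  (a * a + b * b) * c ≡ a * (a * c + - (b * d)) + - ((- b) * (a * d + b * c))
    id20 = solve 4 (λ a b c d →  (a :* a :+ b :* b) :* c := a :* (a :* c :+ :- (b :* d)) :+ :- ((:- b) :* (a :* d :+ b :* c))) ≡.refl

    id21 : ∀ a b c d →  (a * a + b * b) * d ≡ a * (a * d + b * c) + (- b) * (a * c + - (b * d))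
    id21 = solve 4 (λ a b c d →  (a :* a :+ b :* b) :* d := a :* (a :* d :+ b :* c) :+ (:- b) :* (a :* c :+ :- (b :* d))) ≡.refl

    fromℚ-*-re : ∀ a b → a * b ≡ a * b + - (0ℚ * 0ℚ)
    fromℚ-*-re = solve 2 (λ a b → a :* b := a :* b :+ :- (con 0ℚ :* con 0ℚ)) ≡.refl

    fromℚ-*-im : ∀ a b → 0ℚ ≡ a * 0ℚ + 0ℚ * b
    fromℚ-*-im = solve 2 (λ a b → con 0ℚ := a :* con 0ℚ :+ con 0ℚ :* b) ≡.refl

  open Identities public

  ½-pos : ∀ {ε} → 0ℚ < ε → 0ℚ < ½ * ε
  ½-pos {ε} 0<ε = ≡.subst (_< ½ * ε) (ℚ.*-zeroʳ ½) (ℚ.*-monoʳ-<-pos ½ 0<ε)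

  ½ε<ε : ∀ {ε} → 0ℚ < ε → ½ * ε < ε
  ½ε<ε {ε} 0<ε = ≡.subst (½ * ε <_) (ℚ.*-identityˡ ε)
    (ℚ.*-monoˡ-<-pos ε {{ℚ.positive 0<ε}} {½} {1ℚ} (ℚ.*<* (ℤ.+<+ (ℕ.s≤s (ℕ.s≤s ℕ.z≤n)))))

  ∣x∣<½,∣y∣<½⇒∣x+y∣< : ∀ x y {ε} → ∣ x ∣ < ½ * ε → ∣ y ∣ < ½ * ε → ∣ x + y ∣ < ε
  ∣x∣<½,∣y∣<½⇒∣x+y∣< x y {ε} p q =
    ℚ.≤-<-trans (ℚ.∣p+q∣≤∣p∣+∣q∣ x y)
      (≡.subst (∣ x ∣ + ∣ y ∣ <_) (half+half ε) (ℚ.+-mono-< p q))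

  quotient : ∀ {ε M} → 0ℚ < ε → 0ℚ < M → ∃[ δ ] 0ℚ < δ × M * δ ≡ ε
  quotient {ε} {M} 0<ε 0<M = δ , 0<δ , Mδ≡ε
    where
    instance
      M-pos : ℚ.Positive M
      M-pos = ℚ.positive 0<M
      M-nonZero : ℚ.NonZero M
      M-nonZero = ℚ.pos⇒nonZero M
      1/M-pos : ℚ.Positive (ℚ.1/ M)
      1/M-pos = ℚ.1/pos⇒pos M
    δ = ℚ.1/ M * ε
    0<δ : 0ℚ < δ
    0<δ = ≡.subst (_< δ) (ℚ.*-zeroʳ (ℚ.1/ M)) (ℚ.*-monoʳ-<-pos (ℚ.1/ M) 0<ε)
    Mδ≡ε : M * δ ≡ ε
    Mδ≡ε = ≡.trans (≡.sym (ℚ.*-assoc M (ℚ.1/ M) ε))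
             (≡.trans (≡.cong (_* ε) (ℚ.*-inverseʳ M)) (ℚ.*-identityˡ ε))

  ∣x∣≤M,∣y∣<δ⇒∣xy∣<Mδ : ∀ x y {M δ} → 0ℚ < M → ∣ x ∣ ≤ M → ∣ y ∣ < δ → ∣ x * y ∣ < M * δ
  ∣x∣≤M,∣y∣<δ⇒∣xy∣<Mδ x y {M} {δ} 0<M p q = ≡.subst (_< M * δ) (≡.sym (ℚ.∣p*q∣≡∣p∣*∣q∣ x y))
    (ℚ.≤-<-trans (ℚ.*-monoʳ-≤-nonNeg ∣ y ∣ {{ℚ.nonNegative (ℚ.0≤∣p∣ y)}} p)
                 (ℚ.*-monoʳ-<-pos M {{ℚ.positive 0<M}} q))

  *-mono-≤ : ∀ {a b c d} → 0ℚ < a → 0ℚ < c → a ≤ b → c ≤ d → a * c ≤ b * d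
  *-mono-≤ {a} {b} {c} {d} 0<a 0<c a≤b c≤d = ℚ.≤-trans
    (ℚ.*-monoʳ-≤-nonNeg c {{ℚ.nonNegative (ℚ.<⇒≤ 0<c)}} a≤b)
    (ℚ.*-monoˡ-≤-nonNeg b {{ℚ.nonNegative (ℚ.≤-trans (ℚ.<⇒≤ 0<a) a≤b)}} c≤d)

  0<1+∣p∣ : ∀ p → 0ℚ < 1ℚ + ∣ p ∣
  0<1+∣p∣ p = ℚ.<-≤-trans (ℚ.positive⁻¹ 1ℚ)
    (≡.subst (_≤ 1ℚ + ∣ p ∣) (ℚ.+-identityʳ 1ℚ) (ℚ.+-monoʳ-≤ 1ℚ (ℚ.0≤∣p∣ p)))

  ∣p-a∣<1⇒∣p∣≤1+∣a∣ : ∀ p a → ∣ p - a ∣ < 1ℚ → ∣ p ∣ ≤ 1ℚ + ∣ a ∣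
  ∣p-a∣<1⇒∣p∣≤1+∣a∣ p a h = ℚ.≤-trans
    (ℚ.≤-trans (ℚ.≤-reflexive (≡.cong ∣_∣ (≡.sym (id2 p a)))) (ℚ.∣p+q∣≤∣p∣+∣q∣ (p - a) a))
    (ℚ.+-monoˡ-≤ ∣ a ∣ (ℚ.<⇒≤ h))

  *-pos : ∀ {a b} → 0ℚ < a → 0ℚ < b → 0ℚ < a * b
  *-pos {a} {b} 0<a 0<b = ≡.subst (_< a * b) (ℚ.*-zeroʳ a) (ℚ.*-monoʳ-<-pos a {{ℚ.positive 0<a}} 0<b)

  p²≡∣p∣² : ∀ p → p * p ≡ ∣ p ∣ * ∣ p ∣
  p²≡∣p∣² p with ℚ.∣p∣≡p∨∣p∣≡-p p
  ... | inj₁ e rewrite e = ≡.refl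
  ... | inj₂ e rewrite e = id1 p

  0≤p² : ∀ p → 0ℚ ≤ p * p
  0≤p² p = ≡.subst (0ℚ ≤_) (≡.sym (p²≡∣p∣² p))
    (≡.subst (_≤ ∣ p ∣ * ∣ p ∣) (ℚ.*-zeroʳ ∣ p ∣)
      (ℚ.*-monoˡ-≤-nonNeg ∣ p ∣ {{ℚ.nonNegative (ℚ.0≤∣p∣ p)}} (ℚ.0≤∣p∣ p)))

  p²<ε²⇒∣p∣<ε : ∀ p {ε} → 0ℚ < ε → p * p < ε * ε → ∣ p ∣ < ε
  p²<ε²⇒∣p∣<ε p {ε} 0<ε lt with ∣ p ∣ ℚ.<? ε
  ... | yes r = r
  ... | no ¬r = contradiction
    (ℚ.<-≤-trans (≡.subst (_< ε * ε) (p²≡∣p∣² p) lt) (*-mono-≤ 0<ε 0<ε (ℚ.≮⇒≥ ¬r) (ℚ.≮⇒≥ ¬r)))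
    (ℚ.<-irrefl ≡.refl)

  -- Families of rationals indexed by I that become arbitrarily small; N ≼ i
  -- says that i lies beyond the threshold N.
  module Small {I : Set} (_≼_ : ℕ → I → Set)
    (weaken : ∀ {M N i} → M ℕ.≤ N → N ≼ i → M ≼ i) where

    Small : (I → ℚ) → Set
    Small a = ∀ ε → 0ℚ < ε → ∃[ N ] (∀ i → N ≼ i → ∣ a i ∣ < ε)

    Bounded : (I → ℚ) → Set
    Bounded a = ∃[ M ] 0ℚ < M × ∃[ N ] (∀ i → N ≼ i → ∣ a i ∣ ≤ M)

    abstract
      small-resp-≗ : ∀ {a b} → a ≗ b → Small a → Small b
      small-resp-≗ a≗b s ε 0<ε with s ε 0<ε
      ... | N , h = N , λ i N≼i → ≡.subst (λ z → ∣ z ∣ < ε) (a≗b i) (h i N≼i)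

      small-0 : Small (λ _ → 0ℚ)
      small-0 ε 0<ε = 0 , λ _ _ → 0<ε

      small-+ : ∀ {a b} → Small a → Small b → Small (λ i → a i + b i)
      small-+ {a} {b} s t ε 0<ε with s (½ * ε) (½-pos 0<ε) | t (½ * ε) (½-pos 0<ε)
      ... | M , h | N , k = M ℕ.⊔ N , λ i le → ∣x∣<½,∣y∣<½⇒∣x+y∣< (a i) (b i)
        (h i (weaken (ℕ.m≤m⊔n M N) le)) (k i (weaken (ℕ.m≤n⊔m M N) le))

      small-neg : ∀ {a} → Small a → Small (λ i → - a i)
      small-neg {a} s ε 0<ε with s ε 0<ε
      ... | N , h = N , λ i le → ≡.subst (_< ε) (≡.sym (ℚ.∣-p∣≡∣p∣ (a i))) (h i le)

      small-* : ∀ {a b} → Bounded a → Small b → Small (λ i → a i * b i)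
      small-* {a} {b} (K , 0<K , M , h) t ε 0<ε with quotient 0<ε 0<K
      ... | δ , 0<δ , Kδ≡ε with t δ 0<δ
      ... | N , k = M ℕ.⊔ N , λ i le → ≡.subst (∣ a i * b i ∣ <_) Kδ≡ε
        (∣x∣≤M,∣y∣<δ⇒∣xy∣<Mδ (a i) (b i) 0<K (h i (weaken (ℕ.m≤m⊔n M N) le)) (k i (weaken (ℕ.m≤n⊔m M N) le)))

-- Cauchy sequences of rationals; equality is Real._≈_ below.

record ℝ : Set where
  field
    seq    : ℕ → ℚ
    cauchy : ∀ ε → 0ℚ ℚ.< ε →
             ∃[ N ] (∀ m n → N ℕ.≤ m → N ℕ.≤ n → ℚ.∣ seq m ℚ.- seq n ∣ ℚ.< ε)

open ℝ public

module Real where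

  open Estimates
  private
    module S₁ = Small ℕ._≤_ ℕ.≤-trans
    module S₂ = Small (λ N ((m , n) : ℕ × ℕ) → N ℕ.≤ m × N ℕ.≤ n)
                      (λ M≤N (p , q) → ℕ.≤-trans M≤N p , ℕ.≤-trans M≤N q)

  infix 4 _≈_ _#_
  infixl 6 _+_
  infixl 7 _*_
  infix 8 -_

  _≈_ : ℝ → ℝ → Set
  x ≈ y = ∀ ε → 0ℚ ℚ.< ε → ∃[ N ] (∀ n → N ℕ.≤ n → ℚ.∣ seq x n ℚ.- seq y n ∣ ℚ.< ε)

  private
    oscillation : (ℕ → ℚ) → ℕ × ℕ → ℚ
    oscillation a (m , n) = a m ℚ.- a n

    abstract
      osc-small : ∀ x → S₂.Small (oscillation (seq x))
      osc-small x ε 0<ε with cauchy x ε 0<ε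
      ... | N , h = N , λ (m , n) (p , q) → h m n p q

    mk : (a : ℕ → ℚ) → S₂.Small (oscillation a) → ℝ
    mk a s = record
      { seq = a ; cauchy = λ ε 0<ε → let N , h = s ε 0<ε in N , λ m n p q → h (m , n) (p , q) }

    abstract
      bound : ∀ x → S₁.Bounded (seq x)
      bound x with cauchy x 1ℚ (ℚ.positive⁻¹ 1ℚ)
      ... | N , h = 1ℚ ℚ.+ ℚ.∣ seq x N ∣ , 0<1+∣p∣ (seq x N) , N , λ n N≤n →
        ∣p-a∣<1⇒∣p∣≤1+∣a∣ (seq x n) (seq x N) (h n N N≤n ℕ.≤-refl)

      bound-fst : ∀ x → S₂.Bounded (λ i → seq x (proj₁ i))
      bound-fst x = let M , 0<M , N , h = bound x in M , 0<M , N , λ (m , _) (p , _) → h m p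

      bound-snd : ∀ x → S₂.Bounded (λ i → seq x (proj₂ i))
      bound-snd x = let M , 0<M , N , h = bound x in M , 0<M , N , λ (_ , n) (_ , q) → h n q

  fromℚ : ℚ → ℝ
  fromℚ r = mk (λ _ → r) (S₂.small-resp-≗ (λ _ → ≡.sym (ℚ.+-inverseʳ r)) S₂.small-0)

  _+_ : ℝ → ℝ → ℝ
  x + y = mk (λ n → seq x n ℚ.+ seq y n) (S₂.small-resp-≗
    (λ (m , n) → id3
                   (seq x m) (seq x n) (seq y m) (seq y n))
    (S₂.small-+ (osc-small x) (osc-small y)))

  -_ : ℝ → ℝ
  - x = mk (λ n → ℚ.- seq x n) (S₂.small-resp-≗
    (λ (m , n) → id4 (seq x m) (seq x n))
    (S₂.small-neg (osc-small x)))

  _*_ : ℝ → ℝ → ℝ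
  x * y = mk (λ n → seq x n ℚ.* seq y n) (S₂.small-resp-≗
    (λ (m , n) → id5
                   (seq x m) (seq x n) (seq y m) (seq y n))
    (S₂.small-+ (S₂.small-* (bound-fst x) (osc-small y)) (S₂.small-* (bound-snd y) (osc-small x))))

  ≗⇒≈ : ∀ x y → seq x ≗ seq y → x ≈ y
  ≗⇒≈ x y x≗y = S₁.small-resp-≗ (λ n → ≡.sym (≡.trans (≡.cong (ℚ._- seq y n) (x≗y n)) (ℚ.+-inverseʳ (seq y n)))) S₁.small-0

  ≈-refl : ∀ {x} → x ≈ x
  ≈-refl {x} = ≗⇒≈ x x (λ _ → ≡.refl)

  ≈-sym : ∀ {x y} → x ≈ y → y ≈ x
  ≈-sym {x} {y} p = S₁.small-resp-≗
    (λ n → id6 (seq x n) (seq y n)) (S₁.small-neg p)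

  ≈-trans : ∀ {x y z} → x ≈ y → y ≈ z → x ≈ z
  ≈-trans {x} {y} {z} p q = S₁.small-resp-≗
    (λ n → id7 (seq x n) (seq y n) (seq z n))
    (S₁.small-+ p q)

  +-cong : ∀ {x y u v} → x ≈ y → u ≈ v → (x + u) ≈ (y + v)
  +-cong {x} {y} {u} {v} p q = S₁.small-resp-≗
    (λ n → id3
             (seq x n) (seq y n) (seq u n) (seq v n))
    (S₁.small-+ p q)

  -‿cong : ∀ {x y} → x ≈ y → (- x) ≈ (- y)
  -‿cong {x} {y} p = S₁.small-resp-≗
    (λ n → id4 (seq x n) (seq y n))
    (S₁.small-neg p)

  *-cong : ∀ {x y u v} → x ≈ y → u ≈ v → (x * u) ≈ (y * v)
  *-cong {x} {y} {u} {v} p q = S₁.small-resp-≗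
    (λ n → id5
             (seq x n) (seq y n) (seq u n) (seq v n))
    (S₁.small-+ (S₁.small-* (bound x) q) (S₁.small-* (bound v) p))

  _#_ : ℝ → ℝ → Set
  x # y = ∃[ δ ] 0ℚ ℚ.< δ × ∃[ N ] (∀ n → N ℕ.≤ n → δ ℚ.≤ ℚ.∣ seq x n ℚ.- seq y n ∣)

  ¬#⇒≈ : ∀ {x y} → ¬ (x # y) → x ≈ y
  ¬#⇒≈ {x} {y} ¬x#y ε 0<ε = decide (osc-small (x + (- y)) (½ ℚ.* (½ ℚ.* ε)) (½-pos (½-pos 0<ε)))
    where
    d : ℕ → ℚ
    d n = seq x n ℚ.- seq y n
    decide : ∃[ N ] (∀ i → N ℕ.≤ proj₁ i × N ℕ.≤ proj₂ i → ℚ.∣ oscillation d i ∣ ℚ.< ½ ℚ.* (½ ℚ.* ε)) →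
             ∃[ N ] (∀ n → N ℕ.≤ n → ℚ.∣ d n ∣ ℚ.< ε)
    decide (N , h) with ℚ.∣ d N ∣ ℚ.<? ½ ℚ.* ε
    ... | yes small = N , λ n N≤n → ≡.subst (λ z → ℚ.∣ z ∣ ℚ.< ε) (id2 (d n) (d N))
            (∣x∣<½,∣y∣<½⇒∣x+y∣< (d n ℚ.- d N) (d N)
              (ℚ.<-trans (h (n , N) (N≤n , ℕ.≤-refl)) (½ε<ε (½-pos 0<ε))) small)
    ... | no large = contradiction (½ ℚ.* (½ ℚ.* ε) , ½-pos (½-pos 0<ε) , N , far) ¬x#y
      where
      far : ∀ n → N ℕ.≤ n → ½ ℚ.* (½ ℚ.* ε) ℚ.≤ ℚ.∣ d n ∣
      far n N≤n = ℚ.≮⇒≥ λ near → large (≡.subst (λ z → ℚ.∣ z ∣ ℚ.< ½ ℚ.* ε) (id2 (d N) (d n))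
        (∣x∣<½,∣y∣<½⇒∣x+y∣< (d N ℚ.- d n) (d n) (h (N , n) (ℕ.≤-refl , N≤n)) near))

  #⇒¬≈ : ∀ {x y} → x # y → ¬ (x ≈ y)
  #⇒¬≈ (δ , 0<δ , M , far) x≈y with x≈y δ 0<δ
  ... | N , near = ℚ.<-irrefl ≡.refl
    (ℚ.≤-<-trans (far (M ℕ.⊔ N) (ℕ.m≤m⊔n M N)) (near (M ℕ.⊔ N) (ℕ.m≤n⊔m M N)))

  ≈-stable : ∀ {x y} → ¬ ¬ (x ≈ y) → x ≈ y
  ≈-stable {x} {y} ¬¬p = ¬#⇒≈ {x} {y} (λ x#y → ¬¬p (#⇒¬≈ {x} {y} x#y))

  commutativeRing : CommutativeRing 0ℓ 0ℓ
  commutativeRing = record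
    { Carrier = ℝ
    ; _≈_ = _≈_
    ; _+_ = _+_
    ; _*_ = _*_
    ; -_ = -_
    ; 0# = fromℚ 0ℚ
    ; 1# = fromℚ 1ℚ
    ; isCommutativeRing = record
      { isRing = record
        { +-isAbelianGroup = record
          { isGroup = record
            { isMonoid = record
              { isSemigroup = record
                { isMagma = record
                  { isEquivalence = record
                    { refl = λ {x} → ≈-refl {x}
                    ; sym = λ {x} {y} → ≈-sym {x} {y}
                    ; trans = λ {x} {y} {z} → ≈-trans {x} {y} {z}
                    }
                  ; ∙-cong = λ {x} {y} {u} {v} → +-cong {x} {y} {u} {v}
                  }
                ; assoc = λ x y z → ≗⇒≈ (x + y + z) (x + (y + z)) λ n → ℚ.+-assoc (seq x n) (seq y n) (seq z n)
                }
              ; identity = (λ x → ≗⇒≈ (fromℚ 0ℚ + x) x λ n → ℚ.+-identityˡ (seq x n))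
                         , (λ x → ≗⇒≈ (x + fromℚ 0ℚ) x λ n → ℚ.+-identityʳ (seq x n))
              }
            ; inverse = (λ x → ≗⇒≈ (- x + x) (fromℚ 0ℚ) λ n → ℚ.+-inverseˡ (seq x n))
                      , (λ x → ≗⇒≈ (x + - x) (fromℚ 0ℚ) λ n → ℚ.+-inverseʳ (seq x n))
            ; ⁻¹-cong = λ {x} {y} → -‿cong {x} {y}
            }
          ; comm = λ x y → ≗⇒≈ (x + y) (y + x) λ n → ℚ.+-comm (seq x n) (seq y n)
          }
        ; *-cong = λ {x} {y} {u} {v} → *-cong {x} {y} {u} {v}
        ; *-assoc = λ x y z → ≗⇒≈ (x * y * z) (x * (y * z)) λ n → ℚ.*-assoc (seq x n) (seq y n) (seq z n)
        ; *-identity = (λ x → ≗⇒≈ (fromℚ 1ℚ * x) x λ n → ℚ.*-identityˡ (seq x n))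
                     , (λ x → ≗⇒≈ (x * fromℚ 1ℚ) x λ n → ℚ.*-identityʳ (seq x n))
        ; distrib = (λ x y z → ≗⇒≈ (x * (y + z)) (x * y + x * z) λ n → ℚ.*-distribˡ-+ (seq x n) (seq y n) (seq z n))
                  , (λ x y z → ≗⇒≈ ((y + z) * x) (y * x + z * x) λ n → ℚ.*-distribʳ-+ (seq x n) (seq y n) (seq z n))
        }
      ; *-comm = λ x y → ≗⇒≈ (x * y) (y * x) λ n → ℚ.*-comm (seq x n) (seq y n)
      }
    }

  x#0,y#0⇒xy#0 : ∀ {x y} → x # fromℚ 0ℚ → y # fromℚ 0ℚ → (x * y) # fromℚ 0ℚ
  x#0,y#0⇒xy#0 {x} {y} (δ , 0<δ , M , far) (η , 0<η , N , far′) =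
    δ ℚ.* η , *-pos 0<δ 0<η , M ℕ.⊔ N , λ n le →
      ≡.subst (δ ℚ.* η ℚ.≤_)
        (≡.trans (≡.sym (ℚ.∣p*q∣≡∣p∣*∣q∣ (seq x n ℚ.- 0ℚ) (seq y n ℚ.- 0ℚ)))
          (≡.cong ℚ.∣_∣ (≡.trans (≡.cong₂ ℚ._*_ (minus-0 (seq x n)) (minus-0 (seq y n))) (≡.sym (minus-0 (seq x n ℚ.* seq y n))))))
        (*-mono-≤ 0<δ 0<η (far n (ℕ.≤-trans (ℕ.m≤m⊔n M N) le)) (far′ n (ℕ.≤-trans (ℕ.m≤n⊔m M N) le)))
    where
    minus-0 : ∀ p → p ℚ.- 0ℚ ≡ p
    minus-0 = ℚ.+-identityʳ

  x≉0,xy≈0⇒y≈0 : ∀ {x y} → ¬ (x ≈ fromℚ 0ℚ) → (x * y) ≈ fromℚ 0ℚ → y ≈ fromℚ 0ℚ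
  x≉0,xy≈0⇒y≈0 {x} {y} x≉0 xy≈0 = ¬#⇒≈ {y} {fromℚ 0ℚ} λ y#0 → x≉0 (¬#⇒≈ {x} {fromℚ 0ℚ} λ x#0 →
    #⇒¬≈ {x * y} {fromℚ 0ℚ} (x#0,y#0⇒xy#0 {x} {y} x#0 y#0) xy≈0)

  x²+y²≈0⇒x≈0 : ∀ x y → (x * x + y * y) ≈ fromℚ 0ℚ → x ≈ fromℚ 0ℚ
  x²+y²≈0⇒x≈0 x y p ε 0<ε with p (ε ℚ.* ε) (*-pos 0<ε 0<ε)
  ... | N , h = N , λ n N≤n → ≡.subst (λ z → ℚ.∣ z ∣ ℚ.< ε) (≡.sym (ℚ.+-identityʳ (seq x n)))
    (p²<ε²⇒∣p∣<ε (seq x n) 0<ε (ℚ.≤-<-trans (le n) (h n N≤n)))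
    where
    le : ∀ n → seq x n ℚ.* seq x n ℚ.≤ ℚ.∣ seq (x * x + y * y) n ℚ.- 0ℚ ∣
    le n = ℚ.≤-trans x²≤s (ℚ.≤-reflexive (≡.sym (≡.trans (≡.cong ℚ.∣_∣ (ℚ.+-identityʳ s)) (ℚ.0≤p⇒∣p∣≡p (ℚ.≤-trans (0≤p² (seq x n)) x²≤s)))))
      where
      s = seq (x * x + y * y) n
      x²≤s : seq x n ℚ.* seq x n ℚ.≤ s
      x²≤s = ≡.subst (ℚ._≤ s) (ℚ.+-identityʳ _) (ℚ.+-monoʳ-≤ (seq x n ℚ.* seq x n) (0≤p² (seq y n)))

infix 6 _+i_

record ℂ : Set where
  constructor _+i_
  field
    re : ℝ
    im : ℝ

open ℂ public

-- The operations are opaque so that equations between complex numbers are not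
-- unfolded to statements about rationals during unification.
module Complex where

  open Estimates.Identities

  infix 4 _≈_
  infixl 6 _+_
  infixl 7 _*_
  infix 8 -_

  private
    module ℝR = CommutativeRing Real.commutativeRing

  opaque

    _≈_ : ℂ → ℂ → Set
    z ≈ w = re z Real.≈ re w × im z Real.≈ im w

    fromℚ : ℚ → ℂ
    fromℚ r = Real.fromℚ r +i Real.fromℚ 0ℚ

    _+_ : ℂ → ℂ → ℂ
    (a +i b) + (c +i d) = (a Real.+ c) +i (b Real.+ d)

    -_ : ℂ → ℂ
    - (a +i b) = (Real.- a) +i (Real.- b)

    _*_ : ℂ → ℂ → ℂ
    (a +i b) * (c +i d) =
      (a Real.* c Real.+ Real.- (b Real.* d)) +i (a Real.* d Real.+ b Real.* c)

  open import Algebra.Structures _≈_ using (IsCommutativeRing)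

  opaque
    unfolding _≈_ fromℚ _+_ -_ _*_

    private
      ≗₂⇒≈ : ∀ z w → seq (re z) ≗ seq (re w) → seq (im z) ≗ seq (im w) → z ≈ w
      ≗₂⇒≈ z w p q = Real.≗⇒≈ (re z) (re w) p , Real.≗⇒≈ (im z) (im w) q

      *-comm : ∀ x y → (x * y) ≈ (y * x)
      *-comm x y = ≗₂⇒≈ (x * y) (y * x)
        (λ n → id14
                 (seq (re x) n) (seq (im x) n) (seq (re y) n) (seq (im y) n))
        (λ n → id15
                 (seq (re x) n) (seq (im x) n) (seq (re y) n) (seq (im y) n))
      *-identityˡ : ∀ x → (fromℚ 1ℚ * x) ≈ x
      *-identityˡ x = ≗₂⇒≈ (fromℚ 1ℚ * x) x
        (λ n → id16 (seq (re x) n) (seq (im x) n))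
        (λ n → id17 (seq (re x) n) (seq (im x) n))
      distribˡ : ∀ x y z → (x * (y + z)) ≈ (x * y + x * z)
      distribˡ x y z = ≗₂⇒≈ (x * (y + z)) (x * y + x * z)
        (λ n → id18
                 (seq (re x) n) (seq (im x) n) (seq (re y) n) (seq (im y) n) (seq (re z) n) (seq (im z) n))
        (λ n → id19
                 (seq (re x) n) (seq (im x) n) (seq (re y) n) (seq (im y) n) (seq (re z) n) (seq (im z) n))

    isCommutativeRing : IsCommutativeRing _+_ _*_ -_ (fromℚ 0ℚ) (fromℚ 1ℚ)
    isCommutativeRing = record
      { isRing = record
        { +-isAbelianGroup = record
          { isGroup = record
            { isMonoid = record
              { isSemigroup = record
                { isMagma = record
                  { isEquivalence = record
                    { refl = λ {z} → ℝR.refl {re z} , ℝR.refl {im z}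
                    ; sym = λ {z} {w} (p , q) → ℝR.sym {re z} {re w} p , ℝR.sym {im z} {im w} q
                    ; trans = λ {x} {y} {z} (p , q) (r , s) →
                        ℝR.trans {re x} {re y} {re z} p r , ℝR.trans {im x} {im y} {im z} q s
                    }
                  ; ∙-cong = λ {x} {y} {u} {v} (p , q) (r , s) →
                      ℝR.+-cong {re x} {re y} {re u} {re v} p r , ℝR.+-cong {im x} {im y} {im u} {im v} q s
                  }
                ; assoc = λ x y z → ℝR.+-assoc (re x) (re y) (re z) , ℝR.+-assoc (im x) (im y) (im z)
                }
              ; identity = (λ x → ℝR.+-identityˡ (re x) , ℝR.+-identityˡ (im x))
                         , (λ x → ℝR.+-identityʳ (re x) , ℝR.+-identityʳ (im x))
              }
            ; inverse = (λ x → ℝR.-‿inverseˡ (re x) , ℝR.-‿inverseˡ (im x))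
                      , (λ x → ℝR.-‿inverseʳ (re x) , ℝR.-‿inverseʳ (im x))
            ; ⁻¹-cong = λ {x} {y} (p , q) → ℝR.-‿cong {re x} {re y} p , ℝR.-‿cong {im x} {im y} q
            }
          ; comm = λ x y → ℝR.+-comm (re x) (re y) , ℝR.+-comm (im x) (im y)
          }
        ; *-cong = λ {x} {y} {u} {v} (p , q) (r , s) →
              ℝR.+-cong {re x Real.* re u} {re y Real.* re v} {Real.- (im x Real.* im u)} {Real.- (im y Real.* im v)}
                (ℝR.*-cong {re x} {re y} {re u} {re v} p r)
                (ℝR.-‿cong {im x Real.* im u} {im y Real.* im v} (ℝR.*-cong {im x} {im y} {im u} {im v} q s))
            , ℝR.+-cong {re x Real.* im u} {re y Real.* im v} {im x Real.* re u} {im y Real.* re v}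
                (ℝR.*-cong {re x} {re y} {im u} {im v} p s) (ℝR.*-cong {im x} {im y} {re u} {re v} q r)
        ; *-assoc = λ x y z → ≗₂⇒≈ (x * y * z) (x * (y * z))
            (λ n → id10
                     (seq (re x) n) (seq (im x) n) (seq (re y) n) (seq (im y) n) (seq (re z) n) (seq (im z) n))
            (λ n → id11
                     (seq (re x) n) (seq (im x) n) (seq (re y) n) (seq (im y) n) (seq (re z) n) (seq (im z) n))
        ; *-identity = *-identityˡ
                     , λ x → let y = x * fromℚ 1ℚ ; z = fromℚ 1ℚ * x in
                         ℝR.trans {re y} {re z} {re x} (proj₁ (*-comm x (fromℚ 1ℚ))) (proj₁ (*-identityˡ x))
                       , ℝR.trans {im y} {im z} {im x} (proj₂ (*-comm x (fromℚ 1ℚ))) (proj₂ (*-identityˡ x))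
        ; distrib = distribˡ
                  , λ x y z → ≗₂⇒≈ ((y + z) * x) (y * x + z * x)
            (λ n → id12
                     (seq (re x) n) (seq (im x) n) (seq (re y) n) (seq (im y) n) (seq (re z) n) (seq (im z) n))
            (λ n → id13
                     (seq (re x) n) (seq (im x) n) (seq (re y) n) (seq (im y) n) (seq (re z) n) (seq (im z) n))
        }
      ; *-comm = *-comm
      }

  commutativeRing : CommutativeRing 0ℓ 0ℓ
  commutativeRing = record { isCommutativeRing = isCommutativeRing }

  private module ℂR = CommutativeRing commutativeRing

  opaque
    unfolding _≈_ fromℚ _+_ -_ _*_

    fromℚ-+ : ∀ p r → fromℚ (p ℚ.+ r) ≈ fromℚ p + fromℚ r
    fromℚ-+ p r = ≗₂⇒≈ (fromℚ (p ℚ.+ r)) (fromℚ p + fromℚ r) (λ _ → ≡.refl) (λ _ → ≡.sym (ℚ.+-identityʳ 0ℚ))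

    fromℚ-* : ∀ p r → fromℚ (p ℚ.* r) ≈ fromℚ p * fromℚ r
    fromℚ-* p r = ≗₂⇒≈ (fromℚ (p ℚ.* r)) (fromℚ p * fromℚ r)
      (λ _ → fromℚ-*-re p r) (λ _ → fromℚ-*-im p r)

    ≈-stable : ∀ {z w} → ¬ ¬ (z ≈ w) → z ≈ w
    ≈-stable {z} {w} ¬¬p =
        Real.≈-stable {re z} {re w} (λ ¬q → ¬¬p (λ p → ¬q (proj₁ p)))
      , Real.≈-stable {im z} {im w} (λ ¬q → ¬¬p λ p → ¬q (proj₂ p))

    -- Multiply z * w ≈ 0 by the complex conjugate of z.
    z≉0,zw≈0⇒w≈0 : ∀ {z w} → ¬ (z ≈ fromℚ 0ℚ) → (z * w) ≈ fromℚ 0ℚ → w ≈ fromℚ 0ℚ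
    z≉0,zw≈0⇒w≈0 {z@(a +i b)} {w@(c +i d)} z≉0 zw≈0 =
        Real.x≉0,xy≈0⇒y≈0 {∣z∣²} {c} ∣z∣²≉0 (ℝR.trans {∣z∣² Real.* c} {re z̄zw} {Real.fromℚ 0ℚ}
          (Real.≗⇒≈ (∣z∣² Real.* c) (re z̄zw) λ n → id20
             (seq a n) (seq b n) (seq c n) (seq d n)) (proj₁ z̄zw≈0))
      , Real.x≉0,xy≈0⇒y≈0 {∣z∣²} {d} ∣z∣²≉0 (ℝR.trans {∣z∣² Real.* d} {im z̄zw} {Real.fromℚ 0ℚ}
          (Real.≗⇒≈ (∣z∣² Real.* d) (im z̄zw) λ n → id21
             (seq a n) (seq b n) (seq c n) (seq d n)) (proj₂ z̄zw≈0))
      where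
      ∣z∣² : ℝ
      ∣z∣² = a Real.* a Real.+ b Real.* b
      z̄ z̄zw : ℂ
      z̄ = a +i (Real.- b)
      z̄zw = z̄ * (z * w)
      z̄zw≈0 : z̄zw ≈ fromℚ 0ℚ
      z̄zw≈0 = ℂR.trans {z̄zw} {z̄ * fromℚ 0ℚ} {fromℚ 0ℚ}
        (ℂR.*-cong {z̄} {z̄} {z * w} {fromℚ 0ℚ} (ℂR.refl {z̄}) zw≈0) (ℂR.zeroʳ z̄)
      ∣z∣²≉0 : ¬ (∣z∣² Real.≈ Real.fromℚ 0ℚ)
      ∣z∣²≉0 p = z≉0 (Real.x²+y²≈0⇒x≈0 a b p , Real.x²+y²≈0⇒x≈0 b a
        (ℝR.trans {b Real.* b Real.+ a Real.* a} {∣z∣²} {Real.fromℚ 0ℚ} (ℝR.+-comm (b Real.* b) (a Real.* a)) p))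

IsPrimePower : ℕ → Set
IsPrimePower q = ∃[ p ] ∃[ k ] Prime p × q ≡ p ℕ.^ suc k

record FiniteField (c ℓ : Level) (q : ℕ) : Set (Level.suc (c ⊔ ℓ)) where
  field
    commutativeRing : CommutativeRing c ℓ

  open CommutativeRing commutativeRing public

  field
    0≉1         : ¬ (0# ≈ 1#)
    invertible  : ∀ x → ¬ (x ≈ 0#) → ∃[ y ] x * y ≈ 1#
    enumeration : Inverse (≡.setoid (Fin q)) setoid

  element : Fin q → Carrier
  element = Inverse.to enumeration

  index : Carrier → Fin q
  index = Inverse.from enumeration

  element-index : ∀ x → element (index x) ≈ x
  element-index x = Inverse.inverseˡ enumeration ≡.refl

  index-element : ∀ i → index (element i) ≡ i
  index-element i = Inverse.inverseʳ enumeration refl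

  infix 4 _≟_
  _≟_ : Decidable _≈_
  x ≟ y = map′
    (λ eq → trans (sym (element-index x)) (trans (reflexive (≡.cong element eq)) (element-index y)))
    (Inverse.from-cong enumeration)
    (index x Fin.≟ index y)

  -- The convention 0⁻¹ = 0 makes χ̄ (x) = χ (x ⁻¹) hold for every x, since χ (0) = 0.
  infix 8 _⁻¹
  _⁻¹ : Carrier → Carrier
  x ⁻¹ with x ≟ 0#
  ... | yes _   = 0#
  ... | no  x≉0 = proj₁ (invertible x x≉0)

  ⁻¹-zero : ∀ {x} → x ≈ 0# → x ⁻¹ ≈ 0#
  ⁻¹-zero {x} x≈0 with x ≟ 0#
  ... | yes _   = refl
  ... | no  x≉0 = contradiction x≈0 x≉0

  ⁻¹-inverseʳ : ∀ {x} → ¬ (x ≈ 0#) → x * x ⁻¹ ≈ 1#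
  ⁻¹-inverseʳ {x} x≉0 with x ≟ 0#
  ... | yes x≈0 = contradiction x≈0 x≉0
  ... | no  x≉0′ = proj₂ (invertible x x≉0′)

  ⁻¹-inverseˡ : ∀ {x} → ¬ (x ≈ 0#) → x ⁻¹ * x ≈ 1#
  ⁻¹-inverseˡ {x} x≉0 = trans (*-comm (x ⁻¹) x) (⁻¹-inverseʳ x≉0)

  x*y≈1⇒y≈x⁻¹ : ∀ {x y} → ¬ (x ≈ 0#) → x * y ≈ 1# → y ≈ x ⁻¹
  x*y≈1⇒y≈x⁻¹ {x} {y} x≉0 xy≈1 = begin
    y              ≈⟨ *-identityˡ y ⟨
    1# * y         ≈⟨ *-congʳ (⁻¹-inverseˡ x≉0) ⟨
    x ⁻¹ * x * y   ≈⟨ *-assoc (x ⁻¹) x y ⟩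
    x ⁻¹ * (x * y) ≈⟨ *-congˡ xy≈1 ⟩
    x ⁻¹ * 1#      ≈⟨ *-identityʳ (x ⁻¹) ⟩
    x ⁻¹           ∎
    where open SetoidReasoning setoid

  *-≉0 : ∀ {x y} → ¬ (x ≈ 0#) → ¬ (y ≈ 0#) → ¬ (x * y ≈ 0#)
  *-≉0 {x} {y} x≉0 y≉0 xy≈0 = y≉0 (begin
    y              ≈⟨ *-identityˡ y ⟨
    1# * y         ≈⟨ *-congʳ (⁻¹-inverseˡ x≉0) ⟨
    x ⁻¹ * x * y   ≈⟨ *-assoc (x ⁻¹) x y ⟩
    x ⁻¹ * (x * y) ≈⟨ *-congˡ xy≈0 ⟩
    x ⁻¹ * 0#      ≈⟨ zeroʳ (x ⁻¹) ⟩
    0#             ∎)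
    where open SetoidReasoning setoid

  ⁻¹-cong : ∀ {x y} → x ≈ y → x ⁻¹ ≈ y ⁻¹
  ⁻¹-cong {x} {y} x≈y with y ≟ 0#
  ... | yes y≈0 = ⁻¹-zero (trans x≈y y≈0)
  ... | no  y≉0 = sym (x*y≈1⇒y≈x⁻¹ (λ x≈0 → y≉0 (trans (sym x≈y) x≈0))
                    (trans (*-congʳ x≈y) (proj₂ (invertible y y≉0))))

  ⁻¹-distrib-* : ∀ x y → (x * y) ⁻¹ ≈ x ⁻¹ * y ⁻¹
  ⁻¹-distrib-* x y with x ≟ 0# | y ≟ 0#
  ... | yes x≈0 | _ = trans (⁻¹-zero (trans (*-congʳ x≈0) (zeroˡ y))) (sym (zeroˡ _))
  ... | no _ | yes y≈0 = trans (⁻¹-zero (trans (*-congˡ y≈0) (zeroʳ x))) (sym (zeroʳ _))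
  ... | no x≉0 | no y≉0 = sym (x*y≈1⇒y≈x⁻¹ (*-≉0 x≉0 y≉0) (begin
      x * y * (u * v)   ≈⟨ *-assoc x y (u * v) ⟩
      x * (y * (u * v)) ≈⟨ *-congˡ (*-congˡ (*-comm u v)) ⟩
      x * (y * (v * u)) ≈⟨ *-congˡ (*-assoc y v u) ⟨
      x * (y * v * u)   ≈⟨ *-congˡ (*-congʳ (proj₂ (invertible y y≉0))) ⟩
      x * (1# * u)      ≈⟨ *-congˡ (*-identityˡ u) ⟩
      x * u             ≈⟨ proj₂ (invertible x x≉0) ⟩
      1#                ∎))
    where
    open SetoidReasoning setoid
    u v : Carrier
    u = proj₁ (invertible x x≉0)
    v = proj₁ (invertible y y≉0)

  1⁻¹≈1 : 1# ⁻¹ ≈ 1#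
  1⁻¹≈1 = sym (x*y≈1⇒y≈x⁻¹ (λ 1≈0 → 0≉1 (sym 1≈0)) (*-identityˡ 1#))

q∸1-nonZero : ∀ {c ℓ q} → FiniteField c ℓ q → ℕ.NonZero (q ℕ.∸ 1)
q∸1-nonZero {q = zero} 𝔽 with FiniteField.index 𝔽 (FiniteField.0# 𝔽)
... | ()
q∸1-nonZero {q = suc zero} 𝔽 = contradiction
  (trans (sym (element-index 0#)) (trans (reflexive (≡.cong element (fin1 (index 0#) (index 1#)))) (element-index 1#)))
  0≉1
  where
  open FiniteField 𝔽
  fin1 : (i j : Fin 1) → i ≡ j
  fin1 zero zero = ≡.refl
q∸1-nonZero {q = suc (suc _)} _ = _

module Characters {c ℓ : Level} {q : ℕ} (𝔽 : FiniteField c ℓ q) where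

  open CommutativeRing Complex.commutativeRing hiding (Carrier; zero) renaming (refl to ≈-refl)
  open SemiringSum semiring
  open SetoidReasoning setoid
  private module F = FiniteField 𝔽

  -- A homomorphism 𝔽* → ℂ* extended by 0 to 𝔽 is the same thing as a
  -- multiplicative map 𝔽 → ℂ with 1 ↦ 1 and 0 ↦ 0.
  record Character : Set (c ⊔ ℓ) where
    field
      ⟦_⟧                  : F.Carrier → ℂ
      isMonoidHomomorphism : IsMonoidHomomorphism F.*-rawMonoid *-rawMonoid ⟦_⟧
      0-homo               : ⟦ F.0# ⟧ ≈ 0#

    open IsMonoidHomomorphism isMonoidHomomorphism public
      using () renaming (⟦⟧-cong to cong; homo to *-homo; ε-homo to 1-homo)

    zero-at : ∀ {x} → x F.≈ F.0# → ⟦ x ⟧ ≈ 0#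
    zero-at x≈0 = trans (cong x≈0) 0-homo

  open Character public using (⟦_⟧)

  character : (f : F.Carrier → ℂ) → (∀ {x y} → x F.≈ y → f x ≈ f y) →
              (∀ x y → f (x F.* y) ≈ f x * f y) → f F.1# ≈ 1# → f F.0# ≈ 0# → Character
  character f f-cong f-* f-1 f-0 = record
    { ⟦_⟧ = f
    ; isMonoidHomomorphism = record
      { isMagmaHomomorphism = record
        { isRelHomomorphism = record { cong = f-cong } ; homo = f-* }
      ; ε-homo = f-1
      }
    ; 0-homo = f-0
    }

  infix 4 _≋_
  _≋_ : Character → Character → Set c
  χ ≋ ψ = ∀ x → ⟦ χ ⟧ x ≈ ⟦ ψ ⟧ x

  nonzero : F.Carrier → ℂ
  nonzero x with x F.≟ F.0#
  ... | yes _ = 0#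
  ... | no  _ = 1#

  nonzero-0 : ∀ {x} → x F.≈ F.0# → nonzero x ≈ 0#
  nonzero-0 {x} x≈0 with x F.≟ F.0#
  ... | yes _ = ≈-refl
  ... | no x≉0 = contradiction x≈0 x≉0

  nonzero-1 : ∀ {x} → ¬ (x F.≈ F.0#) → nonzero x ≈ 1#
  nonzero-1 {x} x≉0 with x F.≟ F.0#
  ... | yes x≈0 = contradiction x≈0 x≉0
  ... | no _ = ≈-refl

  interchange : ∀ x y z w → (x * y) * (z * w) ≈ (x * z) * (y * w)
  interchange x y z w = begin
    x * y * (z * w)   ≈⟨ *-assoc x y (z * w) ⟩
    x * (y * (z * w)) ≈⟨ *-congˡ (*-assoc y z w) ⟨
    x * (y * z * w)   ≈⟨ *-congˡ (*-congʳ (*-comm y z)) ⟩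
    x * (z * y * w)   ≈⟨ *-congˡ (*-assoc z y w) ⟩
    x * (z * (y * w)) ≈⟨ *-assoc x z (y * w) ⟨
    x * z * (y * w)   ∎

  ε : Character
  ε = character nonzero nonzero-cong nonzero-* (nonzero-1 (λ 1≈0 → F.0≉1 (F.sym 1≈0))) (nonzero-0 F.refl)
    where
    nonzero-cong : ∀ {x y} → x F.≈ y → nonzero x ≈ nonzero y
    nonzero-cong {x} {y} x≈y with y F.≟ F.0#
    ... | yes y≈0 = nonzero-0 (F.trans x≈y y≈0)
    ... | no  y≉0 = nonzero-1 (λ x≈0 → y≉0 (F.trans (F.sym x≈y) x≈0))
    nonzero-* : ∀ x y → nonzero (x F.* y) ≈ nonzero x * nonzero y
    nonzero-* x y with x F.≟ F.0# | y F.≟ F.0#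
    ... | yes x≈0 | _ = trans (nonzero-0 (F.trans (F.*-congʳ x≈0) (F.zeroˡ y))) (sym (zeroˡ _))
    ... | no _ | yes y≈0 = trans (nonzero-0 (F.trans (F.*-congˡ y≈0) (F.zeroʳ x))) (sym (zeroʳ _))
    ... | no x≉0 | no y≉0 = trans (nonzero-1 (F.*-≉0 x≉0 y≉0)) (sym (*-identityˡ 1#))

  infixl 7 _·_
  _·_ : Character → Character → Character
  χ · ψ = character (λ x → ⟦ χ ⟧ x * ⟦ ψ ⟧ x)
    (λ x≈y → *-cong (χ.cong x≈y) (ψ.cong x≈y))
    (λ x y → trans (*-cong (χ.*-homo x y) (ψ.*-homo x y)) (interchange _ _ _ _))
    (trans (*-cong χ.1-homo ψ.1-homo) (*-identityˡ 1#))
    (trans (*-congʳ χ.0-homo) (zeroˡ _))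
    where
    module χ = Character χ
    module ψ = Character ψ

  infix 9 _⁻¹
  _⁻¹ : Character → Character
  χ ⁻¹ = character (λ x → ⟦ χ ⟧ (x F.⁻¹))
    (λ x≈y → χ.cong (F.⁻¹-cong x≈y))
    (λ x y → trans (χ.cong (F.⁻¹-distrib-* x y)) (χ.*-homo _ _))
    (trans (χ.cong F.1⁻¹≈1) χ.1-homo)
    (χ.zero-at (F.⁻¹-zero F.refl))
    where module χ = Character χ

  characterGroup : AbelianGroup (c ⊔ ℓ) c
  characterGroup = record
    { Carrier = Character
    ; _≈_ = _≋_
    ; _∙_ = _·_
    ; ε = ε
    ; _⁻¹ = _⁻¹
    ; isAbelianGroup = record
      { isGroup = record
        { isMonoid = record
          { isSemigroup = record
            { isMagma = record
              { isEquivalence = record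
                { refl = λ x → ≈-refl ; sym = λ p x → sym (p x) ; trans = λ p r x → trans (p x) (r x) }
              ; ∙-cong = λ p r x → *-cong (p x) (r x)
              }
            ; assoc = λ χ ψ ω x → *-assoc _ _ _
            }
          ; identity = identityˡ , λ χ x → trans (*-comm _ _) (identityˡ χ x)
          }
        ; inverse = inverseˡ , λ χ x → trans (*-comm _ _) (inverseˡ χ x)
        ; ⁻¹-cong = λ p x → p (x F.⁻¹)
        }
      ; comm = λ χ ψ x → *-comm _ _
      }
    }
    where
    identityˡ : ∀ χ → (ε · χ) ≋ χ
    identityˡ χ x with x F.≟ F.0#
    ... | yes x≈0 = trans (zeroˡ _) (sym (Character.zero-at χ x≈0))
    ... | no _ = *-identityˡ _
    inverseˡ : ∀ χ → (χ ⁻¹ · χ) ≋ ε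
    inverseˡ χ x with x F.≟ F.0#
    ... | yes x≈0 = trans (*-congˡ (Character.zero-at χ x≈0)) (zeroʳ _)
    ... | no x≉0 = begin
      ⟦ χ ⟧ y * ⟦ χ ⟧ x       ≈⟨ Character.*-homo χ y x ⟨
      ⟦ χ ⟧ (y F.* x)         ≈⟨ Character.cong χ (F.trans (F.*-comm y x) (proj₂ (F.invertible x x≉0))) ⟩
      ⟦ χ ⟧ F.1#              ≈⟨ Character.1-homo χ ⟩
      1#                      ∎
      where
      y : F.Carrier
      y = proj₁ (F.invertible x x≉0)

  infixr 8 _^_
  _^_ : Character → ℕ → Character
  χ ^ n = n ×ᴳ χ
    where open RawMonoidDefinitions (AbelianGroup.rawMonoid characterGroup) using () renaming (_×_ to _×ᴳ_)

  HasOrder : Character → ℕ → Set c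
  HasOrder χ n = χ ^ n ≋ ε × (∀ m → 0 ℕ.< m → m ℕ.< n → ¬ (χ ^ m ≋ ε))

  record AdditiveCharacter : Set (c ⊔ ℓ) where
    field
      ⟦_⟧₊                 : F.Carrier → ℂ
      isMonoidHomomorphism : IsMonoidHomomorphism F.+-rawMonoid *-rawMonoid ⟦_⟧₊

    open IsMonoidHomomorphism isMonoidHomomorphism public
      using () renaming (⟦⟧-cong to cong; homo to +-homo; ε-homo to 0-homo)

  open AdditiveCharacter public using (⟦_⟧₊)

  NonTrivial : AdditiveCharacter → Set c
  NonTrivial θ = ¬ (∀ x → ⟦ θ ⟧₊ x ≈ 1#)

  ∑F : (F.Carrier → ℂ) → ℂ
  ∑F f = ∑[ k < q ] f (F.element k)

  sum-zero : ∀ {n} (t : Fin n → ℂ) → (∀ i → t i ≈ 0#) → sum t ≈ 0#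
  sum-zero {n} t t≈0 = trans (sum-cong-≋ t≈0) (sum-replicate-zero n)

  sum-single : ∀ {n} (t : Fin n → ℂ) i → (∀ j → ¬ (j ≡ i) → t j ≈ 0#) → sum t ≈ t i
  sum-single t zero h = trans (+-congˡ (sum-zero (λ j → t (suc j)) (λ j → h (suc j) λ ()))) (+-identityʳ _)
  sum-single t (suc i) h = trans
    (+-cong (h zero λ ()) (sum-single (λ j → t (suc j)) i (λ j j≢i → h (suc j) λ eq → j≢i (Fin.suc-injective eq))))
    (+-identityˡ _)

  ∑F-cong : ∀ {f g : F.Carrier → ℂ} → (∀ x → f x ≈ g x) → ∑F f ≈ ∑F g
  ∑F-cong f≈g = sum-cong-≋ (λ k → f≈g (F.element k))

  ∑F-zero : ∀ {f : F.Carrier → ℂ} → (∀ x → f x ≈ 0#) → ∑F f ≈ 0#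
  ∑F-zero {f} f≈0 = sum-zero (λ k → f (F.element k)) (λ k → f≈0 (F.element k))

  ∑F-single : ∀ {f : F.Carrier → ℂ} a → (∀ {x y} → x F.≈ y → f x ≈ f y) →
              (∀ x → ¬ (x F.≈ a) → f x ≈ 0#) → ∑F f ≈ f a
  ∑F-single {f} a f-cong h = trans
    (sum-single (λ k → f (F.element k)) (F.index a) λ j j≢ → h (F.element j) λ eq →
      j≢ (≡.trans (≡.sym (F.index-element j)) (Inverse.from-cong F.enumeration eq)))
    (f-cong (F.element-index a))

  ∑F-reindex : ∀ {f : F.Carrier → ℂ} (h h⁻¹ : F.Carrier → F.Carrier) →
               (∀ {x y} → x F.≈ y → f x ≈ f y) →
               (∀ {x y} → x F.≈ y → h x F.≈ h y) → (∀ {x y} → x F.≈ y → h⁻¹ x F.≈ h⁻¹ y) →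
               (∀ x → h (h⁻¹ x) F.≈ x) → (∀ x → h⁻¹ (h x) F.≈ x) →
               ∑F f ≈ ∑F (λ x → f (h x))
  ∑F-reindex {f} h h⁻¹ f-cong h-cong h⁻¹-cong hh⁻¹ h⁻¹h = trans
    (sum-permute (λ k → f (F.element k)) (permutation
      (λ i → F.index (h (F.element i))) (λ i → F.index (h⁻¹ (F.element i)))
      (λ i → ≡.trans (Inverse.from-cong F.enumeration
                 (F.trans (h-cong (F.element-index _)) (hh⁻¹ _))) (F.index-element i))
      (λ i → ≡.trans (Inverse.from-cong F.enumeration
                 (F.trans (h⁻¹-cong (F.element-index _)) (h⁻¹h _))) (F.index-element i))))
    (sum-cong-≋ λ k → f-cong (F.element-index (h (F.element k))))

  fixed⇒≈0 : ∀ {u s} → u * s ≈ s → ¬ (s ≈ 0#) → u ≈ 1#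
  fixed⇒≈0 {u} {s} us≈s s≉0 = RP.x∙y⁻¹≈ε⇒x≈y u 1# (Complex.z≉0,zw≈0⇒w≈0 s≉0 (begin
    s * (u - 1#)          ≈⟨ distribˡ s u (- 1#) ⟩
    s * u + s * (- 1#)    ≈⟨ +-cong (trans (*-comm s u) us≈s) (trans (sym (RP.-‿distribʳ-* s 1#)) (-‿cong (*-identityʳ s))) ⟩
    s - s                 ≈⟨ -‿inverseʳ s ⟩
    0#                    ∎))
    where module RP = RingProperties ring

  shift : ∀ a (f : F.Carrier → ℂ) → (∀ {x y} → x F.≈ y → f x ≈ f y) →
          ∑F f ≈ ∑F (λ x → f (a F.+ x))
  shift a f f-cong = ∑F-reindex (a F.+_) (F.- a F.+_) f-cong F.+-congˡ F.+-congˡ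
    (λ x → F.trans (F.sym (F.+-assoc _ _ _)) (F.trans (F.+-congʳ (F.-‿inverseʳ a)) (F.+-identityˡ x)))
    (λ x → F.trans (F.sym (F.+-assoc _ _ _)) (F.trans (F.+-congʳ (F.-‿inverseˡ a)) (F.+-identityˡ x)))

  scale : ∀ a → ¬ (a F.≈ F.0#) → (f : F.Carrier → ℂ) → (∀ {x y} → x F.≈ y → f x ≈ f y) →
          ∑F f ≈ ∑F (λ x → f (a F.* x))
  scale a a≉0 f f-cong = ∑F-reindex (a F.*_) (a F.⁻¹ F.*_) f-cong F.*-congˡ F.*-congˡ
    (λ x → F.trans (F.sym (F.*-assoc _ _ _)) (F.trans (F.*-congʳ (F.⁻¹-inverseʳ a≉0)) (F.*-identityˡ x)))
    (λ x → F.trans (F.sym (F.*-assoc _ _ _)) (F.trans (F.*-congʳ (F.⁻¹-inverseˡ a≉0)) (F.*-identityˡ x)))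

  ∑χ≈0 : ∀ χ → ¬ (χ ≋ ε) → ∑F ⟦ χ ⟧ ≈ 0#
  ∑χ≈0 χ χ≢ε = Complex.≈-stable λ s≉0 → χ≢ε λ x → value s≉0 x
    where
    module χ = Character χ
    value : ¬ (∑F ⟦ χ ⟧ ≈ 0#) → ∀ a → ⟦ χ ⟧ a ≈ ⟦ ε ⟧ a
    value s≉0 a with a F.≟ F.0#
    ... | yes a≈0 = χ.zero-at a≈0
    ... | no  a≉0 = fixed⇒≈0 (begin
      ⟦ χ ⟧ a * ∑F ⟦ χ ⟧                ≈⟨ *-distribˡ-sum (⟦ χ ⟧ a) (λ k → ⟦ χ ⟧ (F.element k)) ⟩
      ∑F (λ x → ⟦ χ ⟧ a * ⟦ χ ⟧ x)      ≈⟨ ∑F-cong (λ x → χ.*-homo a x) ⟨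
      ∑F (λ x → ⟦ χ ⟧ (a F.* x))        ≈⟨ scale a a≉0 ⟦ χ ⟧ χ.cong ⟨
      ∑F ⟦ χ ⟧                          ∎) s≉0

  ∑θ≈0 : ∀ θ → NonTrivial θ → ∑F ⟦ θ ⟧₊ ≈ 0#
  ∑θ≈0 θ θ≢1 = Complex.≈-stable λ s≉0 → θ≢1 λ a → fixed⇒≈0 (begin
      ⟦ θ ⟧₊ a * ∑F ⟦ θ ⟧₊               ≈⟨ *-distribˡ-sum (⟦ θ ⟧₊ a) (λ k → ⟦ θ ⟧₊ (F.element k)) ⟩
      ∑F (λ x → ⟦ θ ⟧₊ a * ⟦ θ ⟧₊ x)     ≈⟨ ∑F-cong (λ x → θ.+-homo a x) ⟨
      ∑F (λ x → ⟦ θ ⟧₊ (a F.+ x))        ≈⟨ shift a ⟦ θ ⟧₊ θ.cong ⟨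
      ∑F ⟦ θ ⟧₊                          ∎) s≉0
    where module θ = AdditiveCharacter θ

  gauss : AdditiveCharacter → Character → ℂ
  gauss θ χ = ∑F λ x → ⟦ χ ⟧ x * ⟦ θ ⟧₊ x

  #F : ℂ
  #F = ∑F λ _ → 1#

  #F-invertible : ∃[ z ] #F * z ≈ 1#
  #F-invertible = Complex.fromℚ (ℚ.1/ ι q) , (begin
      #F * Complex.fromℚ (ℚ.1/ ι q)                   ≈⟨ *-congʳ (ones q) ⟩
      Complex.fromℚ (ι q) * Complex.fromℚ (ℚ.1/ ι q)  ≈⟨ Complex.fromℚ-* (ι q) (ℚ.1/ ι q) ⟨
      Complex.fromℚ (ι q ℚ.* ℚ.1/ ι q)                ≡⟨ ≡.cong Complex.fromℚ (ℚ.*-inverseʳ (ι q)) ⟩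
      1#                                              ∎)
    where
    ι : ℕ → ℚ
    ι zero = 0ℚ
    ι (suc n) = 1ℚ ℚ.+ ι n
    ι-nonNeg : ∀ n → ℚ.NonNegative (ι n)
    ι-nonNeg zero = _
    ι-nonNeg (suc n) = ℚ.nonNeg+nonNeg⇒nonNeg 1ℚ (ι n) {{ι-nonNeg n}}
    ι-nonZero : ∀ n → Fin n → ℚ.NonZero (ι n)
    ι-nonZero (suc n) _ = ℚ.pos⇒nonZero (1ℚ ℚ.+ ι n) {{ℚ.pos+nonNeg⇒pos 1ℚ (ι n) {{ι-nonNeg n}}}}
    ones : ∀ n → sum {n} (λ _ → 1#) ≈ Complex.fromℚ (ι n)
    ones zero = ≈-refl
    ones (suc n) = trans (+-congˡ (ones n)) (sym (Complex.fromℚ-+ 1ℚ (ι n)))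
    instance
      _ : ℚ.NonZero (ι q)
      _ = ι-nonZero q (F.index F.0#)

  module _ (θ : AdditiveCharacter) (θ≢1 : NonTrivial θ) where

    private
      module θ = AdditiveCharacter θ

      g : Character → ℂ
      g = gauss θ

      -1F : F.Carrier
      -1F = F.- F.1#

      -1≉0 : ¬ (-1F F.≈ F.0#)
      -1≉0 p = F.0≉1 (F.trans (F.sym (F.-‿inverseʳ F.1#)) (F.trans (F.+-congˡ p) (F.+-identityʳ F.1#)))

    gauss-ε : g ε ≈ - 1#
    gauss-ε = RP.+-inverseˡ-unique (g ε) 1# (begin
      g ε + 1#                                             ≈⟨ +-congˡ ∑δ≈1 ⟨
      g ε + ∑F δ                                           ≈⟨ ∑-distrib-+ (λ k → ⟦ ε ⟧ (F.element k) * ⟦ θ ⟧₊ (F.element k)) (λ k → δ (F.element k)) ⟨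
      ∑F (λ x → ⟦ ε ⟧ x * ⟦ θ ⟧₊ x + δ x)                  ≈⟨ ∑F-cong split ⟩
      ∑F ⟦ θ ⟧₊                                            ≈⟨ ∑θ≈0 θ θ≢1 ⟩
      0#                                                   ∎)
      where
      module RP = RingProperties ring
      δ : F.Carrier → ℂ
      δ x with x F.≟ F.0#
      ... | yes _ = 1#
      ... | no  _ = 0#
      δ-1 : ∀ {x} → x F.≈ F.0# → δ x ≈ 1#
      δ-1 {x} x≈0 with x F.≟ F.0#
      ... | yes _ = ≈-refl
      ... | no x≉0 = contradiction x≈0 x≉0
      δ-0 : ∀ {x} → ¬ (x F.≈ F.0#) → δ x ≈ 0#
      δ-0 {x} x≉0 with x F.≟ F.0#
      ... | yes x≈0 = contradiction x≈0 x≉0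
      ... | no _ = ≈-refl
      δ-cong : ∀ {x y} → x F.≈ y → δ x ≈ δ y
      δ-cong {x} {y} x≈y with y F.≟ F.0#
      ... | yes y≈0 = δ-1 (F.trans x≈y y≈0)
      ... | no  y≉0 = δ-0 (λ x≈0 → y≉0 (F.trans (F.sym x≈y) x≈0))
      ∑δ≈1 : ∑F δ ≈ 1#
      ∑δ≈1 = trans (∑F-single F.0# δ-cong (λ x → δ-0)) (δ-1 F.refl)
      split : ∀ x → ⟦ ε ⟧ x * ⟦ θ ⟧₊ x + δ x ≈ ⟦ θ ⟧₊ x
      split x with x F.≟ F.0#
      ... | yes x≈0 = trans (+-congʳ (zeroˡ _)) (trans (+-identityˡ _) (sym (trans (θ.cong x≈0) θ.0-homo)))
      ... | no _ = trans (+-identityʳ _) (*-identityˡ _)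

    gauss-conj : ∀ χ → ¬ (χ ≋ ε) → g χ * g (χ ⁻¹) ≈ ⟦ χ ⟧ (F.- F.1#) * ∑F (λ _ → 1#)
    gauss-conj χ χ≢ε = begin
      g χ * g (χ ⁻¹)
        ≈⟨ *-comm _ _ ⟩
      g (χ ⁻¹) * g χ
        ≈⟨ *-distribʳ-sum (g χ) (λ k → ⟦ χ ⁻¹ ⟧ (F.element k) * ⟦ θ ⟧₊ (F.element k)) ⟩
      ∑F (λ y → ⟦ χ ⁻¹ ⟧ y * ⟦ θ ⟧₊ y * g χ)
        ≈⟨ ∑F-cong inner ⟩
      ∑F (λ y → ∑F λ z → ⟦ χ ⟧ z * ⟦ θ ⟧₊ ((z F.+ F.1#) F.* y))
        ≈⟨ ∑-comm (λ i j → ⟦ χ ⟧ (F.element j) * ⟦ θ ⟧₊ ((F.element j F.+ F.1#) F.* F.element i)) ⟩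
      ∑F (λ z → ∑F λ y → ⟦ χ ⟧ z * ⟦ θ ⟧₊ ((z F.+ F.1#) F.* y))
        ≈⟨ ∑F-cong (λ z → sym (*-distribˡ-sum (⟦ χ ⟧ z) (λ k → ⟦ θ ⟧₊ ((z F.+ F.1#) F.* F.element k)))) ⟩
      ∑F (λ z → ⟦ χ ⟧ z * T z)
        ≈⟨ ∑F-single -1F (λ x≈y → *-cong (χ.cong x≈y) (T-cong x≈y))
             (λ z z≉-1 → trans (*-congˡ (T-0 z (λ p → z≉-1 (FP.+-inverseˡ-unique z F.1# p)))) (zeroʳ _)) ⟩
      ⟦ χ ⟧ -1F * T -1F
        ≈⟨ *-congˡ (∑F-cong λ y → trans (θ.cong (F.trans (F.*-congʳ (F.-‿inverseˡ F.1#)) (F.zeroˡ y))) θ.0-homo) ⟩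
      ⟦ χ ⟧ -1F * ∑F (λ _ → 1#) ∎
      where
      module χ = Character χ
      module FP = RingProperties F.ring
      T : F.Carrier → ℂ
      T z = ∑F λ y → ⟦ θ ⟧₊ ((z F.+ F.1#) F.* y)
      T-cong : ∀ {x y} → x F.≈ y → T x ≈ T y
      T-cong {x} {y} x≈y = ∑F-cong {λ z → ⟦ θ ⟧₊ ((x F.+ F.1#) F.* z)} λ z → θ.cong (F.*-congʳ (F.+-congʳ x≈y))
      T-0 : ∀ z → ¬ (z F.+ F.1# F.≈ F.0#) → T z ≈ 0#
      T-0 z p = trans (sym (scale _ p ⟦ θ ⟧₊ θ.cong)) (∑θ≈0 θ θ≢1)
      inner : ∀ y → ⟦ χ ⁻¹ ⟧ y * ⟦ θ ⟧₊ y * g χ ≈ ∑F λ z → ⟦ χ ⟧ z * ⟦ θ ⟧₊ ((z F.+ F.1#) F.* y)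
      inner y with y F.≟ F.0#
      ... | yes y≈0 = begin
        ⟦ χ ⟧ F.0# * ⟦ θ ⟧₊ y * g χ ≈⟨ *-congʳ (*-congʳ χ.0-homo) ⟩
        0# * ⟦ θ ⟧₊ y * g χ         ≈⟨ *-congʳ (zeroˡ _) ⟩
        0# * g χ                    ≈⟨ zeroˡ _ ⟩
        0#                          ≈⟨ ∑χ≈0 χ χ≢ε ⟨
        ∑F ⟦ χ ⟧                    ≈⟨ ∑F-cong {λ z → ⟦ χ ⟧ z * ⟦ θ ⟧₊ ((z F.+ F.1#) F.* y)} (λ z → trans (*-congˡ (trans (θ.cong (F.trans (F.*-congˡ y≈0) (F.zeroʳ (z F.+ F.1#)))) θ.0-homo)) (*-identityʳ (⟦ χ ⟧ z))) ⟨
        ∑F (λ z → ⟦ χ ⟧ z * ⟦ θ ⟧₊ ((z F.+ F.1#) F.* y)) ∎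
      ... | no y≉0 = begin
        ⟦ χ ⟧ u * ⟦ θ ⟧₊ y * g χ
          ≈⟨ *-congˡ (scale y y≉0 (λ x → ⟦ χ ⟧ x * ⟦ θ ⟧₊ x) (λ p → *-cong (χ.cong p) (θ.cong p))) ⟩
        ⟦ χ ⟧ u * ⟦ θ ⟧₊ y * ∑F (λ z → ⟦ χ ⟧ (y F.* z) * ⟦ θ ⟧₊ (y F.* z))
          ≈⟨ *-distribˡ-sum _ (λ k → ⟦ χ ⟧ (y F.* F.element k) * ⟦ θ ⟧₊ (y F.* F.element k)) ⟩
        ∑F (λ z → ⟦ χ ⟧ u * ⟦ θ ⟧₊ y * (⟦ χ ⟧ (y F.* z) * ⟦ θ ⟧₊ (y F.* z)))
          ≈⟨ ∑F-cong (λ z → trans (interchange _ _ _ _) (*-cong (χ-part z) (θ-part z))) ⟩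
        ∑F (λ z → ⟦ χ ⟧ z * ⟦ θ ⟧₊ ((z F.+ F.1#) F.* y)) ∎
        where
        u : F.Carrier
        u = proj₁ (F.invertible y y≉0)
        χ-part : ∀ z → ⟦ χ ⟧ u * ⟦ χ ⟧ (y F.* z) ≈ ⟦ χ ⟧ z
        χ-part z = trans (sym (χ.*-homo _ _)) (χ.cong (F.trans (F.sym (F.*-assoc u y z))
          (F.trans (F.*-congʳ (F.trans (F.*-comm u y) (proj₂ (F.invertible y y≉0)))) (F.*-identityˡ z))))
        θ-part : ∀ z → ⟦ θ ⟧₊ y * ⟦ θ ⟧₊ (y F.* z) ≈ ⟦ θ ⟧₊ ((z F.+ F.1#) F.* y)
        θ-part z = trans (sym (θ.+-homo _ _)) (θ.cong (F.sym (F.trans (F.distribʳ y z F.1#)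
          (F.trans (F.+-comm _ _) (F.+-cong (F.*-identityˡ y) (F.*-comm z y))))))

    gauss-invertible : Decidable _≋_ → ∀ χ → ∃[ z ] g χ * z ≈ 1#
    gauss-invertible _≟_ χ with χ ≟ ε
    ... | yes χ≋ε = - 1# , (begin
      g χ * - 1#       ≈⟨ *-congʳ (trans (∑F-cong {λ x → ⟦ χ ⟧ x * ⟦ θ ⟧₊ x} λ x → *-congʳ (χ≋ε x)) gauss-ε) ⟩
      - 1# * - 1#      ≈⟨ RP.-‿distribˡ-* 1# (- 1#) ⟨
      - (1# * - 1#)    ≈⟨ -‿cong (*-identityˡ (- 1#)) ⟩
      - - 1#           ≈⟨ RP.-‿involutive 1# ⟩
      1#               ∎)
      where module RP = RingProperties ring
    ... | no χ≢ε = g (χ ⁻¹) * (⟦ χ ⟧ -1F * 1/q) , (begin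
      g χ * (g (χ ⁻¹) * (⟦ χ ⟧ -1F * 1/q))            ≈⟨ *-assoc _ _ _ ⟨
      g χ * g (χ ⁻¹) * (⟦ χ ⟧ -1F * 1/q)              ≈⟨ *-congʳ (gauss-conj χ χ≢ε) ⟩
      ⟦ χ ⟧ -1F * #F * (⟦ χ ⟧ -1F * 1/q)              ≈⟨ interchange _ _ _ _ ⟩
      ⟦ χ ⟧ -1F * ⟦ χ ⟧ -1F * (#F * 1/q)              ≈⟨ *-cong (sym (χ.*-homo _ _)) (proj₂ #F-invertible) ⟩
      ⟦ χ ⟧ (-1F F.* -1F) * 1#                        ≈⟨ *-identityʳ _ ⟩
      ⟦ χ ⟧ (-1F F.* -1F)                             ≈⟨ χ.cong -1*-1≈1 ⟩
      ⟦ χ ⟧ F.1#                                      ≈⟨ χ.1-homo ⟩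
      1#                                              ∎)
      where
      module χ = Character χ
      module FP = RingProperties F.ring
      1/q : ℂ
      1/q = proj₁ #F-invertible
      -1*-1≈1 : -1F F.* -1F F.≈ F.1#
      -1*-1≈1 = F.trans (F.sym (FP.-‿distribˡ-* F.1# -1F))
        (F.trans (F.-‿cong (F.*-identityˡ -1F)) (FP.-‿involutive F.1#))

  -- Sums over the character group run over a listing of its q - 1 elements
  -- without repetition. They do not depend on the listing chosen.
  CharacterListing : Set (c ⊔ ℓ)
  CharacterListing = Inverse (≡.setoid (Fin (q ℕ.∸ 1))) (AbelianGroup.setoid characterGroup)

module Hypergeometric
  {c ℓ : Level} {q : ℕ} (𝔽 : FiniteField c ℓ q)
  (listing : Characters.CharacterListing 𝔽)
  (θ : Characters.AdditiveCharacter 𝔽) (θ≢1 : Characters.NonTrivial 𝔽 θ)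
  where

  open CommutativeRing Complex.commutativeRing using (_≈_; _*_; 0#; 1#; *-rawMonoid; semiring)
  open SemiringSum semiring
  open Characters 𝔽
  private module F = FiniteField 𝔽

  infix 4 _≟_
  _≟_ : Decidable _≋_
  χ ≟ ψ = map′
    (λ eq x → trans (sym (to-from χ x)) (trans (Inverse.to-cong listing eq x) (to-from ψ x)))
    (Inverse.from-cong listing)
    (Inverse.from listing χ Fin.≟ Inverse.from listing ψ)
    where
    open CommutativeRing Complex.commutativeRing using (sym; trans)
    to-from : ∀ χ → Inverse.to listing (Inverse.from listing χ) ≋ χ
    to-from χ = Inverse.inverseˡ listing ≡.refl

  ∑Ĝ : (Character → ℂ) → ℂ
  ∑Ĝ f = ∑[ k < q ℕ.∸ 1 ] f (Inverse.to listing k)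

  ∑√ : Character → (Character → ℂ) → ℂ
  ∑√ S f = ∑Ĝ λ R → if does (R ^ 2 ≟ S) then f R else 0#

  syntax ∑√ S (λ R → e) = ∑[ R ²= S ] e

  g : Character → ℂ
  g = gauss θ

  -- z /g χ is the quotient z / g(χ); every Gauss sum is invertible.
  infixl 7 _/g_
  _/g_ : ℂ → Character → ℂ
  z /g χ = z * proj₁ (gauss-invertible θ θ≢1 _≟_ χ)

  ∏ : ∀ {n} → Vec ℂ n → ℂ
  ∏ = Vec.foldr _ _*_ 1#

  factor : Character → Character → Character → ℂ
  factor χ A B = g (A · χ) /g A * (g ((B · χ) ⁻¹) /g (B ⁻¹))

  ₘFₘ : ∀ {m} → Vec Character m → Vec Character m → F.Carrier → ℂ
  ₘFₘ {m} As Bs t = Complex.fromℚ ((ℤ.- ℤ.1ℤ) ℚ./ (q ℕ.∸ 1)) *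
      ∑Ĝ λ χ → ∏ (Vec.zipWith (factor χ) As Bs) * ⟦ χ ⟧ (F.- F.1#) ^ᶜ m * ⟦ χ ⟧ t
    where
    open RawSemiringDefinitions (Semiring.rawSemiring semiring) using () renaming (_^_ to _^ᶜ_)
    instance
      q-1≢0 : ℕ.NonZero (q ℕ.∸ 1)
      q-1≢0 = q∸1-nonZero 𝔽

  ₃F₂ : (A₁ A₂ A₃ B₂ B₃ : Character) → F.Carrier → ℂ
  ₃F₂ A₁ A₂ A₃ B₂ B₃ = ₘFₘ (A₁ ∷ A₂ ∷ A₃ ∷ []) (ε ∷ B₂ ∷ B₃ ∷ [])

{-# OPTIONS --safe #-}
module Submission where

open import Defs
open import Algebra.Bundles using (AbelianGroup; CommutativeRing)
import Algebra.Definitions.RawMonoid as RawMonoidDefinitions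
import Algebra.Properties.AbelianGroup as AbelianGroupProperties
import Algebra.Properties.CommutativeSemigroup as CommutativeSemigroupProperties
import Algebra.Properties.Monoid.Mult as MultProperties
import Algebra.Properties.Ring as RingProperties
import Algebra.Properties.Semiring.Sum as SemiringSum
import Algebra.Solver.CommutativeMonoid as CommutativeMonoidSolver
import Algebra.Solver.CommutativeMonoid.Normal as CommutativeMonoidNormal
open import Data.Bool.Base using (if_then_else_)
open import Data.Fin.Base using (Fin; zero; suc)
open import Data.Fin.Permutation using (permutation)
import Data.Fin.Properties as Fin
import Data.Integer.Base as ℤ
import Data.Integer.Properties as ℤ
open import Data.Nat.Base as ℕ using (ℕ; zero; suc; _%_)
import Data.Nat.Properties as ℕ
open import Data.Product.Base using (∃-syntax; _×_; _,_; proj₁; proj₂)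
open import Data.Rational.Base as ℚ using (ℚ; 0ℚ; 1ℚ)
import Data.Rational.Properties as ℚ
import Data.Rational.Unnormalised.Base as ℚᵘ
import Data.Rational.Unnormalised.Properties as ℚᵘ
open import Data.Sum.Base using (_⊎_; inj₁; inj₂)
open import Data.Vec.Base using (Vec; []; _∷_; lookup)
open import Function.Bundles using (Inverse)
open import Level using (Level; _⊔_)
open import Relation.Binary.PropositionalEquality as ≡ using (_≡_)
import Relation.Binary.Reasoning.Setoid as SetoidReasoning
open import Relation.Nullary using (¬_; Dec; yes; no; contradiction; does)
open import Relation.Nullary.Decidable using (True; toWitness)

-- By the quadratic Davenport–Hasse formula, applied twice, the summand of the
-- ₈F₈ at χ depends on χ⁴ only. Since a character ψ has 1 + ψ(-1) square roots,
-- the sum splits into a ₂F₁ at 1, the same ₂F₁ at -1 and a well-poised ₄F₃ at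
-- -1, which the analogues of the theorems of Gauss, Kummer and Whipple turn into
-- the three terms of the right-hand side.
--
-- Sums over χ are evaluated by expanding
--   g(Aχ) g(Cχ̄) = Σ_s (Aχ)(s) τ(AC, 1 + s),   τ(P, k) = Σ_z P(z) θ(kz),
-- and using orthogonality in χ. One such expansion gives Barnes' first lemma,
-- which contains Gauss's theorem, and another gives Kummer's theorem. Barnes'
-- lemma followed by Kummer's theorem gives Dixon's theorem, and Barnes' lemma
-- followed by Dixon's theorem gives Whipple's.

-- The trivial character shapes the proof: g(χ)g(χ̄) = χ(-1)q fails at χ = ε, and τ(P,0) vanishes
-- only for P ≠ ε. Barnes' lemma for four parameters with product P therefore wants P ≠ ε. In the
-- outer applications the hypotheses provide this: P is B⁸ in Gauss's theorem and φB⁴/A² in the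
-- first step of Whipple's, while A⁴ ≠ ε keeps the well-poised parameter a and its square roots R
-- non-trivial. The innermost Barnes sum in Whipple's theorem has a P that moves with the summation
-- variable and does meet ε, so a form of the lemma is needed that survives there. No generator of
-- 𝔽* is used, only the number of characters, and equality in ℂ is merely stable under double
-- negation. Column orthogonality and the count 1 + φ(v) of square roots both come from one device:
-- natural numbers with sum 0 all vanish. Whipple's theorem is applied with c = φA². Its partner a/c
-- is then φ, the last lower parameter of the ₃F₂, and R/c is the first upper parameter RφA⁻².

-- Decides equations in abelian groups: u p⁻¹ = v r⁻¹ with u, p, v, r free of
-- inverses amounts to the equation u r = v p between bags of variables.
module AbelianGroupSolver {c ℓ} (G : AbelianGroup c ℓ) where

  open AbelianGroup G
  open RawMonoidDefinitions rawMonoid using (_×_)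
  open AbelianGroupProperties G using (⁻¹-∙-comm; ⁻¹-involutive; ε⁻¹≈ε; ∙-cancelʳ)
  open CommutativeSemigroupProperties commutativeSemigroup using (interchange; xy∙z≈xz∙y)
  open SetoidReasoning setoid
  private module CM = CommutativeMonoidNormal commutativeMonoid

  infixl 7 _⊙_
  infix 9 _⁻
  infixr 8 _↑_

  data Expr (n : ℕ) : Set where
    var : Fin n → Expr n
    ι   : Expr n
    _⊙_ : Expr n → Expr n → Expr n
    _⁻  : Expr n → Expr n

  x₀ : ∀ {n} → Expr (suc n)
  x₀ = var zero

  x₁ : ∀ {n} → Expr (suc (suc n))
  x₁ = var (suc zero)

  x₂ : ∀ {n} → Expr (suc (suc (suc n)))
  x₂ = var (suc (suc zero))

  x₃ : ∀ {n} → Expr (suc (suc (suc (suc n))))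
  x₃ = var (suc (suc (suc zero)))

  _↑_ : ∀ {n} → Expr n → ℕ → Expr n
  e ↑ zero  = ι
  e ↑ suc n = e ⊙ (e ↑ n)

  ⟦_⟧ₑ : ∀ {n} → Expr n → Vec Carrier n → Carrier
  ⟦ var i ⟧ₑ ρ = lookup ρ i
  ⟦ ι ⟧ₑ ρ     = ε
  ⟦ e ⊙ f ⟧ₑ ρ = ⟦ e ⟧ₑ ρ ∙ ⟦ f ⟧ₑ ρ
  ⟦ e ⁻ ⟧ₑ ρ   = ⟦ e ⟧ₑ ρ ⁻¹

  private
    pos neg : ∀ {n} → Expr n → CM.Expr n
    pos (var i) = CM.var i
    pos ι       = CM.id
    pos (e ⊙ f) = pos e CM.⊕ pos f
    pos (e ⁻)   = neg e
    neg (var i) = CM.id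
    neg ι       = CM.id
    neg (e ⊙ f) = neg e CM.⊕ neg f
    neg (e ⁻)   = pos e

  -- Evaluates to the unit type when the two bags agree, so the implicit argument of `solve` is
  -- found by computation.
  Balanced : ∀ {n} → Expr n → Expr n → Set
  Balanced e f = True (CM.normalise (pos e CM.⊕ neg f) CM.≟ CM.normalise (pos f CM.⊕ neg e))

  private
    split : ∀ {n} (e : Expr n) ρ → ⟦ e ⟧ₑ ρ ≈ CM.⟦ pos e ⟧ ρ ∙ CM.⟦ neg e ⟧ ρ ⁻¹
    split (var i) ρ = sym (trans (∙-congˡ ε⁻¹≈ε) (identityʳ _))
    split ι       ρ = sym (trans (∙-congˡ ε⁻¹≈ε) (identityʳ _))
    split (e ⊙ f) ρ = begin
      ⟦ e ⟧ₑ ρ ∙ ⟦ f ⟧ₑ ρ                   ≈⟨ ∙-cong (split e ρ) (split f ρ) ⟩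
      (pe ∙ ne ⁻¹) ∙ (pf ∙ nf ⁻¹)           ≈⟨ interchange pe (ne ⁻¹) pf (nf ⁻¹) ⟩
      (pe ∙ pf) ∙ (ne ⁻¹ ∙ nf ⁻¹)           ≈⟨ ∙-congˡ (⁻¹-∙-comm ne nf) ⟩
      (pe ∙ pf) ∙ (ne ∙ nf) ⁻¹              ∎
      where
      pe pf ne nf : Carrier
      pe = CM.⟦ pos e ⟧ ρ
      pf = CM.⟦ pos f ⟧ ρ
      ne = CM.⟦ neg e ⟧ ρ
      nf = CM.⟦ neg f ⟧ ρ
    split (e ⁻) ρ = begin
      ⟦ e ⟧ₑ ρ ⁻¹               ≈⟨ ⁻¹-cong (split e ρ) ⟩
      (pe ∙ ne ⁻¹) ⁻¹           ≈⟨ ⁻¹-∙-comm pe (ne ⁻¹) ⟨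
      pe ⁻¹ ∙ ne ⁻¹ ⁻¹          ≈⟨ ∙-congˡ (⁻¹-involutive ne) ⟩
      pe ⁻¹ ∙ ne                ≈⟨ comm _ _ ⟩
      ne ∙ pe ⁻¹                ∎
      where
      pe ne : Carrier
      pe = CM.⟦ pos e ⟧ ρ
      ne = CM.⟦ neg e ⟧ ρ

    balance : ∀ {x y u v} → x ∙ v ≈ u ∙ y → x ∙ y ⁻¹ ≈ u ∙ v ⁻¹
    balance {x} {y} {u} {v} eq = ∙-cancelʳ v _ _ (begin
      x ∙ y ⁻¹ ∙ v     ≈⟨ xy∙z≈xz∙y x (y ⁻¹) v ⟩
      x ∙ v ∙ y ⁻¹     ≈⟨ ∙-congʳ eq ⟩
      u ∙ y ∙ y ⁻¹     ≈⟨ trans (assoc u y _) (∙-congˡ (inverseʳ y)) ⟩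
      u ∙ ε            ≈⟨ ∙-congˡ (inverseˡ v) ⟨
      u ∙ (v ⁻¹ ∙ v)   ≈⟨ assoc u _ v ⟨
      u ∙ v ⁻¹ ∙ v     ∎)

  solve : ∀ {n} (ρ : Vec Carrier n) (e f : Expr n) →
          {_ : Balanced e f} →
          ⟦ e ⟧ₑ ρ ≈ ⟦ f ⟧ₑ ρ
  solve ρ e f {eq} = begin
    ⟦ e ⟧ₑ ρ                                 ≈⟨ split e ρ ⟩
    CM.⟦ pos e ⟧ ρ ∙ CM.⟦ neg e ⟧ ρ ⁻¹       ≈⟨ balance (begin
      CM.⟦ pos e CM.⊕ neg f ⟧ ρ                   ≈⟨ CM.correct (pos e CM.⊕ neg f) ρ ⟨
      CM.⟦ CM.normalise (pos e CM.⊕ neg f) ⟧⇓ ρ   ≡⟨ ≡.cong (λ v → CM.⟦ v ⟧⇓ ρ) (toWitness eq) ⟩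
      CM.⟦ CM.normalise (pos f CM.⊕ neg e) ⟧⇓ ρ   ≈⟨ CM.correct (pos f CM.⊕ neg e) ρ ⟩
      CM.⟦ pos f CM.⊕ neg e ⟧ ρ                   ∎) ⟩
    CM.⟦ pos f ⟧ ρ ∙ CM.⟦ neg f ⟧ ρ ⁻¹       ≈⟨ split f ρ ⟨
    ⟦ f ⟧ₑ ρ                                 ∎

-- Natural numbers inside ℂ

module ComplexNaturals where

  open CommutativeRing Complex.commutativeRing hiding (Carrier; zero)
  open SemiringSum semiring
  open MultProperties +-monoid using (×-homo-+) renaming (_×_ to _⊗_)
  open SetoidReasoning setoid
  private module RP = RingProperties ring

  -- Constructively z ≠ 0 alone gives no inverse of z; the absence of zero divisors does the work
  -- instead.
  cancelˡ : ∀ {z u v} → ¬ (z ≈ 0#) → z * u ≈ z * v → u ≈ v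
  cancelˡ {z} {u} {v} z≉0 eq = RP.x∙y⁻¹≈ε⇒x≈y u v (Complex.z≉0,zw≈0⇒w≈0 z≉0 (begin
    z * (u - v)        ≈⟨ distribˡ z u (- v) ⟩
    z * u + z * - v    ≈⟨ +-cong eq (sym (RP.-‿distribʳ-* z v)) ⟩
    z * v - z * v      ≈⟨ -‿inverseʳ (z * v) ⟩
    0#                 ∎))

  unit⇒≉0 : ¬ (1# ≈ 0#) → ∀ {z w} → z * w ≈ 1# → ¬ (z ≈ 0#)
  unit⇒≉0 1≉0 zw≈1 z≈0 = 1≉0 (trans (sym zw≈1) (trans (*-congʳ z≈0) (zeroˡ _)))

  fromℕ : ℕ → ℚ
  fromℕ zero = 0ℚ
  fromℕ (suc n) = 1ℚ ℚ.+ fromℕ n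

  fromℕ-nonNeg : ∀ n → ℚ.NonNegative (fromℕ n)
  fromℕ-nonNeg zero = _
  fromℕ-nonNeg (suc n) = ℚ.nonNeg+nonNeg⇒nonNeg 1ℚ (fromℕ n) {{fromℕ-nonNeg n}}

  fromℕ-nonZero : ∀ n → ℚ.NonZero (fromℕ (suc n))
  fromℕ-nonZero n = ℚ.pos⇒nonZero (1ℚ ℚ.+ fromℕ n) {{ℚ.pos+nonNeg⇒pos 1ℚ (fromℕ n) {{fromℕ-nonNeg n}}}}

  ⊗1≈fromℚ : ∀ n → n ⊗ 1# ≈ Complex.fromℚ (fromℕ n)
  ⊗1≈fromℚ zero = refl
  ⊗1≈fromℚ (suc n) = trans (+-congˡ (⊗1≈fromℚ n)) (sym (Complex.fromℚ-+ 1ℚ (fromℕ n)))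

  toℚᵘ-fromℕ : ∀ n → ℚ.toℚᵘ (fromℕ n) ℚᵘ.≃ ℚᵘ.mkℚᵘ (ℤ.+ n) 0
  toℚᵘ-fromℕ zero = ℚᵘ.≃-refl
  toℚᵘ-fromℕ (suc n) = ℚᵘ.≃-trans (ℚ.toℚᵘ-homo-+ 1ℚ (fromℕ n))
    (ℚᵘ.≃-trans (ℚᵘ.+-congʳ (ℚ.toℚᵘ 1ℚ) (toℚᵘ-fromℕ n))
      (ℚᵘ.*≡* (≡.trans (ℤ.*-identityʳ _) (≡.trans (≡.cong (λ i → ℤ.1ℤ ℤ.+ i) (ℤ.*-identityʳ (ℤ.+ n)))
        (≡.sym (ℤ.*-identityʳ (ℤ.+ suc n)))))))

  -1/n*n≡-1 : ∀ n .{{_ : ℕ.NonZero n}} → ((ℤ.- ℤ.1ℤ) ℚ./ n) ℚ.* fromℕ n ≡ ℚ.- 1ℚ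
  -1/n*n≡-1 (suc k) = ℚ.toℚᵘ-injective (ℚᵘ.≃-trans (ℚ.toℚᵘ-homo-* ((ℤ.- ℤ.1ℤ) ℚ./ suc k) (fromℕ (suc k)))
    (ℚᵘ.≃-trans (ℚᵘ.*-cong (ℚ.toℚᵘ-fromℚᵘ (ℚᵘ.mkℚᵘ (ℤ.- ℤ.1ℤ) k)) (toℚᵘ-fromℕ (suc k)))
      (ℚᵘ.*≡* (≡.trans (ℤ.*-identityʳ _) (≡.cong (λ d → ℤ.- ℤ.1ℤ ℤ.* ℤ.+ d) (≡.cong suc (≡.sym (ℕ.*-identityʳ k))))))))

  fromℚ-1≈-1 : Complex.fromℚ (ℚ.- 1ℚ) ≈ - 1#
  fromℚ-1≈-1 = RP.+-inverseˡ-unique _ _ (trans (sym (Complex.fromℚ-+ (ℚ.- 1ℚ) 1ℚ))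
    (reflexive (≡.cong Complex.fromℚ (ℚ.+-inverseˡ 1ℚ))))

  -1/n*n⊗1≈-1 : ∀ n .{{_ : ℕ.NonZero n}} → Complex.fromℚ ((ℤ.- ℤ.1ℤ) ℚ./ n) * (n ⊗ 1#) ≈ - 1#
  -1/n*n⊗1≈-1 n = begin
    Complex.fromℚ ((ℤ.- ℤ.1ℤ) ℚ./ n) * (n ⊗ 1#)                        ≈⟨ *-congˡ (⊗1≈fromℚ n) ⟩
    Complex.fromℚ ((ℤ.- ℤ.1ℤ) ℚ./ n) * Complex.fromℚ (fromℕ n)         ≈⟨ Complex.fromℚ-* _ _ ⟨
    Complex.fromℚ (((ℤ.- ℤ.1ℤ) ℚ./ n) ℚ.* fromℕ n)                     ≡⟨ ≡.cong Complex.fromℚ (-1/n*n≡-1 n) ⟩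
    Complex.fromℚ (ℚ.- 1ℚ)                                             ≈⟨ fromℚ-1≈-1 ⟩
    - 1#                                                               ∎

  IsNatural : ℂ → Set
  IsNatural z = ∃[ k ] z ≈ k ⊗ 1#

  module _ (1≉0 : ¬ (1# ≈ 0#)) where

    suc⊗1≉0 : ∀ n → ¬ (suc n ⊗ 1# ≈ 0#)
    suc⊗1≉0 n = unit⇒≉0 1≉0 {w = Complex.fromℚ (ℚ.1/ fromℕ (suc n))} (begin
      suc n ⊗ 1# * Complex.fromℚ (ℚ.1/ fromℕ (suc n))                   ≈⟨ *-congʳ (⊗1≈fromℚ (suc n)) ⟩
      Complex.fromℚ (fromℕ (suc n)) * Complex.fromℚ (ℚ.1/ fromℕ (suc n)) ≈⟨ Complex.fromℚ-* (fromℕ (suc n)) (ℚ.1/ fromℕ (suc n)) ⟨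
      Complex.fromℚ (fromℕ (suc n) ℚ.* ℚ.1/ fromℕ (suc n))              ≡⟨ ≡.cong Complex.fromℚ (ℚ.*-inverseʳ (fromℕ (suc n))) ⟩
      1#                                                                ∎)
      where
      instance
        _ : ℚ.NonZero (fromℕ (suc n))
        _ = fromℕ-nonZero n

    naturals-+≈0 : ∀ {z w} → IsNatural z → IsNatural w → z + w ≈ 0# → z ≈ 0#
    naturals-+≈0 (zero , z≈0) _ _ = z≈0
    naturals-+≈0 {z} {w} (suc k , z≈k) (l , w≈l) z+w≈0 = contradiction (begin
      (suc k ℕ.+ l) ⊗ 1#        ≈⟨ ×-homo-+ 1# (suc k) l ⟩
      suc k ⊗ 1# + l ⊗ 1#       ≈⟨ +-cong z≈k w≈l ⟨
      z + w                     ≈⟨ z+w≈0 ⟩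
      0#                        ∎) (suc⊗1≉0 (k ℕ.+ l))

    -- The double negation is all that is available for the summands to come, since it is not
    -- decidable which of them are zero.
    sum-natural : ∀ {n} (t : Fin n → ℂ) → (∀ i → ¬ ¬ IsNatural (t i)) → ¬ ¬ IsNatural (sum t)
    sum-natural {zero} t nat ¬p = ¬p (0 , refl)
    sum-natural {suc n} t nat ¬p = nat zero λ (k , t₀≈k) →
      sum-natural (λ i → t (suc i)) (λ i → nat (suc i)) λ (l , ∑≈l) →
        ¬p (k ℕ.+ l , trans (+-cong t₀≈k ∑≈l) (sym (×-homo-+ 1# k l)))

    -- Natural numbers cannot cancel: a positive term would make the total a positive multiple of 1.
    -- Stability of `≈` discharges the double negations.
    sum≈0⇒≈0 : ∀ {n} (t : Fin n → ℂ) → (∀ i → ¬ ¬ IsNatural (t i)) → sum t ≈ 0# → ∀ i → t i ≈ 0#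
    sum≈0⇒≈0 t nat ∑≈0 zero = Complex.≈-stable λ ¬p → nat zero λ N₀ →
      sum-natural (λ i → t (suc i)) (λ i → nat (suc i)) λ Nₛ → ¬p (naturals-+≈0 N₀ Nₛ ∑≈0)
    sum≈0⇒≈0 t nat ∑≈0 (suc i) = sum≈0⇒≈0 (λ i → t (suc i)) (λ i → nat (suc i))
      (trans (sym (+-identityˡ _)) (trans (+-congʳ (sym (sum≈0⇒≈0 t nat ∑≈0 zero))) ∑≈0)) i

-- Sums over the field and over the character group

module Proof
  {c ℓ : Level} {q : ℕ} (𝔽 : FiniteField c ℓ q)
  (listing : Characters.CharacterListing 𝔽)
  (θ : Characters.AdditiveCharacter 𝔽) (θ≢1 : Characters.NonTrivial 𝔽 θ)
  where

  open CommutativeRing Complex.commutativeRing hiding (Carrier; zero) renaming (refl to ≈-refl)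
  open SemiringSum semiring
  open MultProperties +-monoid using () renaming (_×_ to _⊗_)
  open SetoidReasoning setoid
  open Characters 𝔽
  open Hypergeometric 𝔽 listing θ θ≢1
  open ComplexNaturals
  private
    module F = FiniteField 𝔽
    module FP = RingProperties F.ring
    module RP = RingProperties ring
    module Ĝ = AbelianGroup characterGroup
    module CS = CommutativeMonoidSolver *-commutativeMonoid
    module GS = AbelianGroupSolver characterGroup
    module θ = AdditiveCharacter θ
  open CS using (_⊕_; _⊜_)
  open GS using (_⊙_; _⁻; _↑_; x₀; x₁; x₂; x₃)

  Congruent : (F.Carrier → ℂ) → Set (c ⊔ ℓ)
  Congruent f = ∀ {x y} → x F.≈ y → f x ≈ f y

  Congruent^ : (Character → ℂ) → Set (c ⊔ ℓ)
  Congruent^ f = ∀ χ ψ → χ ≋ ψ → f χ ≈ f ψ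

  -- If ℂ collapsed, every value of θ would equal 1, against the non-triviality of θ.
  1≉0 : ¬ (1# ≈ 0#)
  1≉0 1≈0 = θ≢1 λ x → trans (sym (*-identityʳ _)) (trans (trans (*-congˡ 1≈0) (zeroʳ _)) (sym 1≈0))

  -- Opaque, so that unification can read off the summands.
  opaque

    Σ : (F.Carrier → ℂ) → ℂ
    Σ = ∑F

    Σ̂ : (Character → ℂ) → ℂ
    Σ̂ = ∑Ĝ

    Σ-def : ∀ f → Σ f ≈ ∑F f
    Σ-def f = ≈-refl

    Σ̂-def : ∀ f → Σ̂ f ≈ ∑Ĝ f
    Σ̂-def f = ≈-refl

    Σ-cong : ∀ {f h} → (∀ x → f x ≈ h x) → Σ f ≈ Σ h
    Σ-cong {f} {h} = ∑F-cong {f} {h}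

    Σ̂-cong : ∀ {f h} → (∀ χ → f χ ≈ h χ) → Σ̂ f ≈ Σ̂ h
    Σ̂-cong eq = sum-cong-≋ λ k → eq (Inverse.to listing k)

    Σ-zero : ∀ {f} → (∀ x → f x ≈ 0#) → Σ f ≈ 0#
    Σ-zero {f} = ∑F-zero {f}

    Σ-single : ∀ {f} a → Congruent f → (∀ x → ¬ (x F.≈ a) → f x ≈ 0#) → Σ f ≈ f a
    Σ-single = ∑F-single

    Σ-scale : ∀ {f} a → ¬ (a F.≈ F.0#) → Congruent f → Σ f ≈ Σ λ x → f (a F.* x)
    Σ-scale {f} a a≉0 = scale a a≉0 f

    Σ-shift : ∀ {f} a → Congruent f → Σ f ≈ Σ λ x → f (a F.+ x)
    Σ-shift {f} a = shift a f

    Σ-involution : ∀ {f} (h : F.Carrier → F.Carrier) → Congruent f →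
                   (∀ {x y} → x F.≈ y → h x F.≈ h y) → (∀ x → h (h x) F.≈ x) →
                   Σ f ≈ Σ λ x → f (h x)
    Σ-involution h f-cong h-cong hh = ∑F-reindex h h f-cong h-cong h-cong hh hh

    Σ-distrib-+ : ∀ f h → Σ (λ x → f x + h x) ≈ Σ f + Σ h
    Σ-distrib-+ f h = ∑-distrib-+ (λ k → f (F.element k)) (λ k → h (F.element k))

    Σ̂-distrib-+ : ∀ f h → Σ̂ (λ χ → f χ + h χ) ≈ Σ̂ f + Σ̂ h
    Σ̂-distrib-+ f h = ∑-distrib-+ (λ k → f (Inverse.to listing k)) (λ k → h (Inverse.to listing k))

    *-Σ : ∀ z f → z * Σ f ≈ Σ λ x → z * f x
    *-Σ z f = *-distribˡ-sum z (λ k → f (F.element k))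

    *-Σ̂ : ∀ z f → z * Σ̂ f ≈ Σ̂ λ χ → z * f χ
    *-Σ̂ z f = *-distribˡ-sum z (λ k → f (Inverse.to listing k))

    Σ-comm : (f : F.Carrier → F.Carrier → ℂ) → Σ (λ x → Σ λ y → f x y) ≈ Σ λ y → Σ λ x → f x y
    Σ-comm f = ∑-comm (λ i j → f (F.element i) (F.element j))

    Σ̂-comm : (f : Character → Character → ℂ) → Σ̂ (λ χ → Σ̂ λ ψ → f χ ψ) ≈ Σ̂ λ ψ → Σ̂ λ χ → f χ ψ
    Σ̂-comm f = ∑-comm (λ i j → f (Inverse.to listing i) (Inverse.to listing j))

    Σ̂Σ-comm : (f : Character → F.Carrier → ℂ) → Σ̂ (λ χ → Σ λ x → f χ x) ≈ Σ λ x → Σ̂ λ χ → f χ x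
    Σ̂Σ-comm f = ∑-comm (λ i j → f (Inverse.to listing i) (F.element j))

    Σ-1 : Σ (λ _ → 1#) ≈ q ⊗ 1#
    Σ-1 = sum-replicate q {1#}

    Σ̂-1 : Σ̂ (λ _ → 1#) ≈ (q ℕ.∸ 1) ⊗ 1#
    Σ̂-1 = sum-replicate (q ℕ.∸ 1) {1#}

    Σ≈0⇒≈0 : ∀ {f} → Congruent f → (∀ x → ¬ ¬ IsNatural (f x)) → Σ f ≈ 0# → ∀ x → f x ≈ 0#
    Σ≈0⇒≈0 {f} f-cong nat ∑≈0 x = trans (f-cong (F.sym (F.element-index x)))
      (sum≈0⇒≈0 1≉0 (λ k → f (F.element k)) (λ k → nat (F.element k)) ∑≈0 (F.index x))

    Σ-χ≈0 : ∀ χ → ¬ (χ ≋ ε) → Σ ⟦ χ ⟧ ≈ 0#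
    Σ-χ≈0 = ∑χ≈0

    Σ̂-single : ∀ {f} α → Congruent^ f → (∀ χ → ¬ (χ ≋ α) → f χ ≈ 0#) → Σ̂ f ≈ f α
    Σ̂-single {f} α f-cong f≈0 = trans
      (sum-single (λ k → f (to k)) (from α) λ j j≢ → f≈0 (to j) λ eq →
        j≢ (≡.trans (≡.sym (Inverse.inverseʳ listing (Ĝ.refl {to j}))) (Inverse.from-cong listing {to j} {α} eq)))
      (f-cong (to (from α)) α (Inverse.inverseˡ listing ≡.refl))
      where
      to : Fin (q ℕ.∸ 1) → Character
      to = Inverse.to listing
      from : Character → Fin (q ℕ.∸ 1)
      from = Inverse.from listing

    Σ̂-reindex : ∀ {f} (h h′ : Character → Character) → Congruent^ f →
                (∀ χ ψ → χ ≋ ψ → h χ ≋ h ψ) → (∀ χ ψ → χ ≋ ψ → h′ χ ≋ h′ ψ) →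
                (∀ χ → h (h′ χ) ≋ χ) → (∀ χ → h′ (h χ) ≋ χ) → Σ̂ f ≈ Σ̂ λ χ → f (h χ)
    Σ̂-reindex {f} h h′ f-cong h-cong h′-cong hh′ h′h = trans
      (sum-permute (λ k → f (to k)) (permutation
        (λ i → from (h (to i))) (λ i → from (h′ (to i)))
        (λ i → ≡.trans (Inverse.from-cong listing {h (to (from (h′ (to i))))} {to i}
                  (Ĝ.trans {h (to (from (h′ (to i))))} {h (h′ (to i))} {to i}
                    (h-cong (to (from (h′ (to i)))) (h′ (to i)) (to-from (h′ (to i)))) (hh′ (to i)))) (from-to i))
        (λ i → ≡.trans (Inverse.from-cong listing {h′ (to (from (h (to i))))} {to i}
                  (Ĝ.trans {h′ (to (from (h (to i))))} {h′ (h (to i))} {to i}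
                    (h′-cong (to (from (h (to i)))) (h (to i)) (to-from (h (to i)))) (h′h (to i)))) (from-to i))))
      (sum-cong-≋ λ k → f-cong (to (from (h (to k)))) (h (to k)) (to-from (h (to k))))
      where
      to : Fin (q ℕ.∸ 1) → Character
      to = Inverse.to listing
      from : Character → Fin (q ℕ.∸ 1)
      from = Inverse.from listing
      to-from : ∀ χ → to (from χ) ≋ χ
      to-from χ = Inverse.inverseˡ listing ≡.refl
      from-to : ∀ k → from (to k) ≡ k
      from-to k = Inverse.inverseʳ listing (Ĝ.refl {to k})

  Σ-* : ∀ z f → Σ f * z ≈ Σ λ x → f x * z
  Σ-* z f = trans (*-comm _ z) (trans (*-Σ z f) (Σ-cong λ x → *-comm z (f x)))

  Σ̂-* : ∀ z f → Σ̂ f * z ≈ Σ̂ λ χ → f χ * z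
  Σ̂-* z f = trans (*-comm _ z) (trans (*-Σ̂ z f) (Σ̂-cong λ χ → *-comm z (f χ)))

  Σ-*-Σ : ∀ f h → Σ f * Σ h ≈ Σ λ x → Σ λ y → f x * h y
  Σ-*-Σ f h = trans (Σ-* (Σ h) f) (Σ-cong λ x → *-Σ (f x) h)

  Σ-neg : ∀ {f} → Congruent f → Σ f ≈ Σ λ x → f (F.- x)
  Σ-neg f-cong = Σ-involution F.-_ f-cong F.-‿cong FP.-‿involutive

  -- Orthogonality of characters

  -- This is q - 1, kept as a sum over the characters because interchanges of summation produce it
  -- in this form.
  N : ℂ
  N = Σ̂ λ _ → 1#

  δ : F.Carrier → F.Carrier → ℂ
  δ x y with x F.≟ y
  ... | yes _ = 1#
  ... | no  _ = 0#

  δ-1 : ∀ {x y} → x F.≈ y → δ x y ≈ 1#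
  δ-1 {x} {y} x≈y with x F.≟ y
  ... | yes _   = ≈-refl
  ... | no  x≉y = contradiction x≈y x≉y

  δ-0 : ∀ {x y} → ¬ (x F.≈ y) → δ x y ≈ 0#
  δ-0 {x} {y} x≉y with x F.≟ y
  ... | yes x≈y = contradiction x≈y x≉y
  ... | no  _   = ≈-refl

  δ-cong : ∀ {x x′ y y′} → x F.≈ x′ → y F.≈ y′ → δ x y ≈ δ x′ y′
  δ-cong {x} {x′} {y} {y′} x≈x′ y≈y′ with x′ F.≟ y′
  ... | yes p = δ-1 (F.trans x≈x′ (F.trans p (F.sym y≈y′)))
  ... | no ¬p = δ-0 (λ p → ¬p (F.trans (F.sym x≈x′) (F.trans p y≈y′)))

  Σ-δ : ∀ {f} a → Congruent f → Σ (λ x → δ x a * f x) ≈ f a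
  Σ-δ {f} a f-cong = trans
    (Σ-single a (λ x≈y → *-cong (δ-cong x≈y F.refl) (f-cong x≈y)) (λ x x≉a → trans (*-congʳ (δ-0 x≉a)) (zeroˡ _)))
    (trans (*-congʳ (δ-1 F.refl)) (*-identityˡ _))

  Σ-δ1 : ∀ a → Σ (λ x → δ x a) ≈ 1#
  Σ-δ1 a = trans (Σ-cong λ x → sym (*-identityʳ _)) (Σ-δ a (λ _ → ≈-refl))

  -- Adding the indicator of 0 turns ε into the constant 1, so the left side is q - 1, which is also
  -- the length of the listing of characters.
  Σ-ε : Σ ⟦ ε ⟧ ≈ N
  Σ-ε = RP.+-cancelʳ 1# _ _ (begin
    Σ ⟦ ε ⟧ + 1#                          ≈⟨ +-congˡ (Σ-δ1 F.0#) ⟨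
    Σ ⟦ ε ⟧ + Σ (λ x → δ x F.0#)          ≈⟨ Σ-distrib-+ _ _ ⟨
    Σ (λ x → ⟦ ε ⟧ x + δ x F.0#)          ≈⟨ Σ-cong split ⟩
    Σ (λ _ → 1#)                          ≈⟨ Σ-1 ⟩
    q ⊗ 1#                                ≡⟨ ≡.cong (_⊗ 1#) (q≡suc q (F.index F.0#)) ⟩
    1# + (q ℕ.∸ 1) ⊗ 1#                   ≈⟨ +-comm _ _ ⟩
    (q ℕ.∸ 1) ⊗ 1# + 1#                   ≈⟨ +-congʳ Σ̂-1 ⟨
    N + 1#                                ∎)
    where
    q≡suc : ∀ n → Fin n → n ≡ suc (n ℕ.∸ 1)
    q≡suc (suc n) _ = ≡.refl
    split : ∀ x → ⟦ ε ⟧ x + δ x F.0# ≈ 1#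
    split x with x F.≟ F.0#
    ... | yes _ = +-identityˡ _
    ... | no  _ = +-identityʳ _

  -- S x is 0 or N by translation invariance, and the sum N of all its values
  -- is already exhausted by S 1 = N.
  column : ∀ x → Σ̂ (λ χ → ⟦ χ ⟧ x) ≈ N * δ x F.1#
  column x = trans (split x) (trans (+-congʳ (Σ≈0⇒≈0 t-cong t-natural Σt≈0 x)) (+-identityˡ _))
    where
    S t : F.Carrier → ℂ
    S x = Σ̂ λ χ → ⟦ χ ⟧ x
    t x with x F.≟ F.1#
    ... | yes _ = 0#
    ... | no  _ = S x
    S-cong : Congruent S
    S-cong x≈y = Σ̂-cong λ χ → Character.cong χ x≈y
    S-1 : ∀ {x} → (∀ χ → ⟦ χ ⟧ x ≈ 1#) → S x ≈ N
    S-1 = Σ̂-cong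
    split : ∀ x → S x ≈ t x + N * δ x F.1#
    split x with x F.≟ F.1#
    ... | yes x≈1 = trans (S-1 (λ χ → trans (Character.cong χ x≈1) (Character.1-homo χ)))
                          (sym (trans (+-identityˡ _) (*-identityʳ N)))
    ... | no  _   = sym (trans (+-congˡ (zeroʳ N)) (+-identityʳ _))
    t-cong : Congruent t
    t-cong {x} {y} x≈y with x F.≟ F.1# | y F.≟ F.1#
    ... | yes _   | yes _   = ≈-refl
    ... | yes x≈1 | no y≉1  = contradiction (F.trans (F.sym x≈y) x≈1) y≉1
    ... | no x≉1  | yes y≈1 = contradiction (F.trans x≈y y≈1) x≉1
    ... | no _    | no _    = S-cong x≈y
    translate : ∀ ω x → ⟦ ω ⟧ x * S x ≈ S x
    translate ω x = begin
      ⟦ ω ⟧ x * S x                   ≈⟨ *-Σ̂ _ _ ⟩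
      Σ̂ (λ χ → ⟦ ω · χ ⟧ x)           ≈⟨ Σ̂-reindex (ω ·_) (ω ⁻¹ ·_) (λ _ _ p → p x)
                                           (λ _ _ p y → *-congˡ (p y)) (λ _ _ p y → *-congˡ (p y))
                                           (λ χ → GS.solve (ω ∷ χ ∷ []) (x₀ ⊙ (x₀ ⁻ ⊙ x₁)) x₁)
                                           (λ χ → GS.solve (ω ∷ χ ∷ []) (x₀ ⁻ ⊙ (x₀ ⊙ x₁)) x₁) ⟨
      S x                             ∎
    t-natural : ∀ x → ¬ ¬ IsNatural (t x)
    t-natural x ¬p with x F.≟ F.1#
    ... | yes _ = ¬p (0 , ≈-refl)
    ... | no  _ = ¬p (0 , Complex.≈-stable λ S≉0 →
            ¬p (q ℕ.∸ 1 , trans (S-1 λ χ → fixed⇒≈0 (translate χ x) S≉0) Σ̂-1))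
    Σ-S : Σ S ≈ N
    Σ-S = begin
      Σ S                              ≈⟨ Σ̂Σ-comm _ ⟨
      Σ̂ (λ χ → Σ ⟦ χ ⟧)                ≈⟨ Σ̂-single ε (λ _ _ p → Σ-cong p) Σ-χ≈0 ⟩
      Σ ⟦ ε ⟧                          ≈⟨ Σ-ε ⟩
      N                                ∎
    Σt≈0 : Σ t ≈ 0#
    Σt≈0 = RP.+-cancelʳ N _ _ (begin
      Σ t + N                              ≈⟨ +-congˡ (trans (*-congˡ (Σ-δ1 F.1#)) (*-identityʳ N)) ⟨
      Σ t + N * Σ (λ x → δ x F.1#)         ≈⟨ +-congˡ (*-Σ _ _) ⟩
      Σ t + Σ (λ x → N * δ x F.1#)         ≈⟨ Σ-distrib-+ _ _ ⟨
      Σ (λ x → t x + N * δ x F.1#)         ≈⟨ Σ-cong split ⟨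
      Σ S                                  ≈⟨ Σ-S ⟩
      N                                    ≈⟨ +-identityˡ N ⟨
      0# + N                               ∎)

  -- Plancherel's formula for Mellin transforms on 𝔽*. Expanding the product leaves χ(s/t), whose
  -- sum over χ is N for s = t and 0 otherwise; the terms with t = 0 vanish because D(0) = 0.
  parseval : ∀ A D {f h} → Congruent f → Congruent h →
    Σ̂ (λ χ → Σ (λ s → ⟦ A · χ ⟧ s * f s) * Σ (λ t → ⟦ D · χ ⁻¹ ⟧ t * h t)) ≈
    N * Σ λ s → ⟦ A · D ⟧ s * (f s * h s)
  parseval A D {f} {h} f-cong h-cong = begin
    Σ̂ (λ χ → Σ (λ s → ⟦ A · χ ⟧ s * f s) * Σ (λ t → ⟦ D · χ ⁻¹ ⟧ t * h t))
      ≈⟨ Σ̂-cong (λ χ → trans (Σ-*-Σ _ _) (Σ-cong λ s → Σ-cong λ t → begin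
           ⟦ A ⟧ s * ⟦ χ ⟧ s * f s * (⟦ D ⟧ t * ⟦ χ ⟧ (t F.⁻¹) * h t)
             ≈⟨ CS.solve 6 (λ a x f d y h → ((a ⊕ x) ⊕ f) ⊕ ((d ⊕ y) ⊕ h) ⊜ ((a ⊕ d) ⊕ (f ⊕ h)) ⊕ (x ⊕ y)) ≈-refl _ _ _ _ _ _ ⟩
           u s t * (⟦ χ ⟧ s * ⟦ χ ⟧ (t F.⁻¹))
             ≈⟨ *-congˡ (Character.*-homo χ s (t F.⁻¹)) ⟨
           u s t * ⟦ χ ⟧ (s F.* t F.⁻¹) ∎)) ⟩
    Σ̂ (λ χ → Σ λ s → Σ λ t → u s t * ⟦ χ ⟧ (s F.* t F.⁻¹))
      ≈⟨ trans (Σ̂Σ-comm _) (Σ-cong λ s → trans (Σ̂Σ-comm _) (Σ-cong λ t →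
           trans (sym (*-Σ̂ _ _)) (*-congˡ (column _)))) ⟩
    Σ (λ s → Σ λ t → u s t * (N * δ (s F.* t F.⁻¹) F.1#))
      ≈⟨ Σ-cong (λ s → trans (Σ-single s (summand-cong s) (off-diagonal s)) (diagonal s)) ⟩
    Σ (λ s → N * (⟦ A · D ⟧ s * (f s * h s)))
      ≈⟨ *-Σ _ _ ⟨
    N * Σ (λ s → ⟦ A · D ⟧ s * (f s * h s)) ∎
    where
    u : F.Carrier → F.Carrier → ℂ
    u s t = ⟦ A ⟧ s * ⟦ D ⟧ t * (f s * h t)
    summand-cong : ∀ s → Congruent (λ t → u s t * (N * δ (s F.* t F.⁻¹) F.1#))
    summand-cong s t≈t′ = *-cong (*-cong (*-congˡ (Character.cong D t≈t′)) (*-congˡ (h-cong t≈t′)))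
      (*-congˡ (δ-cong (F.*-congˡ (F.⁻¹-cong t≈t′)) F.refl))
    off-diagonal : ∀ s t → ¬ (t F.≈ s) → u s t * (N * δ (s F.* t F.⁻¹) F.1#) ≈ 0#
    off-diagonal s t t≉s with t F.≟ F.0#
    ... | yes t≈0 = trans (*-congʳ (trans (*-congʳ (trans (*-congˡ (Character.zero-at D t≈0)) (zeroʳ _))) (zeroˡ _))) (zeroˡ _)
    ... | no t≉0 = trans (*-congˡ (trans (*-congˡ (δ-0 λ p → t≉s (t≈s p))) (zeroʳ _))) (zeroʳ _)
      where
      t≈s : s F.* proj₁ (F.invertible t t≉0) F.≈ F.1# → t F.≈ s
      t≈s p = F.trans (F.sym (F.*-identityˡ t)) (F.trans (F.*-congʳ (F.sym p))
        (F.trans (F.*-assoc _ _ _) (F.trans (F.*-congˡ (F.trans (F.*-comm _ _) (proj₂ (F.invertible t t≉0)))) (F.*-identityʳ s))))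
    diagonal : ∀ s → u s s * (N * δ (s F.* s F.⁻¹) F.1#) ≈ N * (⟦ A · D ⟧ s * (f s * h s))
    diagonal s with s F.≟ F.0#
    ... | yes s≈0 = trans (trans (*-congʳ u≈0) (zeroˡ _)) (sym (trans (*-congˡ u≈0) (zeroʳ N)))
      where
      u≈0 : u s s ≈ 0#
      u≈0 = trans (*-congʳ (trans (*-congˡ (Character.zero-at D s≈0)) (zeroʳ _))) (zeroˡ _)
    ... | no s≉0 = trans (*-congˡ (trans (*-congˡ (δ-1 (proj₂ (F.invertible s s≉0)))) (*-identityʳ N))) (*-comm _ _)

  -- Squares in the field

  F-zero-product : ∀ {x y} → x F.* y F.≈ F.0# → x F.≈ F.0# ⊎ y F.≈ F.0#
  F-zero-product {x} {y} xy≈0 with x F.≟ F.0# | y F.≟ F.0#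
  ... | yes x≈0 | _       = inj₁ x≈0
  ... | no _    | yes y≈0 = inj₂ y≈0
  ... | no x≉0  | no y≉0  = contradiction xy≈0 (F.*-≉0 x≉0 y≉0)

  square-roots : ∀ {x y} → x F.* x F.≈ y F.* y → x F.≈ y ⊎ x F.≈ F.- y
  square-roots {x} {y} x²≈y² with F-zero-product {x F.- y} {x F.+ y} (difference x²≈y²)
    where
    module FR = SetoidReasoning F.setoid
    difference : x F.* x F.≈ y F.* y → (x F.- y) F.* (x F.+ y) F.≈ F.0#
    difference p = FR.begin
      (x F.- y) F.* (x F.+ y)                       FR.≈⟨ F.distribˡ (x F.- y) x y ⟩
      (x F.- y) F.* x F.+ (x F.- y) F.* y           FR.≈⟨ F.+-cong (F.distribʳ x x (F.- y)) (F.distribʳ y x (F.- y)) ⟩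
      (x F.* x F.+ F.- y F.* x) F.+ (x F.* y F.+ F.- y F.* y)
        FR.≈⟨ F.+-cong (F.+-cong p (F.trans (F.sym (FP.-‿distribˡ-* y x)) (F.-‿cong (F.*-comm y x)))) (F.+-congˡ (F.sym (FP.-‿distribˡ-* y y))) ⟩
      (y F.* y F.- x F.* y) F.+ (x F.* y F.- y F.* y)
        FR.≈⟨ F.+-assoc _ _ _ ⟩
      y F.* y F.+ (F.- (x F.* y) F.+ (x F.* y F.- y F.* y))
        FR.≈⟨ F.+-congˡ (F.trans (F.sym (F.+-assoc _ _ _)) (F.trans (F.+-congʳ (F.-‿inverseˡ _)) (F.+-identityˡ _))) ⟩
      y F.* y F.- y F.* y                           FR.≈⟨ F.-‿inverseʳ _ ⟩
      F.0#                                          FR.∎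
  ... | inj₁ x-y≈0 = inj₁ (FP.x∙y⁻¹≈ε⇒x≈y x y x-y≈0)
  ... | inj₂ x+y≈0 = inj₂ (FP.+-inverseˡ-unique x y x+y≈0)

  root? : ∀ v → Dec (∃[ r ] r F.* r F.≈ v)
  root? v with Fin.any? (λ k → (F.element k F.* F.element k) F.≟ v)
  ... | yes (k , p) = yes (F.element k , p)
  ... | no ¬p       = no λ (r , p) → ¬p (F.index r , F.trans (F.*-cong (F.element-index r) (F.element-index r)) p)

  roots : F.Carrier → ℂ
  roots v = Σ λ r → δ (r F.* r) v

  roots-cong : Congruent roots
  roots-cong v≈w = Σ-cong λ r → δ-cong F.refl v≈w

  roots-none : ∀ {v} → ¬ (∃[ r ] r F.* r F.≈ v) → roots v ≈ 0#
  roots-none ¬r = Σ-zero λ r → δ-0 λ p → ¬r (r , p)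

  roots-one : ∀ {v} r → r F.≈ F.- r → r F.* r F.≈ v → roots v ≈ 1#
  roots-one {v} r r≈-r r²≈v = trans (Σ-cong same) (Σ-δ1 r)
    where
    same : ∀ s → δ (s F.* s) v ≈ δ s r
    same s with s F.≟ r
    ... | yes s≈r = δ-1 (F.trans (F.*-cong s≈r s≈r) r²≈v)
    ... | no  s≉r = δ-0 λ s²≈v → s≉r (choose (square-roots (F.trans s²≈v (F.sym r²≈v))))
      where
      choose : s F.≈ r ⊎ s F.≈ F.- r → s F.≈ r
      choose (inj₁ p) = p
      choose (inj₂ p) = F.trans p (F.sym r≈-r)

  δ-square : ∀ {v} r → ¬ (r F.≈ F.- r) → r F.* r F.≈ v → ∀ s → δ (s F.* s) v ≈ δ s r + δ s (F.- r)
  δ-square {v} r r≉-r r²≈v s with s F.≟ r | s F.≟ F.- r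
  ... | yes s≈r | yes s≈-r = contradiction (F.trans (F.sym s≈r) s≈-r) r≉-r
  ... | yes s≈r | no _     = trans (δ-1 (F.trans (F.*-cong s≈r s≈r) r²≈v)) (sym (+-identityʳ _))
  ... | no _    | yes s≈-r = trans (δ-1 (F.trans (F.*-cong s≈-r s≈-r) -r²≈v)) (sym (+-identityˡ _))
    where
    -r²≈v : F.- r F.* F.- r F.≈ v
    -r²≈v = F.trans (F.sym (FP.-‿distribˡ-* r (F.- r)))
      (F.trans (F.-‿cong (F.sym (FP.-‿distribʳ-* r r))) (F.trans (FP.-‿involutive _) r²≈v))
  ... | no s≉r  | no s≉-r  = trans (δ-0 λ s²≈v → neither (square-roots (F.trans s²≈v (F.sym r²≈v)))) (sym (+-identityˡ _))
    where
    neither : ¬ (s F.≈ r ⊎ s F.≈ F.- r)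
    neither (inj₁ p) = s≉r p
    neither (inj₂ p) = s≉-r p

  roots-two : ∀ {v} r → ¬ (r F.≈ F.- r) → r F.* r F.≈ v → roots v ≈ 1# + 1#
  roots-two {v} r r≉-r r²≈v = begin
    roots v                                     ≈⟨ Σ-cong (δ-square r r≉-r r²≈v) ⟩
    Σ (λ s → δ s r + δ s (F.- r))               ≈⟨ Σ-distrib-+ _ _ ⟩
    Σ (λ s → δ s r) + Σ (λ s → δ s (F.- r))     ≈⟨ +-cong (Σ-δ1 r) (Σ-δ1 (F.- r)) ⟩
    1# + 1#                                     ∎

  Σ-roots : ∀ h → Congruent h → Σ (λ v → roots v * h v) ≈ Σ λ r → h (r F.* r)
  Σ-roots h h-cong = begin
    Σ (λ v → roots v * h v)                        ≈⟨ Σ-cong (λ v → Σ-* _ _) ⟩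
    Σ (λ v → Σ λ r → δ (r F.* r) v * h v)          ≈⟨ Σ-comm _ ⟩
    Σ (λ r → Σ λ v → δ (r F.* r) v * h v)          ≈⟨ Σ-cong (λ r → trans (Σ-cong λ v → *-congʳ (δ-sym _ v)) (Σ-δ (r F.* r) h-cong)) ⟩
    Σ (λ r → h (r F.* r))                          ∎
    where
    δ-sym : ∀ x y → δ x y ≈ δ y x
    δ-sym x y with y F.≟ x
    ... | yes y≈x = δ-1 (F.sym y≈x)
    ... | no  y≉x = δ-0 λ x≈y → y≉x (F.sym x≈y)

  Σ-roots-1 : Σ roots ≈ Σ λ _ → 1#
  Σ-roots-1 = trans (Σ-cong λ v → sym (*-identityʳ _)) (Σ-roots (λ _ → 1#) λ _ → ≈-refl)

  -- Every r is a root of exactly one v, so the numbers of roots add up to q. This supplies the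
  -- vanishing total that `Σ≈0⇒≈0` asks for.
  Σ-minus-roots : ∀ f → Σ f ≈ Σ (λ _ → 1#) → Σ (λ v → f v - roots v) ≈ 0#
  Σ-minus-roots f Σf≈Σ1 = RP.+-cancelʳ (Σ roots) _ _ (begin
    Σ (λ v → f v - roots v) + Σ roots      ≈⟨ Σ-distrib-+ _ _ ⟨
    Σ (λ v → f v - roots v + roots v)      ≈⟨ Σ-cong (λ v → trans (+-assoc _ _ _) (trans (+-congˡ (-‿inverseˡ _)) (+-identityʳ _))) ⟩
    Σ f                                    ≈⟨ Σf≈Σ1 ⟩
    Σ (λ _ → 1#)                           ≈⟨ Σ-roots-1 ⟨
    Σ roots                                ≈⟨ +-identityˡ _ ⟨
    0# + Σ roots                           ∎)

  module Quadratic (φ : Character) (φφ≋ε : φ · φ ≋ ε) (φ≢ε : ¬ (φ ≋ ε)) where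

    φ-square : ∀ {r} → ¬ (r F.≈ F.0#) → ⟦ φ ⟧ (r F.* r) ≈ 1#
    φ-square {r} r≉0 = trans (Character.*-homo φ r r) (trans (φφ≋ε r) (nonzero-1 r≉0))

    -- In characteristic 2 no element has more than one square root, so the numbers 1 - `roots v`
    -- are natural with sum 0. Hence everything is a square, and φ, being 1 on non-zero squares,
    -- would be trivial.
    1≉-1 : ¬ (F.1# F.≈ F.- F.1#)
    1≉-1 1≈-1 = φ≢ε value
      where
      x≈-x : ∀ x → x F.≈ F.- x
      x≈-x x = F.trans (F.sym (F.*-identityˡ x)) (F.trans (F.*-congʳ 1≈-1)
        (F.trans (F.sym (FP.-‿distribˡ-* F.1# x)) (F.-‿cong (F.*-identityˡ x))))
      natural : ∀ v → ¬ ¬ IsNatural (1# - roots v)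
      natural v ¬p with root? v
      ... | yes (r , r²≈v) = ¬p (0 , trans (+-congˡ (-‿cong (roots-one r (x≈-x r) r²≈v))) (-‿inverseʳ 1#))
      ... | no ¬r          = ¬p (1 , +-congˡ (trans (-‿cong (roots-none ¬r)) RP.-0#≈0#))
      roots≈1 : ∀ v → 1# - roots v ≈ 0#
      roots≈1 = Σ≈0⇒≈0 (λ x≈y → +-congˡ (-‿cong (roots-cong x≈y))) natural (Σ-minus-roots (λ _ → 1#) ≈-refl)
      value : ∀ v → ⟦ φ ⟧ v ≈ ⟦ ε ⟧ v
      value v with root? v | v F.≟ F.0#
      ... | no ¬r          | _       = contradiction (trans (sym (trans (+-congˡ (trans (-‿cong (roots-none ¬r)) RP.-0#≈0#)) (+-identityʳ 1#))) (roots≈1 v)) 1≉0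
      ... | yes _          | yes v≈0 = Character.zero-at φ v≈0
      ... | yes (r , r²≈v) | no v≉0  = trans (Character.cong φ (F.sym r²≈v))
              (φ-square λ r≈0 → v≉0 (F.trans (F.sym r²≈v) (F.trans (F.*-congʳ r≈0) (F.zeroˡ r))))

    2≉0 : ¬ (F.1# F.+ F.1# F.≈ F.0#)
    2≉0 p = 1≉-1 (FP.+-inverseˡ-unique F.1# F.1# p)

    x≉-x : ∀ {x} → ¬ (x F.≈ F.0#) → ¬ (x F.≈ F.- x)
    x≉-x {x} x≉0 x≈-x = F.*-≉0 2≉0 x≉0 (F.trans (F.distribʳ x F.1# F.1#)
      (F.trans (F.+-cong (F.*-identityˡ x) (F.*-identityˡ x)) (F.trans (F.+-congˡ x≈-x) (F.-‿inverseʳ x))))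

    -- The differences are natural numbers with sum 0: a non-square v has no
    -- roots, and φ(v) = ±1.
    roots-φ : ∀ v → 1# + ⟦ φ ⟧ v ≈ roots v
    roots-φ v = RP.x∙y⁻¹≈ε⇒x≈y _ _ (Σ≈0⇒≈0
      (λ x≈y → +-cong (+-congˡ (Character.cong φ x≈y)) (-‿cong (roots-cong x≈y))) natural
      (Σ-minus-roots (λ v → 1# + ⟦ φ ⟧ v) (trans (Σ-distrib-+ _ _) (trans (+-congˡ (Σ-χ≈0 φ φ≢ε)) (+-identityʳ _)))) v)
      where
      vanish : ∀ v → 1# + ⟦ φ ⟧ v ≈ roots v → ¬ ¬ IsNatural (1# + ⟦ φ ⟧ v - roots v)
      vanish v eq ¬p = ¬p (0 , trans (+-congʳ eq) (-‿inverseʳ (roots v)))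
      natural : ∀ v → ¬ ¬ IsNatural (1# + ⟦ φ ⟧ v - roots v)
      natural v with v F.≟ F.0# | root? v
      ... | yes v≈0 | _ = vanish v (trans (trans (+-congˡ (Character.zero-at φ v≈0)) (+-identityʳ 1#))
              (sym (roots-one F.0# (F.sym FP.-0#≈0#) (F.trans (F.zeroˡ _) (F.sym v≈0)))))
      ... | no v≉0 | yes (r , r²≈v) = vanish v (trans (+-congˡ (trans (Character.cong φ (F.sym r²≈v)) (φ-square r≉0)))
              (sym (roots-two r (x≉-x r≉0) r²≈v)))
        where
        r≉0 : ¬ (r F.≈ F.0#)
        r≉0 r≈0 = v≉0 (F.trans (F.sym r²≈v) (F.trans (F.*-congʳ r≈0) (F.zeroˡ r)))
      ... | no v≉0 | no ¬r = λ ¬p → ¬p (0 , trans (minus-none) (Complex.≈-stable λ 1+φ≉0 →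
              ¬p (2 , trans minus-none (+-congˡ (trans (fixed⇒≈0 φ-fixes 1+φ≉0) (sym (+-identityʳ 1#)))))))
        where
        minus-none : 1# + ⟦ φ ⟧ v - roots v ≈ 1# + ⟦ φ ⟧ v
        minus-none = trans (+-congˡ (trans (-‿cong (roots-none ¬r)) RP.-0#≈0#)) (+-identityʳ _)
        φ-fixes : ⟦ φ ⟧ v * (1# + ⟦ φ ⟧ v) ≈ 1# + ⟦ φ ⟧ v
        φ-fixes = trans (distribˡ _ _ _) (trans (+-cong (*-identityʳ _) (trans (φφ≋ε v) (nonzero-1 v≉0))) (+-comm _ _))

    Σ-square : ∀ h → Congruent h → Σ (λ r → h (r F.* r)) ≈ Σ λ v → (1# + ⟦ φ ⟧ v) * h v
    Σ-square h h-cong = trans (sym (Σ-roots h h-cong)) (Σ-cong λ v → *-congʳ (sym (roots-φ v)))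

  -- Both characters are determined by the number of square roots. This identifies χ₄² with φ and
  -- shows that two square roots of a character differ by a factor ε or φ.
  quadratic-unique : ∀ φ ψ → φ · φ ≋ ε → ¬ (φ ≋ ε) → ψ · ψ ≋ ε → ¬ (ψ ≋ ε) → φ ≋ ψ
  quadratic-unique φ ψ φφ≋ε φ≢ε ψψ≋ε ψ≢ε v = RP.+-cancelˡ 1# _ _
    (trans (Quadratic.roots-φ φ φφ≋ε φ≢ε v) (sym (Quadratic.roots-φ ψ ψψ≋ε ψ≢ε v)))

  -- Gauss sums

  -1F : F.Carrier
  -1F = F.- F.1#

  -1≉0 : ¬ (-1F F.≈ F.0#)
  -1≉0 p = F.0≉1 (F.trans (F.sym (F.-‿inverseʳ F.1#)) (F.trans (F.+-congˡ p) (F.+-identityʳ F.1#)))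

  -x≈-1*x : ∀ x → F.- x F.≈ -1F F.* x
  -x≈-1*x x = F.trans (F.-‿cong (F.sym (F.*-identityˡ x))) (FP.-‿distribˡ-* F.1# x)

  χ-neg : ∀ χ x → ⟦ χ ⟧ (F.- x) ≈ ⟦ χ ⟧ -1F * ⟦ χ ⟧ x
  χ-neg χ x = trans (Character.cong χ (-x≈-1*x x)) (Character.*-homo χ -1F x)

  χ-inverse : ∀ χ {x} → ¬ (x F.≈ F.0#) → ⟦ χ ⟧ x * ⟦ χ ⁻¹ ⟧ x ≈ 1#
  χ-inverse χ {x} x≉0 = trans (GS.solve (χ ∷ []) (x₀ ⊙ x₀ ⁻) GS.ι x) (nonzero-1 x≉0)

  χ[-1]²≈1 : ∀ χ → ⟦ χ ⟧ -1F * ⟦ χ ⟧ -1F ≈ 1#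
  χ[-1]²≈1 χ = trans (sym (χ-neg χ -1F)) (trans (Character.cong χ (FP.-‿involutive F.1#)) (Character.1-homo χ))

  χ⁻¹[-1] : ∀ χ → ⟦ χ ⁻¹ ⟧ -1F ≈ ⟦ χ ⟧ -1F
  χ⁻¹[-1] χ = begin
    ⟦ χ ⁻¹ ⟧ -1F                                   ≈⟨ *-identityˡ _ ⟨
    1# * ⟦ χ ⁻¹ ⟧ -1F                              ≈⟨ *-congʳ (χ[-1]²≈1 χ) ⟨
    ⟦ χ ⟧ -1F * ⟦ χ ⟧ -1F * ⟦ χ ⁻¹ ⟧ -1F           ≈⟨ trans (*-assoc _ _ _) (*-congˡ (χ-inverse χ -1≉0)) ⟩
    ⟦ χ ⟧ -1F * 1#                                 ≈⟨ *-identityʳ _ ⟩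
    ⟦ χ ⟧ -1F                                      ∎

  opaque

    γ : Character → ℂ
    γ = g

    γ≈g : ∀ χ → γ χ ≈ g χ
    γ≈g χ = ≈-refl

    γ-def : ∀ χ → γ χ ≈ Σ λ x → ⟦ χ ⟧ x * ⟦ θ ⟧₊ x
    γ-def χ = sym (Σ-def _)

    γ-ε : γ ε ≈ - 1#
    γ-ε = gauss-ε θ θ≢1

    γ-reflection : ∀ χ → ¬ (χ ≋ ε) → γ χ * γ (χ ⁻¹) ≈ ⟦ χ ⟧ -1F * Σ λ _ → 1#
    γ-reflection χ χ≢ε = trans (gauss-conj θ θ≢1 χ χ≢ε) (*-congˡ (sym (Σ-def _)))

    γ⁻¹ : Character → ℂ
    γ⁻¹ χ = proj₁ (gauss-invertible θ θ≢1 _≟_ χ)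

    /g-def : ∀ z χ → z /g χ ≈ z * γ⁻¹ χ
    /g-def z χ = ≈-refl

    γ-inverse : ∀ χ → γ χ * γ⁻¹ χ ≈ 1#
    γ-inverse χ = proj₂ (gauss-invertible θ θ≢1 _≟_ χ)

    τ : Character → F.Carrier → ℂ
    τ χ k = Σ λ x → ⟦ χ ⟧ x * ⟦ θ ⟧₊ (k F.* x)

    τ-def : ∀ χ k → τ χ k ≈ Σ λ x → ⟦ χ ⟧ x * ⟦ θ ⟧₊ (k F.* x)
    τ-def χ k = ≈-refl

  γ≉0 : ∀ χ → ¬ (γ χ ≈ 0#)
  γ≉0 χ = unit⇒≉0 1≉0 (γ-inverse χ)

  γ-cong : ∀ {χ ψ} → χ ≋ ψ → γ χ ≈ γ ψ
  γ-cong {χ} {ψ} p = trans (γ-def χ) (trans (Σ-cong λ x → *-congʳ (p x)) (sym (γ-def ψ)))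

  γ⁻¹-cong : ∀ {χ ψ} → χ ≋ ψ → γ⁻¹ χ ≈ γ⁻¹ ψ
  γ⁻¹-cong {χ} {ψ} p = cancelˡ (γ≉0 χ) (trans (γ-inverse χ) (trans (sym (γ-inverse ψ)) (*-congʳ (sym (γ-cong p)))))

  τ-cong : ∀ {χ ψ k l} → χ ≋ ψ → k F.≈ l → τ χ k ≈ τ ψ l
  τ-cong {χ} {ψ} {k} {l} p k≈l = trans (τ-def χ k)
    (trans (Σ-cong λ x → *-cong (p x) (θ.cong (F.*-congʳ k≈l))) (sym (τ-def ψ l)))

  γ-solve : ∀ {n} (ρ : Vec Character n) (e f : GS.Expr n) {eq : GS.Balanced e f} → γ (GS.⟦ e ⟧ₑ ρ) ≈ γ (GS.⟦ f ⟧ₑ ρ)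
  γ-solve ρ e f {eq} = γ-cong {GS.⟦ e ⟧ₑ ρ} {GS.⟦ f ⟧ₑ ρ} (GS.solve ρ e f {eq})

  γ⁻¹-solve : ∀ {n} (ρ : Vec Character n) (e f : GS.Expr n) {eq : GS.Balanced e f} → γ⁻¹ (GS.⟦ e ⟧ₑ ρ) ≈ γ⁻¹ (GS.⟦ f ⟧ₑ ρ)
  γ⁻¹-solve ρ e f {eq} = γ⁻¹-cong {GS.⟦ e ⟧ₑ ρ} {GS.⟦ f ⟧ₑ ρ} (GS.solve ρ e f {eq})

  τ-solve : ∀ {n} (ρ : Vec Character n) (e f : GS.Expr n) {eq : GS.Balanced e f} {k} → τ (GS.⟦ e ⟧ₑ ρ) k ≈ τ (GS.⟦ f ⟧ₑ ρ) k
  τ-solve ρ e f {eq} = τ-cong {GS.⟦ e ⟧ₑ ρ} {GS.⟦ f ⟧ₑ ρ} (GS.solve ρ e f {eq}) F.refl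

  τ-argument : ∀ χ {k l} → k F.≈ l → τ χ k ≈ τ χ l
  τ-argument χ = τ-cong {χ} {χ} (Ĝ.refl {χ})

  τ-1 : ∀ χ → τ χ F.1# ≈ γ χ
  τ-1 χ = trans (τ-def χ F.1#) (trans (Σ-cong λ x → *-congˡ (θ.cong (F.*-identityˡ x))) (sym (γ-def χ)))

  -- Substitute x/k for x. The other factor l may be 0, which `τ-*-τ-γ` relies on.
  τ-scale : ∀ χ {k} l → ¬ (k F.≈ F.0#) → τ χ (k F.* l) ≈ ⟦ χ ⁻¹ ⟧ k * τ χ l
  τ-scale χ {k} l k≉0 = begin
    τ χ (k F.* l)                                                     ≈⟨ τ-def χ _ ⟩
    Σ (λ x → ⟦ χ ⟧ x * ⟦ θ ⟧₊ (k F.* l F.* x))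
      ≈⟨ Σ-scale (k F.⁻¹) k⁻¹≉0 (λ p → *-cong (Character.cong χ p) (θ.cong (F.*-congˡ p))) ⟩
    Σ (λ x → ⟦ χ ⟧ (k F.⁻¹ F.* x) * ⟦ θ ⟧₊ (k F.* l F.* (k F.⁻¹ F.* x)))
      ≈⟨ Σ-cong (λ x → trans (*-cong (Character.*-homo χ _ _) (θ.cong (move x))) (*-assoc _ _ _)) ⟩
    Σ (λ x → ⟦ χ ⟧ (k F.⁻¹) * (⟦ χ ⟧ x * ⟦ θ ⟧₊ (l F.* x)))          ≈⟨ *-Σ _ _ ⟨
    ⟦ χ ⟧ (k F.⁻¹) * Σ (λ x → ⟦ χ ⟧ x * ⟦ θ ⟧₊ (l F.* x))            ≈⟨ *-congˡ (τ-def χ l) ⟨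
    ⟦ χ ⁻¹ ⟧ k * τ χ l                                                ∎
    where
    kk⁻¹≈1 : k F.* k F.⁻¹ F.≈ F.1#
    kk⁻¹≈1 = F.⁻¹-inverseʳ k≉0
    k⁻¹≉0 : ¬ (k F.⁻¹ F.≈ F.0#)
    k⁻¹≉0 p = F.0≉1 (F.trans (F.sym (F.trans (F.*-congˡ p) (F.zeroʳ k))) kk⁻¹≈1)
    move : ∀ x → k F.* l F.* (k F.⁻¹ F.* x) F.≈ l F.* x
    move x = F.trans (interchangeF k l (k F.⁻¹) x) (F.trans (F.*-congʳ kk⁻¹≈1) (F.*-identityˡ _))
      where open CommutativeSemigroupProperties F.*-commutativeSemigroup using () renaming (interchange to interchangeF)

  τ-0 : ∀ χ {k} → ¬ (χ ≋ ε) → k F.≈ F.0# → τ χ k ≈ 0#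
  τ-0 χ {k} χ≢ε k≈0 = trans (τ-def χ k) (trans
    (Σ-cong λ x → trans (*-congˡ (trans (θ.cong (F.trans (F.*-congʳ k≈0) (F.zeroˡ x))) θ.0-homo)) (*-identityʳ _))
    (Σ-χ≈0 χ χ≢ε))

  τ-unit : ∀ χ {k} → ¬ (k F.≈ F.0#) → τ χ k ≈ ⟦ χ ⁻¹ ⟧ k * γ χ
  τ-unit χ {k} k≉0 = trans (τ-argument χ (F.sym (F.*-identityʳ k))) (trans (τ-scale χ F.1# k≉0) (*-congˡ (τ-1 χ)))

  τ-nontrivial : ∀ χ k → ¬ (χ ≋ ε) → τ χ k ≈ ⟦ χ ⁻¹ ⟧ k * γ χ
  τ-nontrivial χ k χ≢ε = cases (k F.≟ F.0#)
    where
    cases : Dec (k F.≈ F.0#) → τ χ k ≈ ⟦ χ ⁻¹ ⟧ k * γ χ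
    cases (yes k≈0) = trans (τ-0 χ χ≢ε k≈0) (sym (trans (*-congʳ (Character.zero-at (χ ⁻¹) k≈0)) (zeroˡ _)))
    cases (no k≉0)  = τ-unit χ k≉0

  -- Only k = 0 is delicate: the right side is 0 there, whereas τ(ε,0) = q - 1. One non-trivial
  -- character is enough to kill the product on the left.
  τ-*-τ : ∀ χ ψ k → ¬ (χ ≋ ε) ⊎ ¬ (ψ ≋ ε) → τ χ k * τ ψ k ≈ ⟦ (χ · ψ) ⁻¹ ⟧ k * (γ χ * γ ψ)
  τ-*-τ χ ψ k nontrivial = cases (k F.≟ F.0#)
    where
    vanish : k F.≈ F.0# → ¬ (χ ≋ ε) ⊎ ¬ (ψ ≋ ε) → τ χ k * τ ψ k ≈ 0#
    vanish k≈0 (inj₁ χ≢ε) = trans (*-congʳ (τ-0 χ χ≢ε k≈0)) (zeroˡ _)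
    vanish k≈0 (inj₂ ψ≢ε) = trans (*-congˡ (τ-0 ψ ψ≢ε k≈0)) (zeroʳ _)
    cases : Dec (k F.≈ F.0#) → τ χ k * τ ψ k ≈ ⟦ (χ · ψ) ⁻¹ ⟧ k * (γ χ * γ ψ)
    cases (yes k≈0) = trans (vanish k≈0 nontrivial) (sym (trans (*-congʳ (Character.zero-at ((χ · ψ) ⁻¹) k≈0)) (zeroˡ _)))
    cases (no k≉0)  = trans (*-cong (τ-unit χ k≉0) (τ-unit ψ k≉0)) (interchange _ _ _ _)

  -- In the double sum over x and y substitute x = ys for y ≠ 0, so that θ(x)θ(y) = θ((1 + s)y). The
  -- row y = 0 vanishes on both sides because ψ(0) = 0.
  γ-*-γ : ∀ χ ψ → γ χ * γ ψ ≈ Σ λ s → ⟦ χ ⟧ s * τ (χ · ψ) (F.1# F.+ s)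
  γ-*-γ χ ψ = begin
    γ χ * γ ψ                                   ≈⟨ trans (*-comm _ _) (*-cong (γ-def ψ) (γ-def χ)) ⟩
    Σ e[ ψ ] * Σ e[ χ ]                         ≈⟨ Σ-* _ _ ⟩
    Σ (λ y → e[ ψ ] y * Σ e[ χ ])               ≈⟨ Σ-cong row ⟩
    Σ (λ y → Σ λ s → ⟦ χ ⟧ s * (⟦ χ · ψ ⟧ y * ⟦ θ ⟧₊ ((F.1# F.+ s) F.* y)))
      ≈⟨ Σ-comm _ ⟩
    Σ (λ s → Σ λ y → ⟦ χ ⟧ s * (⟦ χ · ψ ⟧ y * ⟦ θ ⟧₊ ((F.1# F.+ s) F.* y)))
      ≈⟨ Σ-cong (λ s → trans (sym (*-Σ _ _)) (*-congˡ (sym (τ-def _ _)))) ⟩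
    Σ (λ s → ⟦ χ ⟧ s * τ (χ · ψ) (F.1# F.+ s))  ∎
    where
    e[_] : Character → F.Carrier → ℂ
    e[ χ ] x = ⟦ χ ⟧ x * ⟦ θ ⟧₊ x
    row : ∀ y → e[ ψ ] y * Σ e[ χ ] ≈ Σ λ s → ⟦ χ ⟧ s * (⟦ χ · ψ ⟧ y * ⟦ θ ⟧₊ ((F.1# F.+ s) F.* y))
    row y = cases (y F.≟ F.0#)
      where
      cases : Dec (y F.≈ F.0#) → e[ ψ ] y * Σ e[ χ ] ≈ Σ λ s → ⟦ χ ⟧ s * (⟦ χ · ψ ⟧ y * ⟦ θ ⟧₊ ((F.1# F.+ s) F.* y))
      cases (yes y≈0) = trans
        (trans (*-congʳ (trans (*-congʳ (Character.zero-at ψ y≈0)) (zeroˡ _))) (zeroˡ _))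
        (sym (Σ-zero λ s → trans (*-congˡ (trans (*-congʳ (Character.zero-at (χ · ψ) y≈0)) (zeroˡ _))) (zeroʳ _)))
      cases (no y≉0) = begin
        e[ ψ ] y * Σ e[ χ ]                       ≈⟨ *-congˡ (Σ-scale y y≉0 (λ p → *-cong (Character.cong χ p) (θ.cong p))) ⟩
        e[ ψ ] y * Σ (λ s → e[ χ ] (y F.* s))     ≈⟨ *-Σ _ _ ⟩
        Σ (λ s → e[ ψ ] y * e[ χ ] (y F.* s))     ≈⟨ Σ-cong (λ s → begin
          ⟦ ψ ⟧ y * ⟦ θ ⟧₊ y * (⟦ χ ⟧ (y F.* s) * ⟦ θ ⟧₊ (y F.* s))
            ≈⟨ *-congˡ (*-congʳ (Character.*-homo χ y s)) ⟩
          ⟦ ψ ⟧ y * ⟦ θ ⟧₊ y * (⟦ χ ⟧ y * ⟦ χ ⟧ s * ⟦ θ ⟧₊ (y F.* s))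
            ≈⟨ CS.solve 5 (λ a b c d e → (a ⊕ b) ⊕ ((c ⊕ d) ⊕ e) ⊜ d ⊕ ((c ⊕ a) ⊕ (b ⊕ e))) ≈-refl _ _ _ _ _ ⟩
          ⟦ χ ⟧ s * (⟦ χ · ψ ⟧ y * (⟦ θ ⟧₊ y * ⟦ θ ⟧₊ (y F.* s)))
            ≈⟨ *-congˡ (*-congˡ (trans (sym (θ.+-homo _ _)) (θ.cong (F.sym (F.trans (F.distribʳ y F.1# s)
                 (F.+-cong (F.*-identityˡ y) (F.*-comm s y))))))) ⟩
          ⟦ χ ⟧ s * (⟦ χ · ψ ⟧ y * ⟦ θ ⟧₊ ((F.1# F.+ s) F.* y)) ∎) ⟩
        Σ (λ s → ⟦ χ ⟧ s * (⟦ χ · ψ ⟧ y * ⟦ θ ⟧₊ ((F.1# F.+ s) F.* y))) ∎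

  -- Barnes' first lemma

  Q : ℂ
  Q = Σ λ _ → 1#

  -- Analogue of the Mellin-Barnes integral of Γ(a+s)Γ(b+s)Γ(c-s)Γ(d-s).
  barnes-sum : Character → Character → Character → Character → ℂ
  barnes-sum A B C D = Σ̂ λ χ → γ (A · χ) * γ (B · χ) * (γ (C · χ ⁻¹) * γ (D · χ ⁻¹))

  -- Each Aχ is paired with a Cχ̄, and Dχ̄ with Bχ, so that the products AC and DB inside τ are free
  -- of χ. What remains of χ is (Aχ)(s)(Dχ̄)(t), which is the shape of `parseval`.
  barnes-τ : ∀ A B C D → barnes-sum A B C D ≈
             N * Σ λ s → ⟦ A · D ⟧ s * (τ (A · C) (F.1# F.+ s) * τ (D · B) (F.1# F.+ s))
  barnes-τ A B C D = begin
    barnes-sum A B C D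
      ≈⟨ Σ̂-cong (λ χ → trans (CS.solve 4 (λ a b c d → (a ⊕ b) ⊕ (c ⊕ d) ⊜ (a ⊕ c) ⊕ (d ⊕ b)) ≈-refl _ _ _ _)
           (*-cong
             (trans (γ-*-γ _ _) (Σ-cong λ s → *-congˡ (τ-solve (A ∷ C ∷ χ ∷ []) ((x₀ ⊙ x₂) ⊙ (x₁ ⊙ x₂ ⁻)) (x₀ ⊙ x₁))))
             (trans (γ-*-γ _ _) (Σ-cong λ t → *-congˡ (τ-solve (D ∷ B ∷ χ ∷ []) ((x₀ ⊙ x₂ ⁻) ⊙ (x₁ ⊙ x₂)) (x₀ ⊙ x₁)))))) ⟩
    Σ̂ (λ χ → Σ (λ s → ⟦ A · χ ⟧ s * τ (A · C) (F.1# F.+ s)) * Σ (λ t → ⟦ D · χ ⁻¹ ⟧ t * τ (D · B) (F.1# F.+ t)))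
      ≈⟨ parseval A D (λ p → τ-argument (A · C) (F.+-congˡ p)) (λ p → τ-argument (D · B) (F.+-congˡ p)) ⟩
    N * Σ (λ s → ⟦ A · D ⟧ s * (τ (A · C) (F.1# F.+ s) * τ (D · B) (F.1# F.+ s))) ∎

  -- The two τ merge into one Jacobi-type sum. The side condition concerns the single point s = -1,
  -- where the common argument 1 + s is 0.
  barnes-J : ∀ A B C D → ¬ (A · C ≋ ε) ⊎ ¬ (D · B ≋ ε) → barnes-sum A B C D ≈
             N * (γ (A · C) * γ (D · B) * Σ λ s → ⟦ A · D ⟧ s * ⟦ (A · C · (D · B)) ⁻¹ ⟧ (F.1# F.+ s))
  barnes-J A B C D nontrivial = trans (barnes-τ A B C D) (*-congˡ (trans
    (Σ-cong λ s → trans (*-congˡ (τ-*-τ (A · C) (D · B) (F.1# F.+ s) nontrivial))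
      (CS.solve 3 (λ a b c → a ⊕ (b ⊕ c) ⊜ c ⊕ (a ⊕ b)) ≈-refl _ _ _))
    (sym (*-Σ _ _))))

  -- The finite field analogue of Barnes' first lemma.
  barnes : ∀ A B C D → ¬ (A · C · (D · B) ≋ ε) →
           γ (A · C · (D · B)) * barnes-sum A B C D ≈ N * (γ (A · C) * γ (D · B) * (γ (A · D) * γ (C · B)))
  barnes A B C D P≢ε = begin
    γ P * barnes-sum A B C D
      ≈⟨ *-congˡ (barnes-J A B C D nontrivial) ⟩
    γ P * (N * (γ (A · C) * γ (D · B) * Σ (λ s → ⟦ A · D ⟧ s * ⟦ P ⁻¹ ⟧ (F.1# F.+ s))))
      ≈⟨ CS.solve 4 (λ p n w j → p ⊕ (n ⊕ (w ⊕ j)) ⊜ n ⊕ (w ⊕ (j ⊕ p))) ≈-refl _ _ _ _ ⟩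
    N * (γ (A · C) * γ (D · B) * (Σ (λ s → ⟦ A · D ⟧ s * ⟦ P ⁻¹ ⟧ (F.1# F.+ s)) * γ P))
      -- For P ≠ ε the product P̄(1 + s) g(P) is τ(P, 1 + s) again. Regrouping P as AD times CB lets
      -- `γ-*-γ` be read backwards for the crossed pairs.
      ≈⟨ *-congˡ (*-congˡ (trans (Σ-* _ _) (trans
           (Σ-cong λ s → trans (*-assoc _ _ _) (*-congˡ (trans (sym (τ-nontrivial P _ P≢ε))
             (τ-solve (A ∷ B ∷ C ∷ D ∷ []) ((x₀ ⊙ x₂) ⊙ (x₃ ⊙ x₁)) ((x₀ ⊙ x₃) ⊙ (x₂ ⊙ x₁))))))
           (sym (γ-*-γ _ _))))) ⟩
    N * (γ (A · C) * γ (D · B) * (γ (A · D) * γ (C · B))) ∎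
    where
    P : Character
    P = A · C · (D · B)
    nontrivial : ¬ (A · C ≋ ε) ⊎ ¬ (D · B ≋ ε)
    nontrivial with (A · C) ≟ ε
    ... | no AC≢ε  = inj₁ AC≢ε
    ... | yes AC≋ε = inj₂ λ DB≋ε → P≢ε (λ x → trans (*-cong (AC≋ε x) (DB≋ε x)) (Ĝ.identityˡ ε x))

  -- Writing 1/g(P) as P(-1) g(P⁻¹)/q makes the lemma hold for trivial P too,
  -- unless A · C or A · D is trivial.
  barnes-reflected : ∀ A B C D → (A · C · (D · B) ≋ ε → ¬ (A · C ≋ ε) × ¬ (A · D ≋ ε)) →
    Q * barnes-sum A B C D ≈
    N * (⟦ A · C · (D · B) ⟧ -1F * γ ((A · C · (D · B)) ⁻¹)) * (γ (A · C) * γ (D · B) * (γ (A · D) * γ (C · B)))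
  barnes-reflected A B C D degenerate = cases (P ≟ ε)
    where
    P : Character
    P = A · C · (D · B)
    goal : Set
    goal = Q * barnes-sum A B C D ≈ N * (⟦ P ⟧ -1F * γ (P ⁻¹)) * (γ (A · C) * γ (D · B) * (γ (A · D) * γ (C · B)))
    cases : Dec (P ≋ ε) → goal
    cases (no P≢ε) = begin
      Q * barnes-sum A B C D                                    ≈⟨ *-congʳ (trans (*-congʳ (χ[-1]²≈1 P)) (*-identityˡ Q)) ⟨
      ⟦ P ⟧ -1F * ⟦ P ⟧ -1F * Q * barnes-sum A B C D            ≈⟨ *-congʳ (trans (*-assoc _ _ _) (*-congˡ (sym (γ-reflection P P≢ε)))) ⟩
      ⟦ P ⟧ -1F * (γ P * γ (P ⁻¹)) * barnes-sum A B C D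
        ≈⟨ CS.solve 4 (λ a b c d → (a ⊕ (b ⊕ c)) ⊕ d ⊜ (a ⊕ c) ⊕ (b ⊕ d)) ≈-refl _ _ _ _ ⟩
      ⟦ P ⟧ -1F * γ (P ⁻¹) * (γ P * barnes-sum A B C D)         ≈⟨ *-congˡ (barnes A B C D P≢ε) ⟩
      ⟦ P ⟧ -1F * γ (P ⁻¹) * (N * (γ (A · C) * γ (D · B) * (γ (A · D) * γ (C · B))))
        ≈⟨ CS.solve 3 (λ a n b → a ⊕ (n ⊕ b) ⊜ (n ⊕ a) ⊕ b) ≈-refl _ _ _ ⟩
      N * (⟦ P ⟧ -1F * γ (P ⁻¹)) * (γ (A · C) * γ (D · B) * (γ (A · D) * γ (C · B))) ∎
    cases (yes P≋ε) = begin
      Q * barnes-sum A B C D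
        ≈⟨ *-congˡ (trans (barnes-J A B C D (inj₁ AC≢ε)) (*-congˡ (*-congˡ J-value))) ⟩
      Q * (N * (γ (A · C) * γ (D · B) * (- 1# * ⟦ A · D ⟧ -1F)))
        ≈⟨ CS.solve 5 (λ q n w m a → q ⊕ (n ⊕ (w ⊕ (m ⊕ a))) ⊜ (n ⊕ m) ⊕ (w ⊕ (a ⊕ q))) ≈-refl _ _ _ _ _ ⟩
      N * - 1# * (γ (A · C) * γ (D · B) * (⟦ A · D ⟧ -1F * Q))
        -- P = ε makes CB the inverse of AD, so AD(-1)q is the reflection product g(AD)g(CB); the
        -- leftover -1 is g(ε).
        ≈⟨ *-cong (*-congˡ (sym Pγ≈-1)) (*-congˡ (sym (trans (*-congˡ (γ-cong {C · B} {(A · D) ⁻¹} CB≋AD⁻¹)) (γ-reflection (A · D) AD≢ε)))) ⟩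
      N * (⟦ P ⟧ -1F * γ (P ⁻¹)) * (γ (A · C) * γ (D · B) * (γ (A · D) * γ (C · B))) ∎
      where
      AC≢ε : ¬ (A · C ≋ ε)
      AC≢ε = proj₁ (degenerate P≋ε)
      AD≢ε : ¬ (A · D ≋ ε)
      AD≢ε = proj₂ (degenerate P≋ε)
      Pγ≈-1 : ⟦ P ⟧ -1F * γ (P ⁻¹) ≈ - 1#
      Pγ≈-1 = trans (*-cong (trans (P≋ε -1F) (nonzero-1 -1≉0))
        (trans (γ-cong {P ⁻¹} {ε} (Ĝ.trans {P ⁻¹} {ε ⁻¹} {ε} (Ĝ.⁻¹-cong {P} {ε} P≋ε) (GS.solve [] (GS.ι ⁻) GS.ι))) γ-ε)) (*-identityˡ _)
      CB≋AD⁻¹ : C · B ≋ (A · D) ⁻¹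
      CB≋AD⁻¹ = Ĝ.trans {C · B} {(A · D) ⁻¹ · P} {(A · D) ⁻¹}
        (GS.solve (A ∷ B ∷ C ∷ D ∷ []) (x₂ ⊙ x₁) ((x₀ ⊙ x₃) ⁻ ⊙ ((x₀ ⊙ x₂) ⊙ (x₃ ⊙ x₁))))
        (λ x → trans (*-congˡ (P≋ε x)) (Ĝ.identityʳ ((A · D) ⁻¹) x))
      P⁻¹-value : ∀ s → ⟦ P ⁻¹ ⟧ (F.1# F.+ s) + δ s -1F ≈ 1#
      P⁻¹-value s = trans (+-congʳ (trans (P≋ε _) (GS.solve [] (GS.ι ⁻) GS.ι (F.1# F.+ s)))) (value (s F.≟ -1F))
        where
        value : Dec (s F.≈ -1F) → ⟦ ε ⟧ (F.1# F.+ s) + δ s -1F ≈ 1#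
        value (yes s≈-1) = trans (+-cong (nonzero-0 (F.trans (F.+-congˡ s≈-1) (F.-‿inverseʳ F.1#))) (δ-1 s≈-1)) (+-identityˡ 1#)
        value (no s≉-1)  = trans (+-cong (nonzero-1 (λ p → s≉-1 (FP.+-inverseʳ-unique F.1# s p))) (δ-0 s≉-1)) (+-identityʳ 1#)
      -- The weight is 1 except at s = -1, where it is 0. So the sum is the complete sum of AD,
      -- which vanishes, minus its term at -1.
      J-value : Σ (λ s → ⟦ A · D ⟧ s * ⟦ P ⁻¹ ⟧ (F.1# F.+ s)) ≈ - 1# * ⟦ A · D ⟧ -1F
      J-value = trans (RP.+-inverseˡ-unique _ _ (begin
        Σ (λ s → ⟦ A · D ⟧ s * ⟦ P ⁻¹ ⟧ (F.1# F.+ s)) + ⟦ A · D ⟧ -1F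
          ≈⟨ +-congˡ (Σ-δ -1F (Character.cong (A · D))) ⟨
        Σ (λ s → ⟦ A · D ⟧ s * ⟦ P ⁻¹ ⟧ (F.1# F.+ s)) + Σ (λ s → δ s -1F * ⟦ A · D ⟧ s)
          ≈⟨ Σ-distrib-+ _ _ ⟨
        Σ (λ s → ⟦ A · D ⟧ s * ⟦ P ⁻¹ ⟧ (F.1# F.+ s) + δ s -1F * ⟦ A · D ⟧ s)
          ≈⟨ Σ-cong (λ s → trans (+-congˡ (*-comm _ _)) (trans (sym (distribˡ _ _ _))
               (trans (*-congˡ (P⁻¹-value s)) (*-identityʳ _)))) ⟩
        Σ ⟦ A · D ⟧                                                 ≈⟨ Σ-χ≈0 (A · D) AD≢ε ⟩
        0#                                                          ∎))
        (trans (-‿cong (sym (*-identityˡ _))) (RP.-‿distribˡ-* 1# _))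

  -- Duplication of Gauss sums

  -- The Jacobi sum of M(x)N(1 - x), with 1 - x arranged as in `convolution` at T = 1.
  J : Character → Character → ℂ
  J M N = Σ λ x → ⟦ M ⟧ x * ⟦ N ⟧ (F.- x F.+ F.1#)

  -- Scaling v by T ≠ 0 extracts (AB)(T). At T = 0 the left side is B(-1) times the complete sum of
  -- AB, which is why AB must be non-trivial.
  convolution : ∀ A B T → ¬ (A · B ≋ ε) → Σ (λ v → ⟦ A ⟧ v * ⟦ B ⟧ (F.- v F.+ T)) ≈ ⟦ A · B ⟧ T * J A B
  convolution A B T AB≢ε = cases (T F.≟ F.0#)
    where
    cases : Dec (T F.≈ F.0#) → Σ (λ v → ⟦ A ⟧ v * ⟦ B ⟧ (F.- v F.+ T)) ≈ ⟦ A · B ⟧ T * J A B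
    cases (yes T≈0) = begin
      Σ (λ v → ⟦ A ⟧ v * ⟦ B ⟧ (F.- v F.+ T))
        ≈⟨ Σ-cong (λ v → trans (*-congˡ (trans (Character.cong B (F.trans (F.+-congˡ T≈0) (F.+-identityʳ _))) (χ-neg B v)))
             (CS.solve 3 (λ a b c → a ⊕ (b ⊕ c) ⊜ b ⊕ (a ⊕ c)) ≈-refl _ _ _)) ⟩
      Σ (λ v → ⟦ B ⟧ -1F * ⟦ A · B ⟧ v)               ≈⟨ *-Σ _ _ ⟨
      ⟦ B ⟧ -1F * Σ ⟦ A · B ⟧                         ≈⟨ trans (*-congˡ (Σ-χ≈0 (A · B) AB≢ε)) (zeroʳ _) ⟩
      0#                                              ≈⟨ trans (*-congʳ (Character.zero-at (A · B) T≈0)) (zeroˡ _) ⟨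
      ⟦ A · B ⟧ T * J A B                             ∎
    cases (no T≉0) = begin
      Σ (λ v → ⟦ A ⟧ v * ⟦ B ⟧ (F.- v F.+ T))
        ≈⟨ Σ-scale T T≉0 (λ p → *-cong (Character.cong A p) (Character.cong B (F.+-congʳ (F.-‿cong p)))) ⟩
      Σ (λ v → ⟦ A ⟧ (T F.* v) * ⟦ B ⟧ (F.- (T F.* v) F.+ T))
        ≈⟨ Σ-cong (λ v → trans (*-cong (Character.*-homo A T v) (trans (Character.cong B (factor-T v)) (Character.*-homo B T _)))
             (interchange _ _ _ _)) ⟩
      Σ (λ v → ⟦ A · B ⟧ T * (⟦ A ⟧ v * ⟦ B ⟧ (F.- v F.+ F.1#)))
        ≈⟨ *-Σ _ _ ⟨
      ⟦ A · B ⟧ T * J A B                             ∎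
      where
      factor-T : ∀ v → F.- (T F.* v) F.+ T F.≈ T F.* (F.- v F.+ F.1#)
      factor-T v = F.sym (F.trans (F.distribˡ T _ _) (F.+-cong (F.sym (FP.-‿distribʳ-* T v)) (F.*-identityʳ T)))

  -- Collect the pairs (x, y) by T = x + y: a product of additive transforms is the transform of the
  -- convolution.
  Σ-*-Σ-θ : ∀ {f h} → Congruent f → Congruent h →
    Σ (λ x → f x * ⟦ θ ⟧₊ x) * Σ (λ y → h y * ⟦ θ ⟧₊ y) ≈
    Σ λ T → Σ (λ x → f x * h (F.- x F.+ T)) * ⟦ θ ⟧₊ T
  Σ-*-Σ-θ {f} {h} f-cong h-cong = begin
    Σ (λ x → f x * ⟦ θ ⟧₊ x) * Σ (λ y → h y * ⟦ θ ⟧₊ y)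
      ≈⟨ trans (Σ-*-Σ _ _) (Σ-cong λ x →
           Σ-shift (F.- x) (λ p → *-congˡ (*-cong (h-cong p) (θ.cong p)))) ⟩
    Σ (λ x → Σ λ T → f x * ⟦ θ ⟧₊ x * (h (F.- x F.+ T) * ⟦ θ ⟧₊ (F.- x F.+ T)))
      ≈⟨ Σ-cong (λ x → Σ-cong λ T → trans (interchange _ _ _ _) (*-congˡ (trans (sym (θ.+-homo _ _))
           (θ.cong (F.trans (F.sym (F.+-assoc _ _ _)) (F.trans (F.+-congʳ (F.-‿inverseʳ x)) (F.+-identityˡ T))))))) ⟩
    Σ (λ x → Σ λ T → f x * h (F.- x F.+ T) * ⟦ θ ⟧₊ T)
      ≈⟨ trans (Σ-comm _) (Σ-cong λ T → sym (Σ-* _ _)) ⟩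
    Σ (λ T → Σ (λ x → f x * h (F.- x F.+ T)) * ⟦ θ ⟧₊ T) ∎

  γ-J : ∀ A B → ¬ (A · B ≋ ε) → γ A * γ B ≈ J A B * γ (A · B)
  γ-J A B AB≢ε = begin
    γ A * γ B
      ≈⟨ *-cong (γ-def A) (γ-def B) ⟩
    Σ (λ x → ⟦ A ⟧ x * ⟦ θ ⟧₊ x) * Σ (λ y → ⟦ B ⟧ y * ⟦ θ ⟧₊ y)
      ≈⟨ Σ-*-Σ-θ (Character.cong A) (Character.cong B) ⟩
    Σ (λ T → Σ (λ x → ⟦ A ⟧ x * ⟦ B ⟧ (F.- x F.+ T)) * ⟦ θ ⟧₊ T)
      ≈⟨ Σ-cong (λ T → trans (*-congʳ (trans (convolution A B T AB≢ε) (*-comm _ _))) (*-assoc _ _ _)) ⟩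
    Σ (λ T → J A B * (⟦ A · B ⟧ T * ⟦ θ ⟧₊ T))
      ≈⟨ trans (*-congˡ (γ-def _)) (*-Σ _ _) ⟨
    J A B * γ (A · B) ∎

  Σ̂-translate : ∀ {f} α → Congruent^ f → Σ̂ f ≈ Σ̂ λ χ → f (α · χ)
  Σ̂-translate α f-cong = Σ̂-reindex (α ·_) (α ⁻¹ ·_) f-cong
    (λ _ _ p x → *-congˡ (p x)) (λ _ _ p x → *-congˡ (p x))
    (λ χ → GS.solve (α ∷ χ ∷ []) (x₀ ⊙ (x₀ ⁻ ⊙ x₁)) x₁)
    (λ χ → GS.solve (α ∷ χ ∷ []) (x₀ ⁻ ⊙ (x₀ ⊙ x₁)) x₁)

  2F 4F : F.Carrier
  2F = F.1# F.+ F.1#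
  4F = 2F F.* 2F

  module WithQuadratic (φ : Character) (φφ≋ε : φ · φ ≋ ε) (φ≢ε : ¬ (φ ≋ ε)) where

    open Quadratic φ φφ≋ε φ≢ε

    drop-φφ : ∀ χ → χ · (φ · φ) ≋ χ
    drop-φφ χ = Ĝ.trans {χ · (φ · φ)} {χ · ε} {χ} (λ x → *-congˡ (φφ≋ε x)) (Ĝ.identityʳ χ)

    4≉0 : ¬ (4F F.≈ F.0#)
    4≉0 = F.*-≉0 2≉0 2≉0

    -- With u = 2x - T the two factors multiply to X(T² - u²), a function of v = u². Weighting v by
    -- its 1 + φ(v) roots gives a complete sum of X, which is 0, plus the convolution of φ and X at
    -- T²; there (φX)(T²) = X²(T).
    square-term : ∀ X → ¬ (X ≋ ε) → ¬ (φ · X ≋ ε) → ∀ T →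
      Σ (λ x → ⟦ X ⟧ (2F F.* x) * ⟦ X ⟧ (2F F.* (F.- x F.+ T))) ≈ ⟦ X · X ⟧ T * J φ X
    square-term X X≢ε φX≢ε T = begin
      Σ (λ x → ⟦ X ⟧ (2F F.* x) * ⟦ X ⟧ (2F F.* (F.- x F.+ T)))
        ≈⟨ Σ-cong (λ x → *-congˡ (Character.cong X (double x))) ⟩
      Σ (λ x → ⟦ X ⟧ (2F F.* x) * ⟦ X ⟧ (F.- (2F F.* x) F.+ (T F.+ T)))
        ≈⟨ Σ-scale 2F 2≉0 (λ p → *-cong (Character.cong X p) (Character.cong X (F.+-congʳ (F.-‿cong p)))) ⟨
      Σ (λ u → ⟦ X ⟧ u * ⟦ X ⟧ (F.- u F.+ (T F.+ T)))
        ≈⟨ Σ-shift T (λ p → *-cong (Character.cong X p) (Character.cong X (F.+-congʳ (F.-‿cong p)))) ⟩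
      Σ (λ u → ⟦ X ⟧ (T F.+ u) * ⟦ X ⟧ (F.- (T F.+ u) F.+ (T F.+ T)))
        ≈⟨ Σ-cong (λ u → trans (sym (Character.*-homo X _ _)) (Character.cong X (conjugate u))) ⟩
      Σ (λ u → ⟦ X ⟧ (F.- (u F.* u) F.+ T F.* T))
        ≈⟨ Σ-square (λ v → ⟦ X ⟧ (F.- v F.+ T F.* T)) h-cong ⟩
      Σ (λ v → (1# + ⟦ φ ⟧ v) * ⟦ X ⟧ (F.- v F.+ T F.* T))
        ≈⟨ trans (Σ-cong λ v → trans (distribʳ _ _ _) (+-congʳ (*-identityˡ _))) (Σ-distrib-+ _ _) ⟩
      Σ (λ v → ⟦ X ⟧ (F.- v F.+ T F.* T)) + Σ (λ v → ⟦ φ ⟧ v * ⟦ X ⟧ (F.- v F.+ T F.* T))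
        ≈⟨ +-cong (trans (Σ-neg h-cong) (trans (Σ-cong λ v → Character.cong X (F.trans (F.+-congʳ (FP.-‿involutive v)) (F.+-comm _ _)))
             (trans (sym (Σ-shift (T F.* T) (Character.cong X))) (Σ-χ≈0 X X≢ε))))
             (convolution φ X (T F.* T) φX≢ε) ⟩
      0# + ⟦ φ · X ⟧ (T F.* T) * J φ X
        ≈⟨ trans (+-identityˡ _) (*-congʳ (trans (Character.*-homo (φ · X) T T)
             (trans (GS.solve (φ ∷ X ∷ []) ((x₀ ⊙ x₁) ⊙ (x₀ ⊙ x₁)) ((x₁ ⊙ x₁) ⊙ (x₀ ⊙ x₀)) T) (drop-φφ (X · X) T)))) ⟩
      ⟦ X · X ⟧ T * J φ X ∎
      where
      h-cong : Congruent (λ v → ⟦ X ⟧ (F.- v F.+ T F.* T))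
      h-cong p = Character.cong X (F.+-congʳ (F.-‿cong p))
      double : ∀ x → 2F F.* (F.- x F.+ T) F.≈ F.- (2F F.* x) F.+ (T F.+ T)
      double x = F.trans (F.distribˡ 2F _ _) (F.+-cong (F.sym (FP.-‿distribʳ-* 2F x))
        (F.trans (F.distribʳ T _ _) (F.+-cong (F.*-identityˡ T) (F.*-identityˡ T))))
      conjugate : ∀ u → (T F.+ u) F.* (F.- (T F.+ u) F.+ (T F.+ T)) F.≈ F.- (u F.* u) F.+ T F.* T
      conjugate u = FR.begin
        (T F.+ u) F.* (F.- (T F.+ u) F.+ (T F.+ T))
          FR.≈⟨ F.*-congˡ (F.trans (F.+-congʳ (F.trans (F.sym (FP.-‿+-comm T u)) (F.+-comm _ _)))
                (F.trans (F.+-assoc _ _ _) (F.+-congˡ (F.trans (F.sym (F.+-assoc _ _ _)) (F.trans (F.+-congʳ (F.-‿inverseˡ T)) (F.+-identityˡ T)))))) ⟩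
        (T F.+ u) F.* (F.- u F.+ T)
          FR.≈⟨ F.distribˡ _ _ _ ⟩
        (T F.+ u) F.* F.- u F.+ (T F.+ u) F.* T
          FR.≈⟨ F.+-cong (F.sym (FP.-‿distribʳ-* _ u)) (F.distribʳ T T u) ⟩
        F.- ((T F.+ u) F.* u) F.+ (T F.* T F.+ u F.* T)
          FR.≈⟨ F.+-cong (F.trans (F.-‿cong (F.trans (F.distribʳ u T u) (F.+-comm _ _))) (F.sym (FP.-‿+-comm _ _))) (F.+-comm _ _) ⟩
        (F.- (u F.* u) F.+ F.- (T F.* u)) F.+ (u F.* T F.+ T F.* T)
          FR.≈⟨ F.trans (F.+-assoc _ _ _) (F.+-congˡ (F.trans (F.sym (F.+-assoc _ _ _))
                (F.trans (F.+-congʳ (F.trans (F.+-congˡ (F.*-comm u T)) (F.-‿inverseˡ _))) (F.+-identityˡ _)))) ⟩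
        F.- (u F.* u) F.+ T F.* T FR.∎
        where module FR = SetoidReasoning F.setoid

    -- The quadratic case of the Davenport–Hasse product formula.
    duplication : ∀ X → ⟦ X ⟧ 4F * (γ X * γ (φ · X)) ≈ γ φ * γ (X · X)
    duplication X with X ≟ ε | (φ · X) ≟ ε
    ... | yes X≋ε | _ = begin
      ⟦ X ⟧ 4F * (γ X * γ (φ · X))    ≈⟨ *-cong (trans (X≋ε 4F) (nonzero-1 4≉0)) (*-cong (γ-cong {X} {ε} X≋ε)
                                          (γ-cong {φ · X} {φ} (λ x → trans (*-congˡ (X≋ε x)) (Ĝ.identityʳ φ x)))) ⟩
      1# * (γ ε * γ φ)                ≈⟨ trans (*-identityˡ _) (*-comm _ _) ⟩
      γ φ * γ ε                       ≈⟨ *-congˡ (γ-cong {X · X} {ε} λ x → trans (*-cong (X≋ε x) (X≋ε x)) (Ĝ.identityˡ ε x)) ⟨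
      γ φ * γ (X · X)                 ∎
    ... | no _ | yes φX≋ε = begin
      ⟦ X ⟧ 4F * (γ X * γ (φ · X))    ≈⟨ *-cong (trans (X≋φ 4F) (φ-square 2≉0)) (*-cong (γ-cong {X} {φ} X≋φ) (γ-cong {φ · X} {ε} φX≋ε)) ⟩
      1# * (γ φ * γ ε)                ≈⟨ *-identityˡ _ ⟩
      γ φ * γ ε                       ≈⟨ *-congˡ (γ-cong {X · X} {ε} λ x → trans (*-cong (X≋φ x) (X≋φ x)) (φφ≋ε x)) ⟨
      γ φ * γ (X · X)                 ∎
      where
      X≋φ : X ≋ φ
      X≋φ = Ĝ.trans {X} {φ · X · φ} {φ} (Ĝ.trans {X} {X · (φ · φ)} {φ · X · φ} (Ĝ.sym {X · (φ · φ)} {X} (drop-φφ X))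
              (GS.solve (φ ∷ X ∷ []) (x₁ ⊙ (x₀ ⊙ x₀)) ((x₀ ⊙ x₁) ⊙ x₀)))
              (λ x → trans (*-congʳ (φX≋ε x)) (Ĝ.identityˡ φ x))
    -- A further factor g(X) completes the square of X(2)g(X), the additive transform of X(2x), to
    -- which `square-term` applies. The Jacobi sum J(φ, X) it leaves is absorbed by `γ-J`. In the
    -- two degenerate cases above, both sides are g(φ)g(ε).
    ... | no X≢ε | no φX≢ε = cancelˡ (γ≉0 X) (begin
      γ X * (⟦ X ⟧ 4F * (γ X * γ (φ · X)))
        ≈⟨ *-congˡ (*-congʳ (Character.*-homo X 2F 2F)) ⟩
      γ X * (⟦ X ⟧ 2F * ⟦ X ⟧ 2F * (γ X * γ (φ · X)))
        ≈⟨ CS.solve 3 (λ x a g → x ⊕ ((a ⊕ a) ⊕ (x ⊕ g)) ⊜ ((a ⊕ x) ⊕ (a ⊕ x)) ⊕ g) ≈-refl _ _ _ ⟩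
      ⟦ X ⟧ 2F * γ X * (⟦ X ⟧ 2F * γ X) * γ (φ · X)
        ≈⟨ *-congʳ square ⟩
      J φ X * γ (X · X) * γ (φ · X)
        ≈⟨ CS.solve 3 (λ a b c → (a ⊕ b) ⊕ c ⊜ (a ⊕ c) ⊕ b) ≈-refl _ _ _ ⟩
      J φ X * γ (φ · X) * γ (X · X)
        ≈⟨ *-congʳ (γ-J φ X φX≢ε) ⟨
      γ φ * γ X * γ (X · X)
        ≈⟨ CS.solve 3 (λ a b c → (a ⊕ b) ⊕ c ⊜ b ⊕ (a ⊕ c)) ≈-refl _ _ _ ⟩
      γ X * (γ φ * γ (X · X)) ∎)
      where
      doubled : ⟦ X ⟧ 2F * γ X ≈ Σ λ x → ⟦ X ⟧ (2F F.* x) * ⟦ θ ⟧₊ x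
      doubled = trans (*-congˡ (γ-def X)) (trans (*-Σ _ _) (Σ-cong λ x →
        trans (sym (*-assoc _ _ _)) (*-congʳ (sym (Character.*-homo X 2F x)))))
      square : ⟦ X ⟧ 2F * γ X * (⟦ X ⟧ 2F * γ X) ≈ J φ X * γ (X · X)
      square = trans (*-cong doubled doubled) (trans
        (Σ-*-Σ-θ (λ p → Character.cong X (F.*-congˡ p)) (λ p → Character.cong X (F.*-congˡ p)))
        (trans (Σ-cong λ T → trans (*-congʳ (trans (square-term X X≢ε φX≢ε T) (*-comm _ _))) (*-assoc _ _ _))
        (sym (trans (*-congˡ (γ-def _)) (*-Σ _ _)))))

  -- Kummer sums

  module KummerSums (φ : Character) (φφ≋ε : φ · φ ≋ ε) (φ≢ε : ¬ (φ ≋ ε)) where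

    open Quadratic φ φφ≋ε φ≢ε
    open WithQuadratic φ φφ≋ε φ≢ε

    γ-drop-φφ : ∀ χ → γ (χ · (φ · φ)) ≈ γ χ
    γ-drop-φφ χ = γ-cong {χ · (φ · φ)} {χ} (drop-φφ χ)

    -- If k ≠ 0, then τ(P,k) = P̄(k)g(P), and P̄(k) is absorbed into the other τ by scaling. Unlike
    -- `τ-*-τ` this puts no condition on P, but at k = l = 0 it would fail for P = ε.
    τ-*-τ-γ : ∀ P k l → ¬ (k F.≈ F.0# × l F.≈ F.0#) → τ P k * τ P l ≈ γ P * τ P (k F.* l)
    τ-*-τ-γ P k l ¬both = cases (k F.≟ F.0#) (l F.≟ F.0#)
      where
      unit-case : ∀ k l → ¬ (k F.≈ F.0#) → τ P k * τ P l ≈ γ P * τ P (k F.* l)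
      unit-case k l k≉0 = begin
        τ P k * τ P l                   ≈⟨ *-congʳ (τ-unit P k≉0) ⟩
        ⟦ P ⁻¹ ⟧ k * γ P * τ P l        ≈⟨ CS.solve 3 (λ a b c → (a ⊕ b) ⊕ c ⊜ b ⊕ (a ⊕ c)) ≈-refl _ _ _ ⟩
        γ P * (⟦ P ⁻¹ ⟧ k * τ P l)      ≈⟨ *-congˡ (τ-scale P l k≉0) ⟨
        γ P * τ P (k F.* l)             ∎
      cases : Dec (k F.≈ F.0#) → Dec (l F.≈ F.0#) → τ P k * τ P l ≈ γ P * τ P (k F.* l)
      cases (no k≉0)  _         = unit-case k l k≉0
      cases (yes _)   (no l≉0)  = trans (*-comm _ _) (trans (unit-case l k l≉0) (*-congˡ (τ-argument P (F.*-comm l k))))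
      cases (yes k≈0) (yes l≈0) = contradiction (k≈0 , l≈0) ¬both

    -- The sign ψ(-1) reverses t in one of the two expansions, so Parseval brings together τ(P, 1 +
    -- s) and τ(P, 1 - s). Their arguments never vanish together because 2 ≠ 0, and they merge into
    -- τ(P, 1 - s²), a function of s²; the weight 1 + φ(v) for v = s² gives the two products of
    -- Gauss sums.
    kummer-symmetric : ∀ X Y →
      Σ̂ (λ ψ → ⟦ ψ ⟧ -1F * (γ (X · ψ) * γ (Y · ψ) * (γ (X · ψ ⁻¹) * γ (Y · ψ ⁻¹)))) ≈
      N * (γ (X · Y) * (γ X * γ Y + ⟦ φ ⟧ -1F * (γ (φ · X) * γ (φ · Y))))
    kummer-symmetric X Y = begin
      Σ̂ (λ ψ → ⟦ ψ ⟧ -1F * (γ (X · ψ) * γ (Y · ψ) * (γ (X · ψ ⁻¹) * γ (Y · ψ ⁻¹))))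
        ≈⟨ Σ̂-cong (λ ψ → trans (CS.solve 5 (λ m a b c d → m ⊕ ((a ⊕ b) ⊕ (c ⊕ d)) ⊜ (a ⊕ d) ⊕ (m ⊕ (c ⊕ b))) ≈-refl _ _ _ _ _)
             (*-cong (first ψ) (second ψ))) ⟩
      Σ̂ (λ ψ → Σ (λ s → ⟦ X · ψ ⟧ s * τ P (F.1# F.+ s)) * Σ (λ t → ⟦ X · ψ ⁻¹ ⟧ t * (⟦ X ⟧ -1F * τ P (F.1# F.- t))))
        ≈⟨ parseval X X (λ p → τ-argument P (F.+-congˡ p)) (λ p → *-congˡ (τ-argument P (F.+-congˡ (F.-‿cong p)))) ⟩
      N * Σ (λ s → ⟦ X · X ⟧ s * (τ P (F.1# F.+ s) * (⟦ X ⟧ -1F * τ P (F.1# F.- s))))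
        ≈⟨ *-congˡ (Σ-cong (λ s → begin
             ⟦ X · X ⟧ s * (τ P (F.1# F.+ s) * (⟦ X ⟧ -1F * τ P (F.1# F.- s)))
               ≈⟨ *-cong (sym (Character.*-homo X s s)) (trans (CS.solve 3 (λ a b c → a ⊕ (b ⊕ c) ⊜ b ⊕ (a ⊕ c)) ≈-refl _ _ _)
                    (*-congˡ (trans (τ-*-τ-γ P _ _ (not-both s)) (*-congˡ (τ-argument P (conjugate s)))))) ⟩
             ⟦ X ⟧ (s F.* s) * (⟦ X ⟧ -1F * (γ P * τ P (F.1# F.- s F.* s)))
               ≈⟨ CS.solve 4 (λ a b c d → a ⊕ (b ⊕ (c ⊕ d)) ⊜ c ⊕ ((b ⊕ a) ⊕ d)) ≈-refl _ _ _ _ ⟩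
             γ P * (⟦ X ⟧ -1F * ⟦ X ⟧ (s F.* s) * τ P (F.1# F.- s F.* s))
               ≈⟨ *-congˡ (*-congʳ (χ-neg X _)) ⟨
             γ P * h (s F.* s) ∎)) ⟩
      N * Σ (λ s → γ P * h (s F.* s))
        ≈⟨ *-congˡ (trans (sym (*-Σ _ _)) (*-congˡ (Σ-square h h-cong))) ⟩
      N * (γ P * Σ (λ v → (1# + ⟦ φ ⟧ v) * h v))
        -- Replacing v by -v restores the argument 1 + v required by `γ-*-γ` and leaves φ(-1) in
        -- front of the twisted half.
        ≈⟨ *-congˡ (*-congˡ (trans (Σ-neg (λ p → *-cong (+-congˡ (Character.cong φ p)) (h-cong p)))
             (trans (Σ-cong λ v → trans (*-congˡ (*-cong (Character.cong X (FP.-‿involutive v)) (τ-argument P (F.+-congˡ (FP.-‿involutive v)))))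
               (trans (distribʳ _ _ _) (+-cong (*-identityˡ _) (trans (*-congʳ (χ-neg φ v))
                 (CS.solve 4 (λ a b c d → (a ⊕ b) ⊕ (c ⊕ d) ⊜ a ⊕ ((b ⊕ c) ⊕ d)) ≈-refl _ _ _ _)))))
             (trans (Σ-distrib-+ _ _) (+-congˡ (sym (*-Σ _ _))))))) ⟩
      N * (γ P * (Σ (λ v → ⟦ X ⟧ v * τ P (F.1# F.+ v)) + ⟦ φ ⟧ -1F * Σ (λ v → ⟦ φ · X ⟧ v * τ P (F.1# F.+ v))))
        ≈⟨ *-congˡ (*-congˡ (+-cong (γ-*-γ X Y) (*-congˡ (trans (γ-*-γ (φ · X) (φ · Y)) (Σ-cong λ v → *-congˡ (τ-cong {φ · X · (φ · Y)} {P} twisted F.refl)))))) ⟨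
      N * (γ P * (γ X * γ Y + ⟦ φ ⟧ -1F * (γ (φ · X) * γ (φ · Y)))) ∎
      where
      P : Character
      P = X · Y
      h : F.Carrier → ℂ
      h v = ⟦ X ⟧ (F.- v) * τ P (F.1# F.- v)
      h-cong : Congruent h
      h-cong p = *-cong (Character.cong X (F.-‿cong p)) (τ-argument P (F.+-congˡ (F.-‿cong p)))
      twisted : φ · X · (φ · Y) ≋ P
      twisted = Ĝ.trans {φ · X · (φ · Y)} {P · (φ · φ)} {P}
        (GS.solve (φ ∷ X ∷ Y ∷ []) ((x₀ ⊙ x₁) ⊙ (x₀ ⊙ x₂)) ((x₁ ⊙ x₂) ⊙ (x₀ ⊙ x₀))) (drop-φφ P)
      not-both : ∀ s → ¬ (F.1# F.+ s F.≈ F.0# × F.1# F.- s F.≈ F.0#)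
      not-both s (p , r) = 1≉-1 (F.trans (F.sym (FP.-‿involutive F.1#))
        (F.trans (F.-‿cong (F.sym (FP.+-inverseʳ-unique F.1# s p))) (FP.+-inverseʳ-unique F.1# (F.- s) r)))
      conjugate : ∀ s → (F.1# F.+ s) F.* (F.1# F.- s) F.≈ F.1# F.- s F.* s
      conjugate s = FR.begin
        (F.1# F.+ s) F.* (F.1# F.- s)                   FR.≈⟨ F.distribˡ _ _ _ ⟩
        (F.1# F.+ s) F.* F.1# F.+ (F.1# F.+ s) F.* F.- s
          FR.≈⟨ F.+-cong (F.*-identityʳ _) (F.trans (F.distribʳ _ _ _) (F.+-cong (F.*-identityˡ _) (F.sym (FP.-‿distribʳ-* s s)))) ⟩
        (F.1# F.+ s) F.+ (F.- s F.+ F.- (s F.* s))      FR.≈⟨ F.trans (F.sym (F.+-assoc _ _ _)) (F.+-congʳ (F.trans (F.+-assoc _ _ _)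
                                                              (F.trans (F.+-congˡ (F.-‿inverseʳ s)) (F.+-identityʳ _)))) ⟩
        F.1# F.- s F.* s                                FR.∎
        where module FR = SetoidReasoning F.setoid
      first : ∀ ψ → γ (X · ψ) * γ (Y · ψ ⁻¹) ≈ Σ λ s → ⟦ X · ψ ⟧ s * τ P (F.1# F.+ s)
      first ψ = trans (γ-*-γ _ _) (Σ-cong λ s → *-congˡ
        (τ-solve (X ∷ Y ∷ ψ ∷ []) ((x₀ ⊙ x₂) ⊙ (x₁ ⊙ x₂ ⁻)) (x₀ ⊙ x₁)))
      second : ∀ ψ → ⟦ ψ ⟧ -1F * (γ (X · ψ ⁻¹) * γ (Y · ψ)) ≈ Σ λ t → ⟦ X · ψ ⁻¹ ⟧ t * (⟦ X ⟧ -1F * τ P (F.1# F.- t))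
      second ψ = begin
        ⟦ ψ ⟧ -1F * (γ (X · ψ ⁻¹) * γ (Y · ψ))
          ≈⟨ *-congˡ (trans (γ-*-γ _ _) (Σ-cong λ s → *-congˡ
               (τ-solve (X ∷ Y ∷ ψ ∷ []) ((x₀ ⊙ x₂ ⁻) ⊙ (x₁ ⊙ x₂)) (x₀ ⊙ x₁)))) ⟩
        ⟦ ψ ⟧ -1F * Σ (λ t → ⟦ X · ψ ⁻¹ ⟧ t * τ P (F.1# F.+ t))
          ≈⟨ *-congˡ (Σ-neg (λ p → *-cong (Character.cong (X · ψ ⁻¹) p) (τ-argument P (F.+-congˡ p)))) ⟩
        ⟦ ψ ⟧ -1F * Σ (λ t → ⟦ X · ψ ⁻¹ ⟧ (F.- t) * τ P (F.1# F.- t))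
          ≈⟨ *-Σ _ _ ⟩
        Σ (λ t → ⟦ ψ ⟧ -1F * (⟦ X · ψ ⁻¹ ⟧ (F.- t) * τ P (F.1# F.- t)))
          ≈⟨ Σ-cong (λ t → begin
               ⟦ ψ ⟧ -1F * (⟦ X · ψ ⁻¹ ⟧ (F.- t) * τ P (F.1# F.- t))
                 ≈⟨ *-congˡ (*-congʳ (trans (χ-neg (X · ψ ⁻¹) t) (*-congʳ (*-congˡ (χ⁻¹[-1] ψ))))) ⟩
               ⟦ ψ ⟧ -1F * (⟦ X ⟧ -1F * ⟦ ψ ⟧ -1F * ⟦ X · ψ ⁻¹ ⟧ t * τ P (F.1# F.- t))
                 ≈⟨ CS.solve 4 (λ m x c d → m ⊕ (((x ⊕ m) ⊕ c) ⊕ d) ⊜ (m ⊕ m) ⊕ (c ⊕ (x ⊕ d))) ≈-refl _ _ _ _ ⟩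
               ⟦ ψ ⟧ -1F * ⟦ ψ ⟧ -1F * (⟦ X · ψ ⁻¹ ⟧ t * (⟦ X ⟧ -1F * τ P (F.1# F.- t)))
                 ≈⟨ trans (*-congʳ (χ[-1]²≈1 ψ)) (*-identityˡ _) ⟩
               ⟦ X · ψ ⁻¹ ⟧ t * (⟦ X ⟧ -1F * τ P (F.1# F.- t)) ∎) ⟩
        Σ (λ t → ⟦ X · ψ ⁻¹ ⟧ t * (⟦ X ⟧ -1F * τ P (F.1# F.- t))) ∎

    opaque

      -- Sum over the square roots R of S², which are S and φS; `∑√≈Σ√` relates it to the sum in the
      -- statement.
      Σ√ : Character → (Character → ℂ) → ℂ
      Σ√ S f = f S + f (φ · S)

      Σ√-def : ∀ S f → Σ√ S f ≈ f S + f (φ · S)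
      Σ√-def S f = ≈-refl

    -- Translating ψ by the inverse of S centres the sum: with X = x/S and Y = y/S the parameters of
    -- ψ and of its inverse coincide, as in `kummer-symmetric`.
    kummer : ∀ S x y →
      Σ̂ (λ ψ → ⟦ ψ ⟧ -1F * (γ (x · ψ) * γ (y · ψ) * (γ (x · (S · S) ⁻¹ · ψ ⁻¹) * γ (y · (S · S) ⁻¹ · ψ ⁻¹)))) ≈
      N * (γ (x · y · (S · S) ⁻¹) * Σ√ S λ R → ⟦ R ⟧ -1F * (γ (x · R ⁻¹) * γ (y · R ⁻¹)))
    kummer S x y = begin
      Σ̂ (λ ψ → ⟦ ψ ⟧ -1F * (γ (x · ψ) * γ (y · ψ) * (γ (x · (S · S) ⁻¹ · ψ ⁻¹) * γ (y · (S · S) ⁻¹ · ψ ⁻¹))))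
        ≈⟨ Σ̂-translate (S ⁻¹) (λ χ ψ p → *-cong (p -1F) (*-cong
             (*-cong (γ-cong {x · χ} {x · ψ} λ u → *-congˡ (p u)) (γ-cong {y · χ} {y · ψ} λ u → *-congˡ (p u)))
             (*-cong (γ-cong {x · (S · S) ⁻¹ · χ ⁻¹} {x · (S · S) ⁻¹ · ψ ⁻¹} λ u → *-congˡ (p (u F.⁻¹)))
                     (γ-cong {y · (S · S) ⁻¹ · χ ⁻¹} {y · (S · S) ⁻¹ · ψ ⁻¹} λ u → *-congˡ (p (u F.⁻¹)))))) ⟩
      Σ̂ (λ ψ → ⟦ S ⁻¹ · ψ ⟧ -1F * (γ (x · (S ⁻¹ · ψ)) * γ (y · (S ⁻¹ · ψ)) *
              (γ (x · (S · S) ⁻¹ · (S ⁻¹ · ψ) ⁻¹) * γ (y · (S · S) ⁻¹ · (S ⁻¹ · ψ) ⁻¹))))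
        ≈⟨ Σ̂-cong (λ ψ → trans (*-cong (*-congʳ (χ⁻¹[-1] S)) (*-cong
             (*-cong (up x ψ) (up y ψ)) (*-cong (down x ψ) (down y ψ)))) (*-assoc _ _ _)) ⟩
      Σ̂ (λ ψ → ⟦ S ⟧ -1F * (⟦ ψ ⟧ -1F * (γ (X · ψ) * γ (Y · ψ) * (γ (X · ψ ⁻¹) * γ (Y · ψ ⁻¹)))))
        ≈⟨ trans (sym (*-Σ̂ _ _)) (*-congˡ (kummer-symmetric X Y)) ⟩
      ⟦ S ⟧ -1F * (N * (γ (X · Y) * (γ X * γ Y + ⟦ φ ⟧ -1F * (γ (φ · X) * γ (φ · Y)))))
        ≈⟨ CS.solve 4 (λ s n a b → s ⊕ (n ⊕ (a ⊕ b)) ⊜ n ⊕ (a ⊕ (s ⊕ b))) ≈-refl _ _ _ _ ⟩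
      N * (γ (X · Y) * (⟦ S ⟧ -1F * (γ X * γ Y + ⟦ φ ⟧ -1F * (γ (φ · X) * γ (φ · Y)))))
        ≈⟨ *-congˡ (*-cong (γ-solve (S ∷ x ∷ y ∷ []) ((x₁ ⊙ x₀ ⁻) ⊙ (x₂ ⊙ x₀ ⁻)) ((x₁ ⊙ x₂) ⊙ (x₀ ⊙ x₀) ⁻))
             (trans (distribˡ _ _ _) (trans (+-congˡ (trans (CS.solve 3 (λ s f b → s ⊕ (f ⊕ b) ⊜ (f ⊕ s) ⊕ b) ≈-refl _ _ _)
               (*-congˡ (*-cong (twist x) (twist y))))) (sym (Σ√-def S _))))) ⟩
      N * (γ (x · y · (S · S) ⁻¹) * Σ√ S (λ R → ⟦ R ⟧ -1F * (γ (x · R ⁻¹) * γ (y · R ⁻¹)))) ∎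
      where
      X Y : Character
      X = x · S ⁻¹
      Y = y · S ⁻¹
      up : ∀ x ψ → γ (x · (S ⁻¹ · ψ)) ≈ γ (x · S ⁻¹ · ψ)
      up x ψ = γ-solve (S ∷ x ∷ ψ ∷ []) (x₁ ⊙ (x₀ ⁻ ⊙ x₂)) ((x₁ ⊙ x₀ ⁻) ⊙ x₂)
      down : ∀ x ψ → γ (x · (S · S) ⁻¹ · (S ⁻¹ · ψ) ⁻¹) ≈ γ (x · S ⁻¹ · ψ ⁻¹)
      down x ψ = γ-solve (S ∷ x ∷ ψ ∷ []) ((x₁ ⊙ (x₀ ⊙ x₀) ⁻) ⊙ (x₀ ⁻ ⊙ x₂) ⁻) ((x₁ ⊙ x₀ ⁻) ⊙ x₂ ⁻)
      twist : ∀ x → γ (φ · (x · S ⁻¹)) ≈ γ (x · (φ · S) ⁻¹)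
      twist x = trans (γ-solve (φ ∷ S ∷ x ∷ []) (x₀ ⊙ (x₂ ⊙ x₁ ⁻)) ((x₂ ⊙ (x₀ ⊙ x₁) ⁻) ⊙ (x₀ ⊙ x₀)))
                      (γ-drop-φφ (x · (φ · S) ⁻¹))

  -- Well-poised sums

  N≉0 : ¬ (N ≈ 0#)
  N≉0 N≈0 = positive (q ℕ.∸ 1) (q∸1-nonZero 𝔽) (trans (sym Σ̂-1) N≈0)
    where
    positive : ∀ n → ℕ.NonZero n → ¬ (n ⊗ 1# ≈ 0#)
    positive (suc n) _ = suc⊗1≉0 1≉0 n

  module WellPoised (φ : Character) (φφ≋ε : φ · φ ≋ ε) (φ≢ε : ¬ (φ ≋ ε)) (S : Character) where

    open WithQuadratic φ φφ≋ε φ≢ε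
    open KummerSums φ φφ≋ε φ≢ε

    -- The well-poised parameter is given through a square root S because Kummer's theorem sums over
    -- the roots of a.
    a : Character
    a = S · S

    -- Numerator of the column x over a/x of a well-poised series: x/(aψ) is the inverse of (a/x)ψ.
    pair : Character → Character → ℂ
    pair x ψ = γ (x · ψ) * γ (x · a ⁻¹ · ψ ⁻¹)

    Σ√-cong : ∀ {f h} → (∀ R → R · R ≋ a → f R ≈ h R) → Σ√ S f ≈ Σ√ S h
    Σ√-cong eq = trans (Σ√-def S _) (trans (+-cong (eq S (Ĝ.refl {a})) (eq (φ · S) (Ĝ.trans {φ · S · (φ · S)} {a · (φ · φ)} {a}
      (GS.solve (φ ∷ S ∷ []) ((x₀ ⊙ x₁) ⊙ (x₀ ⊙ x₁)) ((x₁ ⊙ x₁) ⊙ (x₀ ⊙ x₀))) (drop-φφ a)))) (sym (Σ√-def S _)))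

    *-Σ√ : ∀ z f → z * Σ√ S f ≈ Σ√ S λ R → z * f R
    *-Σ√ z f = trans (*-congˡ (Σ√-def S f)) (trans (distribˡ _ _ _) (sym (Σ√-def S _)))

    Σ̂-Σ√ : (f : Character → Character → ℂ) → Σ̂ (λ χ → Σ√ S λ R → f χ R) ≈ Σ√ S λ R → Σ̂ λ χ → f χ R
    Σ̂-Σ√ f = trans (Σ̂-cong λ χ → Σ√-def S (f χ)) (trans (Σ̂-distrib-+ _ _) (sym (Σ√-def S _)))

    kummer-pair : ∀ x y → Σ̂ (λ ψ → ⟦ ψ ⟧ -1F * (pair x ψ * pair y ψ)) ≈
                  N * (γ (x · y · a ⁻¹) * Σ√ S λ R → ⟦ R ⟧ -1F * (γ (x · R ⁻¹) * γ (y · R ⁻¹)))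
    kummer-pair x y = trans (Σ̂-cong λ ψ → *-congˡ (interchange _ _ _ _)) (kummer S x y)

    -- Barnes' lemma from right to left, with ψ and 1/(aψ) as the last two parameters. The product
    -- of the four parameters is xy/a, so its Gauss sum does not depend on ψ.
    barnes-pair : ∀ x y ψ → ¬ (x · y · a ⁻¹ ≋ ε) →
      N * (pair x ψ * pair y ψ) ≈ γ (x · y · a ⁻¹) * Σ̂ λ ω → γ (x · ω) * γ (y · ω) * pair (ω ⁻¹) ψ
    barnes-pair x y ψ xy≢a = sym (begin
      γ (x · y · a ⁻¹) * Σ̂ (λ ω → γ (x · ω) * γ (y · ω) * pair (ω ⁻¹) ψ)
        ≈⟨ *-cong (γ-cong {x · y · a ⁻¹} {P} P≋) (Σ̂-cong λ ω → *-congˡ (*-cong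
             (γ-solve (ω ∷ ψ ∷ []) (x₀ ⁻ ⊙ x₁) (x₁ ⊙ x₀ ⁻))
             (γ-solve (S ∷ ω ∷ ψ ∷ []) ((x₁ ⁻ ⊙ (x₀ ⊙ x₀) ⁻) ⊙ x₂ ⁻) (((x₀ ⊙ x₀) ⁻ ⊙ x₂ ⁻) ⊙ x₁ ⁻)))) ⟩
      γ P * barnes-sum x y ψ (a ⁻¹ · ψ ⁻¹)
        ≈⟨ barnes x y ψ (a ⁻¹ · ψ ⁻¹) (λ P≋ε → xy≢a (Ĝ.trans {x · y · a ⁻¹} {P} {ε} P≋ P≋ε)) ⟩
      N * (γ (x · ψ) * γ (a ⁻¹ · ψ ⁻¹ · y) * (γ (x · (a ⁻¹ · ψ ⁻¹)) * γ (ψ · y)))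
        ≈⟨ *-congˡ (trans (CS.solve 4 (λ a b c d → (a ⊕ b) ⊕ (c ⊕ d) ⊜ (a ⊕ c) ⊕ (d ⊕ b)) ≈-refl _ _ _ _)
             (*-cong (*-congˡ (γ-solve (S ∷ x ∷ ψ ∷ []) (x₁ ⊙ ((x₀ ⊙ x₀) ⁻ ⊙ x₂ ⁻)) ((x₁ ⊙ (x₀ ⊙ x₀) ⁻) ⊙ x₂ ⁻)))
               (*-cong (γ-solve (y ∷ ψ ∷ []) (x₁ ⊙ x₀) (x₀ ⊙ x₁))
                 (γ-solve (S ∷ y ∷ ψ ∷ []) (((x₀ ⊙ x₀) ⁻ ⊙ x₂ ⁻) ⊙ x₁) ((x₁ ⊙ (x₀ ⊙ x₀) ⁻) ⊙ x₂ ⁻))))) ⟩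
      N * (pair x ψ * pair y ψ) ∎)
      where
      P : Character
      P = x · ψ · (a ⁻¹ · ψ ⁻¹ · y)
      P≋ : x · y · a ⁻¹ ≋ P
      P≋ = GS.solve (S ∷ x ∷ y ∷ ψ ∷ []) ((x₁ ⊙ x₂) ⊙ (x₀ ⊙ x₀) ⁻) ((x₁ ⊙ x₃) ⊙ (((x₀ ⊙ x₀) ⁻ ⊙ x₃ ⁻) ⊙ x₂))

    -- Barnes' lemma turns two of the pairs into a sum over ω of the single
    -- pair of ω ⁻¹, which lowers the number of pairs by one.
    lower : ∀ x y (f : Character → ℂ) → ¬ (x · y · a ⁻¹ ≋ ε) →
      N * Σ̂ (λ ψ → ⟦ ψ ⟧ -1F * (pair x ψ * pair y ψ * f ψ)) ≈
      γ (x · y · a ⁻¹) * Σ̂ λ ω → γ (x · ω) * γ (y · ω) * Σ̂ λ ψ → ⟦ ψ ⟧ -1F * (pair (ω ⁻¹) ψ * f ψ)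
    lower x y f xy≢a = begin
      N * Σ̂ (λ ψ → ⟦ ψ ⟧ -1F * (pair x ψ * pair y ψ * f ψ))
        ≈⟨ trans (*-Σ̂ _ _) (Σ̂-cong λ ψ → trans (CS.solve 4 (λ n m p f → n ⊕ (m ⊕ (p ⊕ f)) ⊜ (n ⊕ p) ⊕ (m ⊕ f)) ≈-refl _ _ _ _)
             (trans (*-congʳ (barnes-pair x y ψ xy≢a)) (trans (*-assoc _ _ _) (*-congˡ (Σ̂-* _ _))))) ⟩
      Σ̂ (λ ψ → γ (x · y · a ⁻¹) * Σ̂ λ ω → γ (x · ω) * γ (y · ω) * pair (ω ⁻¹) ψ * (⟦ ψ ⟧ -1F * f ψ))
        ≈⟨ trans (sym (*-Σ̂ _ _)) (*-congˡ (Σ̂-comm _)) ⟩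
      γ (x · y · a ⁻¹) * Σ̂ (λ ω → Σ̂ λ ψ → γ (x · ω) * γ (y · ω) * pair (ω ⁻¹) ψ * (⟦ ψ ⟧ -1F * f ψ))
        ≈⟨ *-congˡ (Σ̂-cong λ ω → trans
             (Σ̂-cong λ ψ → CS.solve 4 (λ g p m f → (g ⊕ p) ⊕ (m ⊕ f) ⊜ g ⊕ (m ⊕ (p ⊕ f))) ≈-refl _ _ _ _)
             (sym (*-Σ̂ _ _))) ⟩
      γ (x · y · a ⁻¹) * Σ̂ (λ ω → γ (x · ω) * γ (y · ω) * Σ̂ λ ψ → ⟦ ψ ⟧ -1F * (pair (ω ⁻¹) ψ * f ψ)) ∎

    -- After `lower`, the two remaining pairs fall to Kummer's theorem, and for each root R the sum
    -- over ω is a Barnes sum again. It stays unevaluated because its parameters may multiply to ε.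
    dixon : ∀ x y z → ¬ (x · y · a ⁻¹ ≋ ε) →
      Σ̂ (λ ψ → ⟦ ψ ⟧ -1F * (pair x ψ * pair y ψ * pair z ψ)) ≈
      γ (x · y · a ⁻¹) * Σ√ S λ R → ⟦ R ⟧ -1F * γ (z · R ⁻¹) * barnes-sum x y (z · a ⁻¹) (R ⁻¹)
    dixon x y z xy≢a = cancelˡ N≉0 (begin
      N * Σ̂ (λ ψ → ⟦ ψ ⟧ -1F * (pair x ψ * pair y ψ * pair z ψ))
        ≈⟨ lower x y (pair z) xy≢a ⟩
      γ P * Σ̂ (λ ω → γ (x · ω) * γ (y · ω) * Σ̂ λ ψ → ⟦ ψ ⟧ -1F * (pair (ω ⁻¹) ψ * pair z ψ))
        ≈⟨ *-congˡ (Σ̂-cong λ ω → trans (*-congˡ (trans (kummer-pair (ω ⁻¹) z) (*-congˡ (*-Σ√ _ _))))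
             (trans (CS.solve 3 (λ g n s → g ⊕ (n ⊕ s) ⊜ n ⊕ (g ⊕ s)) ≈-refl _ _ _) (*-congˡ (*-Σ√ _ _)))) ⟩
      γ P * Σ̂ (λ ω → N * Σ√ S λ R → γ (x · ω) * γ (y · ω) * (γ (ω ⁻¹ · z · a ⁻¹) * (⟦ R ⟧ -1F * (γ (ω ⁻¹ · R ⁻¹) * γ (z · R ⁻¹)))))
        ≈⟨ *-congˡ (trans (sym (*-Σ̂ _ _)) (*-congˡ (Σ̂-Σ√ _))) ⟩
      γ P * (N * Σ√ S λ R → Σ̂ λ ω → γ (x · ω) * γ (y · ω) * (γ (ω ⁻¹ · z · a ⁻¹) * (⟦ R ⟧ -1F * (γ (ω ⁻¹ · R ⁻¹) * γ (z · R ⁻¹)))))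
        ≈⟨ CS.solve 3 (λ p n s → p ⊕ (n ⊕ s) ⊜ n ⊕ (p ⊕ s)) ≈-refl _ _ _ ⟩
      N * (γ P * Σ√ S λ R → Σ̂ λ ω → γ (x · ω) * γ (y · ω) * (γ (ω ⁻¹ · z · a ⁻¹) * (⟦ R ⟧ -1F * (γ (ω ⁻¹ · R ⁻¹) * γ (z · R ⁻¹)))))
        ≈⟨ *-congˡ (*-congˡ (Σ√-cong λ R _ → trans (Σ̂-cong λ ω → trans
             (CS.solve 5 (λ g c m d e → g ⊕ (c ⊕ (m ⊕ (d ⊕ e))) ⊜ (m ⊕ e) ⊕ (g ⊕ (c ⊕ d))) ≈-refl _ _ _ _ _)
             (*-congˡ (*-congˡ (*-cong
               (γ-solve (S ∷ z ∷ ω ∷ []) ((x₂ ⁻ ⊙ x₁) ⊙ (x₀ ⊙ x₀) ⁻) ((x₁ ⊙ (x₀ ⊙ x₀) ⁻) ⊙ x₂ ⁻))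
               (γ-solve (R ∷ ω ∷ []) (x₁ ⁻ ⊙ x₀ ⁻) (x₀ ⁻ ⊙ x₁ ⁻)))))) (sym (*-Σ̂ _ _)))) ⟩
      N * (γ P * Σ√ S λ R → ⟦ R ⟧ -1F * γ (z · R ⁻¹) * barnes-sum x y (z · a ⁻¹) (R ⁻¹)) ∎)
      where
      P : Character
      P = x · y · a ⁻¹

    -- The ₃F₂ at 1 with upper parameters R/c, d, e and lower parameters ε, R, a/c, before
    -- normalisation.
    balanced-sum : Character → Character → Character → Character → ℂ
    balanced-sum c d e R = Σ̂ λ χ → ⟦ χ ⟧ -1F *
      (γ (R · c ⁻¹ · χ) * (γ (d · χ) * γ (e · χ)) * (γ (χ ⁻¹) * (γ ((R · χ) ⁻¹) * γ ((a · c ⁻¹ · χ) ⁻¹))))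

    aR⁻¹≋R : ∀ R → R · R ≋ a → a · R ⁻¹ ≋ R
    aR⁻¹≋R R RR≋a = Ĝ.trans {a · R ⁻¹} {R · R · R ⁻¹} {R}
      (λ x → *-congʳ (sym (RR≋a x))) (GS.solve (R ∷ []) ((x₀ ⊙ x₀) ⊙ x₀ ⁻) x₀)

    root≢ε : ¬ (a ≋ ε) → ∀ R → R · R ≋ a → ¬ (R ≋ ε)
    root≢ε a≢ε R RR≋a R≋ε = a≢ε (Ĝ.trans {a} {R · R} {ε} (λ x → sym (RR≋a x))
      (λ x → trans (*-cong (R≋ε x) (R≋ε x)) (Ĝ.identityˡ ε x)))

    module _ (c d e : Character) (a≢ε : ¬ (a ≋ ε)) (c≢ε : ¬ (c ≋ ε)) (cc≢a : ¬ (c · c ≋ a)) (de≢a : ¬ (d · e · a ⁻¹ ≋ ε)) where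

      -- The four parameters multiply to c/(χR), which is ε for χ = c/R; hence `barnes-reflected`.
      -- Its degenerate cases are excluded: χ = ε together with this would force c = R and so c² =
      -- a, while a/R = R is non-trivial since a is.
      dixon-term : ∀ χ R → R · R ≋ a →
        Q * (⟦ R ⟧ -1F * γ (χ ⁻¹ · R ⁻¹) * barnes-sum a c (χ ⁻¹ · a ⁻¹) (R ⁻¹)) ≈
        N * (⟦ c ⟧ -1F * (γ R * γ (c · R ⁻¹)) * (⟦ χ ⟧ -1F * (γ (R · c ⁻¹ · χ) * (γ (χ ⁻¹) * (γ ((R · χ) ⁻¹) * γ ((a · c ⁻¹ · χ) ⁻¹))))))
      dixon-term χ R RR≋a = begin
        Q * (⟦ R ⟧ -1F * γ (χ ⁻¹ · R ⁻¹) * barnes-sum a c (χ ⁻¹ · a ⁻¹) (R ⁻¹))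
          ≈⟨ CS.solve 3 (λ q m b → q ⊕ (m ⊕ b) ⊜ m ⊕ (q ⊕ b)) ≈-refl _ _ _ ⟩
        ⟦ R ⟧ -1F * γ (χ ⁻¹ · R ⁻¹) * (Q * barnes-sum a c (χ ⁻¹ · a ⁻¹) (R ⁻¹))
          ≈⟨ *-congˡ (barnes-reflected a c (χ ⁻¹ · a ⁻¹) (R ⁻¹) degenerate) ⟩
        ⟦ R ⟧ -1F * γ (χ ⁻¹ · R ⁻¹) * (N * (⟦ P ⟧ -1F * γ (P ⁻¹)) * (γ (a · (χ ⁻¹ · a ⁻¹)) * γ (R ⁻¹ · c) * (γ (a · R ⁻¹) * γ (χ ⁻¹ · a ⁻¹ · c))))
          ≈⟨ CS.solve 9 (λ r x n p y u v w z → (r ⊕ x) ⊕ ((n ⊕ (p ⊕ y)) ⊕ ((u ⊕ v) ⊕ (w ⊕ z))) ⊜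
                                               n ⊕ ((r ⊕ p) ⊕ ((w ⊕ v) ⊕ (y ⊕ (u ⊕ (x ⊕ z)))))) ≈-refl _ _ _ _ _ _ _ _ _ ⟩
        N * (⟦ R · P ⟧ -1F * (γ (a · R ⁻¹) * γ (R ⁻¹ · c) * (γ (P ⁻¹) * (γ (a · (χ ⁻¹ · a ⁻¹)) * (γ (χ ⁻¹ · R ⁻¹) * γ (χ ⁻¹ · a ⁻¹ · c))))))
          ≈⟨ *-congˡ (*-cong sign (*-cong
               (*-cong (γ-cong {a · R ⁻¹} {R} (aR⁻¹≋R R RR≋a)) (γ-solve (R ∷ c ∷ []) (x₀ ⁻ ⊙ x₁) (x₁ ⊙ x₀ ⁻)))
               (*-cong (γ-solve (S ∷ c ∷ χ ∷ R ∷ []) ((((x₀ ⊙ x₀) ⊙ (x₂ ⁻ ⊙ (x₀ ⊙ x₀) ⁻)) ⊙ (x₃ ⁻ ⊙ x₁)) ⁻) ((x₃ ⊙ x₁ ⁻) ⊙ x₂))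
                 (*-cong (γ-solve (S ∷ χ ∷ []) ((x₀ ⊙ x₀) ⊙ (x₁ ⁻ ⊙ (x₀ ⊙ x₀) ⁻)) (x₁ ⁻))
                   (*-cong (γ-solve (R ∷ χ ∷ []) (x₁ ⁻ ⊙ x₀ ⁻) ((x₀ ⊙ x₁) ⁻))
                           (γ-solve (S ∷ c ∷ χ ∷ []) ((x₂ ⁻ ⊙ (x₀ ⊙ x₀) ⁻) ⊙ x₁) ((((x₀ ⊙ x₀) ⊙ x₁ ⁻) ⊙ x₂) ⁻))))))) ⟩
        N * (⟦ c ⟧ -1F * ⟦ χ ⟧ -1F * (γ R * γ (c · R ⁻¹) * (γ (R · c ⁻¹ · χ) * (γ (χ ⁻¹) * (γ ((R · χ) ⁻¹) * γ ((a · c ⁻¹ · χ) ⁻¹))))))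
          ≈⟨ *-congˡ (interchange _ _ _ _) ⟩
        N * (⟦ c ⟧ -1F * (γ R * γ (c · R ⁻¹)) * (⟦ χ ⟧ -1F * (γ (R · c ⁻¹ · χ) * (γ (χ ⁻¹) * (γ ((R · χ) ⁻¹) * γ ((a · c ⁻¹ · χ) ⁻¹)))))) ∎
        where
        P : Character
        P = a · (χ ⁻¹ · a ⁻¹) · (R ⁻¹ · c)
        sign : ⟦ R · P ⟧ -1F ≈ ⟦ c ⟧ -1F * ⟦ χ ⟧ -1F
        sign = trans (GS.solve (S ∷ c ∷ χ ∷ R ∷ []) (x₃ ⊙ (((x₀ ⊙ x₀) ⊙ (x₂ ⁻ ⊙ (x₀ ⊙ x₀) ⁻)) ⊙ (x₃ ⁻ ⊙ x₁))) (x₁ ⊙ x₂ ⁻) -1F)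
                     (*-congˡ (χ⁻¹[-1] χ))
        degenerate : P ≋ ε → ¬ (a · (χ ⁻¹ · a ⁻¹) ≋ ε) × ¬ (a · R ⁻¹ ≋ ε)
        degenerate P≋ε = (λ AC≋ε → cc≢a (Ĝ.trans {c · c} {R · R} {a} (λ x → *-cong (c≋R AC≋ε x) (c≋R AC≋ε x)) RR≋a))
                       , (λ AD≋ε → root≢ε a≢ε R RR≋a (Ĝ.trans {R} {a · R ⁻¹} {ε} (Ĝ.sym {a · R ⁻¹} {R} (aR⁻¹≋R R RR≋a)) AD≋ε))
          where
          c≋R : a · (χ ⁻¹ · a ⁻¹) ≋ ε → c ≋ R
          c≋R AC≋ε = Ĝ.trans {c} {P · (a · (χ ⁻¹ · a ⁻¹)) ⁻¹ · R} {R}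
            (GS.solve (S ∷ c ∷ χ ∷ R ∷ []) x₁ (((((x₀ ⊙ x₀) ⊙ (x₂ ⁻ ⊙ (x₀ ⊙ x₀) ⁻)) ⊙ (x₃ ⁻ ⊙ x₁)) ⊙ ((x₀ ⊙ x₀) ⊙ (x₂ ⁻ ⊙ (x₀ ⊙ x₀) ⁻)) ⁻) ⊙ x₃))
            (Ĝ.trans {P · (a · (χ ⁻¹ · a ⁻¹)) ⁻¹ · R} {ε · ε ⁻¹ · R} {R}
              (λ x → *-congʳ (*-cong (P≋ε x) (AC≋ε (x F.⁻¹)))) (GS.solve (R ∷ []) ((GS.ι ⊙ GS.ι ⁻) ⊙ x₀) x₀))

      -- Barnes' lemma trades the pairs of d and e for a pair of the inverse of χ. Dixon's theorem
      -- is then applied with a and c as its first two parameters, so that its condition concerns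
      -- ac/a = c and holds for every χ.
      whipple : Q * Σ̂ (λ ψ → ⟦ ψ ⟧ -1F * (pair d ψ * pair e ψ * (pair a ψ * pair c ψ))) ≈
        γ (d · e · a ⁻¹) * (⟦ c ⟧ -1F * γ c) * Σ√ S λ R → γ R * γ (c · R ⁻¹) * balanced-sum c d e R
      whipple = cancelˡ N≉0 (begin
        N * (Q * Σ̂ (λ ψ → ⟦ ψ ⟧ -1F * (pair d ψ * pair e ψ * (pair a ψ * pair c ψ))))
          ≈⟨ CS.solve 3 (λ n q s → n ⊕ (q ⊕ s) ⊜ q ⊕ (n ⊕ s)) ≈-refl _ _ _ ⟩
        Q * (N * Σ̂ (λ ψ → ⟦ ψ ⟧ -1F * (pair d ψ * pair e ψ * (pair a ψ * pair c ψ))))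
          ≈⟨ *-congˡ (lower d e (λ ψ → pair a ψ * pair c ψ) de≢a) ⟩
        Q * (γ (d · e · a ⁻¹) * Σ̂ λ χ → γ (d · χ) * γ (e · χ) * Σ̂ λ ψ → ⟦ ψ ⟧ -1F * (pair (χ ⁻¹) ψ * (pair a ψ * pair c ψ)))
          ≈⟨ trans (CS.solve 3 (λ q g s → q ⊕ (g ⊕ s) ⊜ g ⊕ (q ⊕ s)) ≈-refl _ _ _) (*-congˡ (*-Σ̂ _ _)) ⟩
        γ (d · e · a ⁻¹) * Σ̂ (λ χ → Q * (γ (d · χ) * γ (e · χ) * Σ̂ λ ψ → ⟦ ψ ⟧ -1F * (pair (χ ⁻¹) ψ * (pair a ψ * pair c ψ))))
          ≈⟨ *-congˡ (Σ̂-cong row) ⟩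
        γ (d · e · a ⁻¹) * Σ̂ (λ χ → N * (γ c * Σ√ S λ R → ⟦ c ⟧ -1F * (γ R * γ (c · R ⁻¹)) * term R χ))
          ≈⟨ *-congˡ (trans (sym (*-Σ̂ _ _)) (*-congˡ (trans (sym (*-Σ̂ _ _)) (*-congˡ (trans (Σ̂-Σ√ _)
               (Σ√-cong λ R _ → trans (sym (*-Σ̂ _ _)) (*-assoc _ _ _))))))) ⟩
        γ (d · e · a ⁻¹) * (N * (γ c * Σ√ S λ R → ⟦ c ⟧ -1F * (γ R * γ (c · R ⁻¹) * balanced-sum c d e R)))
          ≈⟨ *-congˡ (*-congˡ (*-congˡ (*-Σ√ _ _))) ⟨
        γ (d · e · a ⁻¹) * (N * (γ c * (⟦ c ⟧ -1F * Σ√ S λ R → γ R * γ (c · R ⁻¹) * balanced-sum c d e R)))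
          ≈⟨ CS.solve 5 (λ g n c m s → g ⊕ (n ⊕ (c ⊕ (m ⊕ s))) ⊜ n ⊕ ((g ⊕ (m ⊕ c)) ⊕ s)) ≈-refl _ _ _ _ _ ⟩
        N * (γ (d · e · a ⁻¹) * (⟦ c ⟧ -1F * γ c) * Σ√ S λ R → γ R * γ (c · R ⁻¹) * balanced-sum c d e R) ∎)
        where
        term : Character → Character → ℂ
        term R χ = ⟦ χ ⟧ -1F * (γ (R · c ⁻¹ · χ) * (γ (d · χ) * γ (e · χ)) * (γ (χ ⁻¹) * (γ ((R · χ) ⁻¹) * γ ((a · c ⁻¹ · χ) ⁻¹))))
        aca⁻¹≋c : a · c · a ⁻¹ ≋ c
        aca⁻¹≋c = GS.solve (S ∷ c ∷ []) (((x₀ ⊙ x₀) ⊙ x₁) ⊙ (x₀ ⊙ x₀) ⁻) x₁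
        row : ∀ χ → Q * (γ (d · χ) * γ (e · χ) * Σ̂ λ ψ → ⟦ ψ ⟧ -1F * (pair (χ ⁻¹) ψ * (pair a ψ * pair c ψ))) ≈
              N * (γ c * Σ√ S λ R → ⟦ c ⟧ -1F * (γ R * γ (c · R ⁻¹)) * term R χ)
        row χ = begin
          Q * (γ (d · χ) * γ (e · χ) * Σ̂ λ ψ → ⟦ ψ ⟧ -1F * (pair (χ ⁻¹) ψ * (pair a ψ * pair c ψ)))
            ≈⟨ *-congˡ (*-congˡ (trans (Σ̂-cong λ ψ → *-congˡ (*-comm _ _))
                 (dixon a c (χ ⁻¹) λ p → c≢ε (Ĝ.trans {c} {a · c · a ⁻¹} {ε} (Ĝ.sym {a · c · a ⁻¹} {c} aca⁻¹≋c) p)))) ⟩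
          Q * (γ (d · χ) * γ (e · χ) * (γ (a · c · a ⁻¹) * Σ√ S λ R → ⟦ R ⟧ -1F * γ (χ ⁻¹ · R ⁻¹) * barnes-sum a c (χ ⁻¹ · a ⁻¹) (R ⁻¹)))
            ≈⟨ CS.solve 4 (λ q g c s → q ⊕ (g ⊕ (c ⊕ s)) ⊜ (c ⊕ g) ⊕ (q ⊕ s)) ≈-refl _ _ _ _ ⟩
          γ (a · c · a ⁻¹) * (γ (d · χ) * γ (e · χ)) * (Q * Σ√ S λ R → ⟦ R ⟧ -1F * γ (χ ⁻¹ · R ⁻¹) * barnes-sum a c (χ ⁻¹ · a ⁻¹) (R ⁻¹))
            ≈⟨ *-cong (*-congʳ (γ-cong {a · c · a ⁻¹} {c} aca⁻¹≋c)) (trans (*-Σ√ _ _) (trans (Σ√-cong (dixon-term χ)) (sym (*-Σ√ _ _)))) ⟩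
          γ c * (γ (d · χ) * γ (e · χ)) * (N * Σ√ S λ R → ⟦ c ⟧ -1F * (γ R * γ (c · R ⁻¹)) *
            (⟦ χ ⟧ -1F * (γ (R · c ⁻¹ · χ) * (γ (χ ⁻¹) * (γ ((R · χ) ⁻¹) * γ ((a · c ⁻¹ · χ) ⁻¹))))))
            ≈⟨ CS.solve 4 (λ c g n s → (c ⊕ g) ⊕ (n ⊕ s) ⊜ n ⊕ (c ⊕ (g ⊕ s))) ≈-refl _ _ _ _ ⟩
          N * (γ c * (γ (d · χ) * γ (e · χ) * Σ√ S λ R → ⟦ c ⟧ -1F * (γ R * γ (c · R ⁻¹)) *
            (⟦ χ ⟧ -1F * (γ (R · c ⁻¹ · χ) * (γ (χ ⁻¹) * (γ ((R · χ) ⁻¹) * γ ((a · c ⁻¹ · χ) ⁻¹)))))))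
            ≈⟨ *-congˡ (*-congˡ (trans (*-Σ√ _ _) (Σ√-cong λ R _ →
                 CS.solve 5 (λ g u m p w → g ⊕ (u ⊕ (m ⊕ (p ⊕ w))) ⊜ u ⊕ (m ⊕ ((p ⊕ g) ⊕ w))) ≈-refl _ _ _ _ _))) ⟩
          N * (γ c * Σ√ S λ R → ⟦ c ⟧ -1F * (γ R * γ (c · R ⁻¹)) * term R χ) ∎

  -- Hypergeometric terms

  ratio : Character → Character → ℂ
  ratio A χ = γ (A · χ) * γ⁻¹ A

  term : Character → Character → Character → ℂ
  term χ A B = γ (A · χ) * γ⁻¹ A * (γ ((B · χ) ⁻¹) * γ⁻¹ (B ⁻¹))

  factor≈term : ∀ χ A B → factor χ A B ≈ term χ A B
  factor≈term χ A B = *-cong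
    (trans (/g-def _ A) (*-congʳ (sym (γ≈g (A · χ)))))
    (trans (/g-def _ (B ⁻¹)) (*-congʳ (sym (γ≈g ((B · χ) ⁻¹)))))

  term-cong : ∀ {χ ψ A A′ B B′} → χ ≋ ψ → A ≋ A′ → B ≋ B′ → term χ A B ≈ term ψ A′ B′
  term-cong {χ} {ψ} {A} {A′} {B} {B′} p r s = *-cong
    (*-cong (γ-cong {A · χ} {A′ · ψ} λ x → *-cong (r x) (p x)) (γ⁻¹-cong {A} {A′} r))
    (*-cong (γ-cong {(B · χ) ⁻¹} {(B′ · ψ) ⁻¹} λ x → *-cong (s (x F.⁻¹)) (p (x F.⁻¹))) (γ⁻¹-cong {B ⁻¹} {B′ ⁻¹} λ x → s (x F.⁻¹)))

  Q≉0 : ¬ (Q ≈ 0#)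
  Q≉0 = unit⇒≉0 1≉0 (trans (*-congʳ (Σ-def _)) (proj₂ #F-invertible))

  γ-*-γ⁻¹-cancel : ∀ χ z → γ χ * (γ⁻¹ χ * z) ≈ z
  γ-*-γ⁻¹-cancel χ z = trans (sym (*-assoc _ _ _)) (trans (*-congʳ (γ-inverse χ)) (*-identityˡ z))

  γ⁻¹-ε : γ⁻¹ ε ≈ - 1#
  γ⁻¹-ε = cancelˡ (γ≉0 ε) (trans (γ-inverse ε) (sym (begin
    γ ε * - 1#        ≈⟨ *-congʳ γ-ε ⟩
    - 1# * - 1#       ≈⟨ RP.-‿distribˡ-* 1# (- 1#) ⟨
    - (1# * - 1#)     ≈⟨ -‿cong (*-identityˡ _) ⟩
    - - 1#            ≈⟨ RP.-‿involutive 1# ⟩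
    1#                ∎)))

  Q*γ⁻¹ : ∀ χ → ¬ (χ ≋ ε) → Q * γ⁻¹ χ ≈ ⟦ χ ⟧ -1F * γ (χ ⁻¹)
  Q*γ⁻¹ χ χ≢ε = begin
    Q * γ⁻¹ χ                                          ≈⟨ trans (*-congʳ (χ[-1]²≈1 χ)) (*-identityˡ _) ⟨
    ⟦ χ ⟧ -1F * ⟦ χ ⟧ -1F * (Q * γ⁻¹ χ)                ≈⟨ CS.solve 3 (λ m q i → (m ⊕ m) ⊕ (q ⊕ i) ⊜ m ⊕ ((m ⊕ q) ⊕ i)) ≈-refl _ _ _ ⟩
    ⟦ χ ⟧ -1F * (⟦ χ ⟧ -1F * Q * γ⁻¹ χ)                ≈⟨ *-congˡ (*-congʳ (γ-reflection χ χ≢ε)) ⟨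
    ⟦ χ ⟧ -1F * (γ χ * γ (χ ⁻¹) * γ⁻¹ χ)
      ≈⟨ *-congˡ (trans (CS.solve 3 (λ g h i → (g ⊕ h) ⊕ i ⊜ g ⊕ (i ⊕ h)) ≈-refl _ _ _) (γ-*-γ⁻¹-cancel χ _)) ⟩
    ⟦ χ ⟧ -1F * γ (χ ⁻¹)                               ∎

  -- Counting square roots of characters, and duplication of hypergeometric terms

  module Transformations (φ : Character) (φφ≋ε : φ · φ ≋ ε) (φ≢ε : ¬ (φ ≋ ε)) where

    open Quadratic φ φφ≋ε φ≢ε
    open WithQuadratic φ φφ≋ε φ≢ε
    open KummerSums φ φφ≋ε φ≢ε

    -- A character ψ has 1 + ψ(-1) square roots in the character group.
    Σ̂-square : ∀ {f} → Congruent^ f → Σ̂ (λ χ → f (χ · χ)) ≈ Σ̂ f + Σ̂ λ ψ → ⟦ ψ ⟧ -1F * f ψ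
    Σ̂-square {f} f-cong = cancelˡ N≉0 (begin
      N * Σ̂ (λ χ → f (χ · χ))
        -- The condition ψ = χ² is detected by the complete sum over t of (χ²/ψ)(t), which is N or
        -- 0. Summing over χ first leaves t² = 1, hence the two contributions 1 and ψ(-1).
        ≈⟨ trans (*-Σ̂ _ _) (Σ̂-cong λ χ → sym (expand χ)) ⟩
      Σ̂ (λ χ → Σ̂ λ ψ → f ψ * Σ ⟦ χ · χ · ψ ⁻¹ ⟧)
        ≈⟨ trans (Σ̂-comm _) (Σ̂-cong λ ψ → trans (sym (*-Σ̂ _ _)) (*-congˡ (count ψ))) ⟩
      Σ̂ (λ ψ → f ψ * (N * (1# + ⟦ ψ ⟧ -1F)))
        ≈⟨ trans (Σ̂-cong λ ψ → CS.solve 3 (λ f n s → f ⊕ (n ⊕ s) ⊜ n ⊕ (s ⊕ f)) ≈-refl _ _ _) (sym (*-Σ̂ _ _)) ⟩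
      N * Σ̂ (λ ψ → (1# + ⟦ ψ ⟧ -1F) * f ψ)
        ≈⟨ *-congˡ (trans (Σ̂-cong λ ψ → trans (distribʳ _ _ _) (+-congʳ (*-identityˡ _))) (Σ̂-distrib-+ _ _)) ⟩
      N * (Σ̂ f + Σ̂ (λ ψ → ⟦ ψ ⟧ -1F * f ψ)) ∎)
      where
      expand : ∀ χ → Σ̂ (λ ψ → f ψ * Σ ⟦ χ · χ · ψ ⁻¹ ⟧) ≈ N * f (χ · χ)
      expand χ = trans (Σ̂-single (χ · χ)
        (λ ψ ω p → *-cong (f-cong ψ ω p) (Σ-cong λ x → *-congˡ (p (x F.⁻¹))))
        (λ ψ ψ≢χχ → trans (*-congˡ (Σ-χ≈0 (χ · χ · ψ ⁻¹) λ p → ψ≢χχ (Ĝ.trans {ψ} {(χ · χ · ψ ⁻¹) ⁻¹ · (χ · χ)} {χ · χ}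
          (GS.solve (χ ∷ ψ ∷ []) x₁ (((x₀ ⊙ x₀) ⊙ x₁ ⁻) ⁻ ⊙ (x₀ ⊙ x₀)))
          (Ĝ.trans {(χ · χ · ψ ⁻¹) ⁻¹ · (χ · χ)} {ε ⁻¹ · (χ · χ)} {χ · χ} (λ x → *-congʳ (p (x F.⁻¹)))
            (GS.solve (χ ∷ []) (GS.ι ⁻ ⊙ (x₀ ⊙ x₀)) (x₀ ⊙ x₀)))))) (zeroʳ _)))
        (trans (*-comm _ _) (*-congʳ (trans (Σ-cong (GS.solve (χ ∷ []) ((x₀ ⊙ x₀) ⊙ (x₀ ⊙ x₀) ⁻) GS.ι)) Σ-ε)))
      count : ∀ ψ → Σ̂ (λ χ → Σ ⟦ χ · χ · ψ ⁻¹ ⟧) ≈ N * (1# + ⟦ ψ ⟧ -1F)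
      count ψ = begin
        Σ̂ (λ χ → Σ ⟦ χ · χ · ψ ⁻¹ ⟧)
          ≈⟨ trans (Σ̂Σ-comm _) (Σ-cong λ t → trans (sym (Σ̂-* _ _)) (*-congʳ (trans (Σ̂-cong λ χ → sym (Character.*-homo χ t t)) (column _)))) ⟩
        Σ (λ t → N * δ (t F.* t) F.1# * ⟦ ψ ⁻¹ ⟧ t)
          ≈⟨ trans (Σ-cong λ t → trans (*-assoc _ _ _) (*-congˡ (trans (*-congʳ (δ-square F.1# 1≉-1 (F.*-identityˡ _) t)) (distribʳ _ _ _)))) (sym (*-Σ _ _)) ⟩
        N * Σ (λ t → δ t F.1# * ⟦ ψ ⁻¹ ⟧ t + δ t -1F * ⟦ ψ ⁻¹ ⟧ t)
          ≈⟨ *-congˡ (trans (Σ-distrib-+ _ _) (+-cong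
               (trans (Σ-δ F.1# (Character.cong (ψ ⁻¹))) (Character.1-homo (ψ ⁻¹)))
               (trans (Σ-δ -1F (Character.cong (ψ ⁻¹))) (χ⁻¹[-1] ψ)))) ⟩
        N * (1# + ⟦ ψ ⟧ -1F) ∎

    -- Divide `duplication` at Aχ by `duplication` at A; g(φ) and A(4) cancel, and only χ(4) is
    -- left.
    ratio-duplication : ∀ A χ → ⟦ χ ⟧ 4F * (ratio A χ * ratio (φ · A) χ) ≈ ratio (A · A) (χ · χ)
    ratio-duplication A χ = cancelˡ (γ≉0 φ) (cancelˡ (γ≉0 (A · A)) (begin
      γ (A · A) * (γ φ * (⟦ χ ⟧ 4F * (ratio A χ * ratio (φ · A) χ)))
        ≈⟨ CS.solve 4 (λ b p c r → b ⊕ (p ⊕ (c ⊕ r)) ⊜ (p ⊕ b) ⊕ (c ⊕ r)) ≈-refl _ _ _ _ ⟩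
      γ φ * γ (A · A) * (⟦ χ ⟧ 4F * (ratio A χ * ratio (φ · A) χ))
        ≈⟨ *-congʳ (duplication A) ⟨
      ⟦ A ⟧ 4F * (γ A * γ (φ · A)) * (⟦ χ ⟧ 4F * (γ (A · χ) * γ⁻¹ A * (γ (φ · A · χ) * γ⁻¹ (φ · A))))
        ≈⟨ CS.solve 8 (λ a g h c u i v j → (a ⊕ (g ⊕ h)) ⊕ (c ⊕ ((u ⊕ i) ⊕ (v ⊕ j))) ⊜
                                           g ⊕ (i ⊕ (h ⊕ (j ⊕ ((a ⊕ c) ⊕ (u ⊕ v)))))) ≈-refl _ _ _ _ _ _ _ _ ⟩
      γ A * (γ⁻¹ A * (γ (φ · A) * (γ⁻¹ (φ · A) * (⟦ A · χ ⟧ 4F * (γ (A · χ) * γ (φ · A · χ))))))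
        ≈⟨ trans (γ-*-γ⁻¹-cancel A _) (γ-*-γ⁻¹-cancel (φ · A) _) ⟩
      ⟦ A · χ ⟧ 4F * (γ (A · χ) * γ (φ · A · χ))
        ≈⟨ *-congˡ (*-congˡ (γ-solve (φ ∷ A ∷ χ ∷ []) ((x₀ ⊙ x₁) ⊙ x₂) (x₀ ⊙ (x₁ ⊙ x₂)))) ⟩
      ⟦ A · χ ⟧ 4F * (γ (A · χ) * γ (φ · (A · χ)))
        ≈⟨ duplication (A · χ) ⟩
      γ φ * γ (A · χ · (A · χ))
        ≈⟨ *-congˡ (γ-solve (A ∷ χ ∷ []) ((x₀ ⊙ x₁) ⊙ (x₀ ⊙ x₁)) ((x₀ ⊙ x₀) ⊙ (x₁ ⊙ x₁))) ⟩
      γ φ * γ (A · A · (χ · χ))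
        ≈⟨ *-congˡ (γ-*-γ⁻¹-cancel (A · A) _) ⟨
      γ φ * (γ (A · A) * (γ⁻¹ (A · A) * γ (A · A · (χ · χ))))
        ≈⟨ CS.solve 4 (λ p b i u → p ⊕ (b ⊕ (i ⊕ u)) ⊜ b ⊕ (p ⊕ (u ⊕ i))) ≈-refl _ _ _ _ ⟩
      γ (A · A) * (γ φ * ratio (A · A) (χ · χ)) ∎))

    φ⁻¹≋φ : φ ⁻¹ ≋ φ
    φ⁻¹≋φ = Ĝ.trans {φ ⁻¹} {φ ⁻¹ · (φ · φ)} {φ} (Ĝ.sym {φ ⁻¹ · (φ · φ)} {φ ⁻¹} (drop-φφ (φ ⁻¹)))
      (GS.solve (φ ∷ []) (x₀ ⁻ ⊙ (x₀ ⊙ x₀)) x₀)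

    -- The constant χ(4) from the upper parameters meets the inverse one from the lower parameters,
    -- so the argument of the series does not change.
    term-duplication : ∀ χ A B → term χ A B * term χ (φ · A) (φ · B) ≈ term (χ · χ) (A · A) (B · B)
    term-duplication χ A B = begin
      term χ A B * term χ (φ · A) (φ · B)
        ≈⟨ *-cong (*-congˡ (*-congʳ (γ-solve (B ∷ χ ∷ []) ((x₀ ⊙ x₁) ⁻) (x₀ ⁻ ⊙ x₁ ⁻))))
             (*-congˡ (*-cong (γ-cong {(φ · B · χ) ⁻¹} {φ · B ⁻¹ · χ ⁻¹} λ x → *-congʳ (*-congʳ (φ⁻¹≋φ x)))
                              (γ⁻¹-cong {(φ · B) ⁻¹} {φ · B ⁻¹} λ x → *-congʳ (φ⁻¹≋φ x)))) ⟩
      ratio A χ * ratio (B ⁻¹) (χ ⁻¹) * (ratio (φ · A) χ * ratio (φ · B ⁻¹) (χ ⁻¹))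
        ≈⟨ trans (interchange _ _ _ _) (trans (sym (*-identityˡ _)) (*-congʳ (sym (χ-inverse χ 4≉0)))) ⟩
      ⟦ χ ⟧ 4F * ⟦ χ ⁻¹ ⟧ 4F * (ratio A χ * ratio (φ · A) χ * (ratio (B ⁻¹) (χ ⁻¹) * ratio (φ · B ⁻¹) (χ ⁻¹)))
        ≈⟨ trans (interchange _ _ _ _) (*-cong (ratio-duplication A χ) (ratio-duplication (B ⁻¹) (χ ⁻¹))) ⟩
      ratio (A · A) (χ · χ) * ratio (B ⁻¹ · B ⁻¹) (χ ⁻¹ · χ ⁻¹)
        ≈⟨ *-congˡ (*-cong (γ-solve (B ∷ χ ∷ []) ((x₀ ⁻ ⊙ x₀ ⁻) ⊙ (x₁ ⁻ ⊙ x₁ ⁻)) (((x₀ ⊙ x₀) ⊙ (x₁ ⊙ x₁)) ⁻))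
                           (γ⁻¹-solve (B ∷ []) (x₀ ⁻ ⊙ x₀ ⁻) ((x₀ ⊙ x₀) ⁻))) ⟩
      term (χ · χ) (A · A) (B · B) ∎

  instance
    q∸1≢0 : ℕ.NonZero (q ℕ.∸ 1)
    q∸1≢0 = q∸1-nonZero 𝔽

  -1/[q-1] : ℂ
  -1/[q-1] = Complex.fromℚ ((ℤ.- ℤ.1ℤ) ℚ./ (q ℕ.∸ 1))

  -1/[q-1]*N : -1/[q-1] * N ≈ - 1#
  -1/[q-1]*N = trans (*-congˡ Σ̂-1) (-1/n*n⊗1≈-1 (q ℕ.∸ 1))

  -1*-1≈1 : - 1# * - 1# ≈ 1#
  -1*-1≈1 = trans (sym (RP.-‿distribˡ-* 1# (- 1#))) (trans (-‿cong (*-identityˡ _)) (RP.-‿involutive 1#))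

  -- Counterpart of `₃F₂` at 1 in terms of `γ`; of the sign χ(-1)³ one factor survives.
  hyper₃ : (A₁ A₂ A₃ B₂ B₃ : Character) → ℂ
  hyper₃ A₁ A₂ A₃ B₂ B₃ = -1/[q-1] * Σ̂ λ χ → ⟦ χ ⟧ -1F * (term χ A₁ ε * (term χ A₂ B₂ * term χ A₃ B₃))

  -- Gauss's, Kummer's and Whipple's theorems, normalised

  module Summations (φ : Character) (φφ≋ε : φ · φ ≋ ε) (φ≢ε : ¬ (φ ≋ ε)) (S : Character) where

    open KummerSums φ φφ≋ε φ≢ε
    open WellPoised φ φφ≋ε φ≢ε S

    κ : Character → ℂ
    κ x = γ⁻¹ x * γ⁻¹ (x · a ⁻¹)

    term-pair : ∀ ψ x y → y ≋ a · x ⁻¹ → term ψ x y ≈ pair x ψ * κ x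
    term-pair ψ x y y≋a/x = trans (interchange _ _ _ _) (*-cong
      (*-congˡ (trans (γ-cong {(y · ψ) ⁻¹} {(a · x ⁻¹ · ψ) ⁻¹} λ u → *-congʳ (y≋a/x (u F.⁻¹)))
        (γ-solve (S ∷ x ∷ ψ ∷ []) ((((x₀ ⊙ x₀) ⊙ x₁ ⁻) ⊙ x₂) ⁻) ((x₁ ⊙ (x₀ ⊙ x₀) ⁻) ⊙ x₂ ⁻))))
      (*-congˡ (trans (γ⁻¹-cong {y ⁻¹} {(a · x ⁻¹) ⁻¹} λ u → y≋a/x (u F.⁻¹))
        (γ⁻¹-solve (S ∷ x ∷ []) (((x₀ ⊙ x₀) ⊙ x₁ ⁻) ⁻) (x₁ ⊙ (x₀ ⊙ x₀) ⁻)))))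

    κa : κ a ≈ γ⁻¹ a * - 1#
    κa = *-congˡ (trans (γ⁻¹-solve (S ∷ []) ((x₀ ⊙ x₀) ⊙ (x₀ ⊙ x₀) ⁻) GS.ι) γ⁻¹-ε)

    Q*γ⁻¹a : ¬ (a ≋ ε) → Q * γ⁻¹ a ≈ γ (a ⁻¹)
    Q*γ⁻¹a a≢ε = trans (Q*γ⁻¹ a a≢ε) (trans (*-congʳ (χ[-1]²≈1 S)) (*-identityˡ _))

    -- The pair of a contributes a/(aη), so the third Barnes parameter is ε and the fourth is b/a.
    -- All four multiply to b², the character required to be non-trivial.
    gauss-theorem : ∀ b → ¬ (b · b ≋ ε) → Σ̂ (λ η → pair a η * pair b η) * (κ a * κ b) ≈
      N * - 1# * (γ b * γ (a ⁻¹ · (b · b)) * γ⁻¹ (a ⁻¹ · b) * γ⁻¹ (b · b))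
    gauss-theorem b bb≢ε = cancelˡ (γ≉0 (b · b)) (begin
      γ (b · b) * (Σ̂ (λ η → pair a η * pair b η) * (κ a * κ b))
        ≈⟨ trans (sym (*-assoc _ _ _)) (*-congʳ (*-cong (γ-cong {b · b} {P} bb≋P) (Σ̂-cong λ η → interchange _ _ _ _))) ⟩
      γ P * barnes-sum a b (a · a ⁻¹) (b · a ⁻¹) * (κ a * κ b)
        ≈⟨ *-cong (barnes a b (a · a ⁻¹) (b · a ⁻¹) (λ P≋ε → bb≢ε (Ĝ.trans {b · b} {P} {ε} bb≋P P≋ε))) (*-congʳ κa) ⟩
      N * (γ (a · (a · a ⁻¹)) * γ (b · a ⁻¹ · b) * (γ (a · (b · a ⁻¹)) * γ (a · a ⁻¹ · b))) * (γ⁻¹ a * - 1# * (γ⁻¹ b * γ⁻¹ (b · a ⁻¹)))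
        ≈⟨ *-cong (*-congˡ (*-cong
             (*-cong (γ-solve (S ∷ []) ((x₀ ⊙ x₀) ⊙ ((x₀ ⊙ x₀) ⊙ (x₀ ⊙ x₀) ⁻)) (x₀ ⊙ x₀))
                     (γ-solve (S ∷ b ∷ []) ((x₁ ⊙ (x₀ ⊙ x₀) ⁻) ⊙ x₁) ((x₀ ⊙ x₀) ⁻ ⊙ (x₁ ⊙ x₁))))
             (*-cong (γ-solve (S ∷ b ∷ []) ((x₀ ⊙ x₀) ⊙ (x₁ ⊙ (x₀ ⊙ x₀) ⁻)) x₁)
                     (γ-solve (S ∷ b ∷ []) (((x₀ ⊙ x₀) ⊙ (x₀ ⊙ x₀) ⁻) ⊙ x₁) x₁))))
             (*-congˡ (*-congˡ (γ⁻¹-solve (S ∷ b ∷ []) (x₁ ⊙ (x₀ ⊙ x₀) ⁻) ((x₀ ⊙ x₀) ⁻ ⊙ x₁)))) ⟩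
      N * (γ a * γ (a ⁻¹ · (b · b)) * (γ b * γ b)) * (γ⁻¹ a * - 1# * (γ⁻¹ b * γ⁻¹ (a ⁻¹ · b)))
        ≈⟨ CS.solve 8 (λ n α β b i m j k → (n ⊕ ((α ⊕ β) ⊕ (b ⊕ b))) ⊕ ((i ⊕ m) ⊕ (j ⊕ k)) ⊜
                                           α ⊕ (i ⊕ (b ⊕ (j ⊕ ((n ⊕ m) ⊕ ((b ⊕ β) ⊕ k)))))) ≈-refl _ _ _ _ _ _ _ _ ⟩
      γ a * (γ⁻¹ a * (γ b * (γ⁻¹ b * (N * - 1# * (γ b * γ (a ⁻¹ · (b · b)) * γ⁻¹ (a ⁻¹ · b))))))
        ≈⟨ trans (γ-*-γ⁻¹-cancel a _) (γ-*-γ⁻¹-cancel b _) ⟩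
      N * - 1# * (γ b * γ (a ⁻¹ · (b · b)) * γ⁻¹ (a ⁻¹ · b))
        ≈⟨ γ-*-γ⁻¹-cancel (b · b) _ ⟨
      γ (b · b) * (γ⁻¹ (b · b) * (N * - 1# * (γ b * γ (a ⁻¹ · (b · b)) * γ⁻¹ (a ⁻¹ · b))))
        ≈⟨ *-congˡ (CS.solve 3 (λ i n x → i ⊕ (n ⊕ x) ⊜ n ⊕ (x ⊕ i)) ≈-refl _ _ _) ⟩
      γ (b · b) * (N * - 1# * (γ b * γ (a ⁻¹ · (b · b)) * γ⁻¹ (a ⁻¹ · b) * γ⁻¹ (b · b))) ∎)
      where
      P : Character
      P = a · (a · a ⁻¹) · (b · a ⁻¹ · b)
      bb≋P : b · b ≋ P
      bb≋P = GS.solve (S ∷ b ∷ []) (x₁ ⊙ x₁) (((x₀ ⊙ x₀) ⊙ ((x₀ ⊙ x₀) ⊙ (x₀ ⊙ x₀) ⁻)) ⊙ ((x₁ ⊙ (x₀ ⊙ x₀) ⁻) ⊙ x₁))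

    kummer-theorem : ∀ b → ¬ (a ≋ ε) → Σ̂ (λ η → ⟦ η ⟧ -1F * (pair a η * pair b η)) * (κ a * κ b) ≈
      N * - 1# * Σ√ S λ R → γ (a ⁻¹) * γ (R ⁻¹ · b) * γ⁻¹ (R ⁻¹) * γ⁻¹ (a ⁻¹ · b)
    kummer-theorem b a≢ε = begin
      Σ̂ (λ η → ⟦ η ⟧ -1F * (pair a η * pair b η)) * (κ a * κ b)
        ≈⟨ *-cong (kummer-pair a b) (*-congʳ κa) ⟩
      N * (γ (a · b · a ⁻¹) * Σ√ S λ R → ⟦ R ⟧ -1F * (γ (a · R ⁻¹) * γ (b · R ⁻¹))) * (γ⁻¹ a * - 1# * (γ⁻¹ b * γ⁻¹ (b · a ⁻¹)))
        ≈⟨ *-cong (*-congˡ (*-congʳ (γ-solve (S ∷ b ∷ []) (((x₀ ⊙ x₀) ⊙ x₁) ⊙ (x₀ ⊙ x₀) ⁻) x₁)))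
             (*-congˡ (*-congˡ (γ⁻¹-solve (S ∷ b ∷ []) (x₁ ⊙ (x₀ ⊙ x₀) ⁻) ((x₀ ⊙ x₀) ⁻ ⊙ x₁)))) ⟩
      N * (γ b * Σ√ S λ R → ⟦ R ⟧ -1F * (γ (a · R ⁻¹) * γ (b · R ⁻¹))) * (γ⁻¹ a * - 1# * (γ⁻¹ b * γ⁻¹ (a ⁻¹ · b)))
        ≈⟨ CS.solve 7 (λ n b s i m j k → (n ⊕ (b ⊕ s)) ⊕ ((i ⊕ m) ⊕ (j ⊕ k)) ⊜ b ⊕ (j ⊕ ((n ⊕ m) ⊕ ((i ⊕ k) ⊕ s)))) ≈-refl _ _ _ _ _ _ _ ⟩
      γ b * (γ⁻¹ b * (N * - 1# * (γ⁻¹ a * γ⁻¹ (a ⁻¹ · b) * Σ√ S λ R → ⟦ R ⟧ -1F * (γ (a · R ⁻¹) * γ (b · R ⁻¹)))))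
        ≈⟨ γ-*-γ⁻¹-cancel b _ ⟩
      N * - 1# * (γ⁻¹ a * γ⁻¹ (a ⁻¹ · b) * Σ√ S λ R → ⟦ R ⟧ -1F * (γ (a · R ⁻¹) * γ (b · R ⁻¹)))
        ≈⟨ *-congˡ (trans (*-Σ√ _ _) (Σ√-cong summand)) ⟩
      N * - 1# * Σ√ S (λ R → γ (a ⁻¹) * γ (R ⁻¹ · b) * γ⁻¹ (R ⁻¹) * γ⁻¹ (a ⁻¹ · b)) ∎
      where
      -- Reflect numerator and denominator: R(-1)g(R) is q over the Gauss sum of the inverse of R,
      -- and q/g(a) is the Gauss sum of the inverse of a, since a(-1) = S(-1)² = 1.
      flip-root : ∀ R → R · R ≋ a → ⟦ R ⟧ -1F * γ R * γ⁻¹ a ≈ γ (a ⁻¹) * γ⁻¹ (R ⁻¹)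
      flip-root R RR≋a = cancelˡ Q≉0 (begin
        Q * (⟦ R ⟧ -1F * γ R * γ⁻¹ a)        ≈⟨ CS.solve 3 (λ q r i → q ⊕ (r ⊕ i) ⊜ r ⊕ (q ⊕ i)) ≈-refl _ _ _ ⟩
        ⟦ R ⟧ -1F * γ R * (Q * γ⁻¹ a)        ≈⟨ *-cong (*-cong (sym (χ⁻¹[-1] R)) (γ-solve (R ∷ []) x₀ (x₀ ⁻ ⁻))) (Q*γ⁻¹a a≢ε) ⟩
        ⟦ R ⁻¹ ⟧ -1F * γ (R ⁻¹ ⁻¹) * γ (a ⁻¹) ≈⟨ *-congʳ (Q*γ⁻¹ (R ⁻¹) R⁻¹≢ε) ⟨
        Q * γ⁻¹ (R ⁻¹) * γ (a ⁻¹)            ≈⟨ trans (*-assoc _ _ _) (*-congˡ (*-comm _ _)) ⟩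
        Q * (γ (a ⁻¹) * γ⁻¹ (R ⁻¹))          ∎)
        where
        R⁻¹≢ε : ¬ (R ⁻¹ ≋ ε)
        R⁻¹≢ε p = root≢ε a≢ε R RR≋a (Ĝ.trans {R} {(R ⁻¹) ⁻¹} {ε} (GS.solve (R ∷ []) x₀ (x₀ ⁻ ⁻))
          (Ĝ.trans {(R ⁻¹) ⁻¹} {ε ⁻¹} {ε} (λ x → p (x F.⁻¹)) (GS.solve [] (GS.ι ⁻) GS.ι)))
      summand : ∀ R → R · R ≋ a → γ⁻¹ a * γ⁻¹ (a ⁻¹ · b) * (⟦ R ⟧ -1F * (γ (a · R ⁻¹) * γ (b · R ⁻¹))) ≈
                γ (a ⁻¹) * γ (R ⁻¹ · b) * γ⁻¹ (R ⁻¹) * γ⁻¹ (a ⁻¹ · b)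
      summand R RR≋a = begin
        γ⁻¹ a * γ⁻¹ (a ⁻¹ · b) * (⟦ R ⟧ -1F * (γ (a · R ⁻¹) * γ (b · R ⁻¹)))
          ≈⟨ *-congˡ (*-congˡ (*-cong (γ-cong {a · R ⁻¹} {R} (aR⁻¹≋R R RR≋a)) (γ-solve (R ∷ b ∷ []) (x₁ ⊙ x₀ ⁻) (x₀ ⁻ ⊙ x₁)))) ⟩
        γ⁻¹ a * γ⁻¹ (a ⁻¹ · b) * (⟦ R ⟧ -1F * (γ R * γ (R ⁻¹ · b)))
          ≈⟨ CS.solve 5 (λ i k m r b → (i ⊕ k) ⊕ (m ⊕ (r ⊕ b)) ⊜ (((m ⊕ r) ⊕ i) ⊕ b) ⊕ k) ≈-refl _ _ _ _ _ ⟩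
        ⟦ R ⟧ -1F * γ R * γ⁻¹ a * γ (R ⁻¹ · b) * γ⁻¹ (a ⁻¹ · b)
          ≈⟨ *-congʳ (*-congʳ (flip-root R RR≋a)) ⟩
        γ (a ⁻¹) * γ⁻¹ (R ⁻¹) * γ (R ⁻¹ · b) * γ⁻¹ (a ⁻¹ · b)
          ≈⟨ *-congʳ (CS.solve 3 (λ a i b → (a ⊕ i) ⊕ b ⊜ (a ⊕ b) ⊕ i) ≈-refl _ _ _) ⟩
        γ (a ⁻¹) * γ (R ⁻¹ · b) * γ⁻¹ (R ⁻¹) * γ⁻¹ (a ⁻¹ · b) ∎

    module _ (c d e : Character) where

      balanced-sum≈hyper₃ : ∀ R → balanced-sum c d e R ≈
        N * (γ (R · c ⁻¹) * (γ d * (γ e * (γ (R ⁻¹) * γ ((a · c ⁻¹) ⁻¹))))) * hyper₃ (R · c ⁻¹) d e R (a · c ⁻¹)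
      balanced-sum≈hyper₃ R = sym (begin
        N * G * (-1/[q-1] * X)                    ≈⟨ CS.solve 4 (λ n g m x → (n ⊕ g) ⊕ (m ⊕ x) ⊜ (m ⊕ n) ⊕ (g ⊕ x)) ≈-refl _ _ _ _ ⟩
        -- The value -1 is written as g(ε), the numerator that cancels the denominator contributed
        -- by the lower parameter ε in every term.
        -1/[q-1] * N * (G * X)                    ≈⟨ *-congʳ (trans -1/[q-1]*N (sym (trans (γ-solve [] (GS.ι ⁻) GS.ι) γ-ε))) ⟩
        γ (ε ⁻¹) * (G * X)                        ≈⟨ trans (sym (*-assoc _ _ _)) (*-Σ̂ _ _) ⟩
        Σ̂ (λ χ → γ (ε ⁻¹) * G * (⟦ χ ⟧ -1F * (term χ (R · c ⁻¹) ε * (term χ d R * term χ e (a · c ⁻¹)))))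
          ≈⟨ Σ̂-cong summand ⟩
        balanced-sum c d e R                      ∎)
        where
        G X : ℂ
        G = γ (R · c ⁻¹) * (γ d * (γ e * (γ (R ⁻¹) * γ ((a · c ⁻¹) ⁻¹))))
        X = Σ̂ λ χ → ⟦ χ ⟧ -1F * (term χ (R · c ⁻¹) ε * (term χ d R * term χ e (a · c ⁻¹)))
        cancel³ : ∀ A B C z → γ A * (γ⁻¹ A * (γ B * (γ⁻¹ B * (γ C * (γ⁻¹ C * z))))) ≈ z
        cancel³ A B C z = trans (γ-*-γ⁻¹-cancel A _) (trans (γ-*-γ⁻¹-cancel B _) (γ-*-γ⁻¹-cancel C z))
        summand : ∀ χ → γ (ε ⁻¹) * G * (⟦ χ ⟧ -1F * (term χ (R · c ⁻¹) ε * (term χ d R * term χ e (a · c ⁻¹)))) ≈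
          ⟦ χ ⟧ -1F * (γ (R · c ⁻¹ · χ) * (γ (d · χ) * γ (e · χ)) * (γ (χ ⁻¹) * (γ ((R · χ) ⁻¹) * γ ((a · c ⁻¹ · χ) ⁻¹))))
        summand χ = begin
          γ (ε ⁻¹) * G * (⟦ χ ⟧ -1F * (term χ (R · c ⁻¹) ε * (term χ d R * term χ e (a · c ⁻¹))))
            ≈⟨ CS.solve 13 (λ p₀ p₁ p₂ p₃ p₄ p₅ m u₁ i₁ v₁ j₁ w₂ w₃ →
                 (p₀ ⊕ (p₁ ⊕ (p₂ ⊕ (p₃ ⊕ (p₄ ⊕ p₅))))) ⊕ (m ⊕ (((u₁ ⊕ i₁) ⊕ (v₁ ⊕ j₁)) ⊕ (w₂ ⊕ w₃))) ⊜
                 p₀ ⊕ (j₁ ⊕ (p₁ ⊕ (i₁ ⊕ ((p₂ ⊕ (p₃ ⊕ (p₄ ⊕ p₅))) ⊕ ((m ⊕ (u₁ ⊕ v₁)) ⊕ (w₂ ⊕ w₃))))))) ≈-refl _ _ _ _ _ _ _ _ _ _ _ _ _ ⟩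
          γ (ε ⁻¹) * (γ⁻¹ (ε ⁻¹) * (γ (R · c ⁻¹) * (γ⁻¹ (R · c ⁻¹) *
            (γ d * (γ e * (γ (R ⁻¹) * γ ((a · c ⁻¹) ⁻¹))) * (⟦ χ ⟧ -1F * (γ (R · c ⁻¹ · χ) * γ ((ε · χ) ⁻¹)) * (term χ d R * term χ e (a · c ⁻¹)))))))
            ≈⟨ trans (γ-*-γ⁻¹-cancel (ε ⁻¹) _) (γ-*-γ⁻¹-cancel (R · c ⁻¹) _) ⟩
          γ d * (γ e * (γ (R ⁻¹) * γ ((a · c ⁻¹) ⁻¹))) * (⟦ χ ⟧ -1F * (γ (R · c ⁻¹ · χ) * γ ((ε · χ) ⁻¹)) * (term χ d R * term χ e (a · c ⁻¹)))
            ≈⟨ CS.solve 13 (λ p₂ p₃ p₄ p₅ y u₂ i₂ v₂ j₂ u₃ i₃ v₃ j₃ →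
                 (p₂ ⊕ (p₃ ⊕ (p₄ ⊕ p₅))) ⊕ (y ⊕ (((u₂ ⊕ i₂) ⊕ (v₂ ⊕ j₂)) ⊕ ((u₃ ⊕ i₃) ⊕ (v₃ ⊕ j₃)))) ⊜
                 p₂ ⊕ (i₂ ⊕ (p₃ ⊕ (i₃ ⊕ (p₄ ⊕ (j₂ ⊕ (p₅ ⊕ (j₃ ⊕ (y ⊕ ((u₂ ⊕ u₃) ⊕ (v₂ ⊕ v₃))))))))))) ≈-refl _ _ _ _ _ _ _ _ _ _ _ _ _ ⟩
          γ d * (γ⁻¹ d * (γ e * (γ⁻¹ e * (γ (R ⁻¹) * (γ⁻¹ (R ⁻¹) * (γ ((a · c ⁻¹) ⁻¹) * (γ⁻¹ ((a · c ⁻¹) ⁻¹) *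
            (⟦ χ ⟧ -1F * (γ (R · c ⁻¹ · χ) * γ ((ε · χ) ⁻¹)) * (γ (d · χ) * γ (e · χ) * (γ ((R · χ) ⁻¹) * γ ((a · c ⁻¹ · χ) ⁻¹)))))))))))
            ≈⟨ trans (cancel³ d e (R ⁻¹) _) (γ-*-γ⁻¹-cancel ((a · c ⁻¹) ⁻¹) _) ⟩
          ⟦ χ ⟧ -1F * (γ (R · c ⁻¹ · χ) * γ ((ε · χ) ⁻¹)) * (γ (d · χ) * γ (e · χ) * (γ ((R · χ) ⁻¹) * γ ((a · c ⁻¹ · χ) ⁻¹)))
            ≈⟨ *-congʳ (*-congˡ (*-congˡ (γ-solve (χ ∷ []) ((GS.ι ⊙ x₀) ⁻) (x₀ ⁻)))) ⟩
          ⟦ χ ⟧ -1F * (γ (R · c ⁻¹ · χ) * γ (χ ⁻¹)) * (γ (d · χ) * γ (e · χ) * (γ ((R · χ) ⁻¹) * γ ((a · c ⁻¹ · χ) ⁻¹)))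
            ≈⟨ CS.solve 5 (λ m u v p w → (m ⊕ (u ⊕ v)) ⊕ (p ⊕ w) ⊜ m ⊕ ((u ⊕ p) ⊕ (v ⊕ w))) ≈-refl _ _ _ _ _ ⟩
          ⟦ χ ⟧ -1F * (γ (R · c ⁻¹ · χ) * (γ (d · χ) * γ (e · χ)) * (γ (χ ⁻¹) * (γ ((R · χ) ⁻¹) * γ ((a · c ⁻¹ · χ) ⁻¹)))) ∎

      module _ (a≢ε : ¬ (a ≋ ε)) (c≢ε : ¬ (c ≋ ε)) (cc≢a : ¬ (c · c ≋ a)) (de≢a : ¬ (d · e · a ⁻¹ ≋ ε)) where

        private
          hyper : Character → ℂ
          hyper R = hyper₃ (R · c ⁻¹) d e R (a · c ⁻¹)

          G : ℂ
          G = γ d * (γ e * γ ((a · c ⁻¹) ⁻¹))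

          -- Normalising the ₃F₂ provides exactly the Gauss sums inverse to g(R) and g(c/R). Both
          -- products reflect, with signs R(-1) and (c/R)(-1), so the coefficient becomes free of R
          -- and can leave the sum over roots.
          root-summand : ∀ R → R · R ≋ a → γ R * γ (c · R ⁻¹) * balanced-sum c d e R ≈ ⟦ c ⟧ -1F * (Q * Q * (N * G)) * hyper R
          root-summand R RR≋a = begin
            γ R * γ (c · R ⁻¹) * balanced-sum c d e R
              ≈⟨ *-congˡ (balanced-sum≈hyper₃ R) ⟩
            γ R * γ (c · R ⁻¹) * (N * (γ (R · c ⁻¹) * (γ d * (γ e * (γ (R ⁻¹) * γ ((a · c ⁻¹) ⁻¹))))) * hyper R)
              ≈⟨ CS.solve 9 (λ r s n t d e u v h → (r ⊕ s) ⊕ ((n ⊕ (t ⊕ (d ⊕ (e ⊕ (u ⊕ v))))) ⊕ h) ⊜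
                   ((r ⊕ u) ⊕ (s ⊕ t)) ⊕ ((n ⊕ (d ⊕ (e ⊕ v))) ⊕ h)) ≈-refl _ _ _ _ _ _ _ _ _ ⟩
            γ R * γ (R ⁻¹) * (γ (c · R ⁻¹) * γ (R · c ⁻¹)) * (N * G * hyper R)
              ≈⟨ *-congʳ (*-cong (γ-reflection R (root≢ε a≢ε R RR≋a))
                   (trans (*-congˡ (γ-solve (c ∷ R ∷ []) (x₁ ⊙ x₀ ⁻) ((x₀ ⊙ x₁ ⁻) ⁻))) (γ-reflection (c · R ⁻¹) c≢R))) ⟩
            ⟦ R ⟧ -1F * Q * (⟦ c · R ⁻¹ ⟧ -1F * Q) * (N * G * hyper R)
              ≈⟨ trans (*-congʳ (interchange _ _ _ _)) (*-congʳ (*-congʳ (GS.solve (c ∷ R ∷ []) (x₁ ⊙ (x₀ ⊙ x₁ ⁻)) x₀ -1F))) ⟩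
            ⟦ c ⟧ -1F * (Q * Q) * (N * G * hyper R)
              ≈⟨ CS.solve 4 (λ m q n h → (m ⊕ q) ⊕ (n ⊕ h) ⊜ (m ⊕ (q ⊕ n)) ⊕ h) ≈-refl _ _ _ _ ⟩
            ⟦ c ⟧ -1F * (Q * Q * (N * G)) * hyper R ∎
            where
            c≢R : ¬ (c · R ⁻¹ ≋ ε)
            c≢R p = cc≢a (Ĝ.trans {c · c} {R · R} {a} (λ x → *-cong (c≋R x) (c≋R x)) RR≋a)
              where
              c≋R : c ≋ R
              c≋R = Ĝ.trans {c} {c · R ⁻¹ · R} {R} (GS.solve (c ∷ R ∷ []) x₀ ((x₀ ⊙ x₁ ⁻) ⊙ x₁))
                (λ x → trans (*-congʳ (p x)) (Ĝ.identityˡ R x))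

          W : ℂ
          W = Σ̂ λ ψ → ⟦ ψ ⟧ -1F * (pair d ψ * pair e ψ * (pair a ψ * pair c ψ))

          W-value : W ≈ Q * (N * (γ (d · e · a ⁻¹) * γ c * G)) * Σ√ S hyper
          W-value = cancelˡ Q≉0 (begin
            Q * W
              ≈⟨ whipple c d e a≢ε c≢ε cc≢a de≢a ⟩
            γ (d · e · a ⁻¹) * (⟦ c ⟧ -1F * γ c) * Σ√ S (λ R → γ R * γ (c · R ⁻¹) * balanced-sum c d e R)
              ≈⟨ *-congˡ (trans (Σ√-cong root-summand) (sym (*-Σ√ _ _))) ⟩
            γ (d · e · a ⁻¹) * (⟦ c ⟧ -1F * γ c) * (⟦ c ⟧ -1F * (Q * Q * (N * G)) * Σ√ S hyper)
              ≈⟨ CS.solve 7 (λ g m c q n h s → (g ⊕ (m ⊕ c)) ⊕ ((m ⊕ ((q ⊕ q) ⊕ (n ⊕ h))) ⊕ s) ⊜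
                   (m ⊕ m) ⊕ (q ⊕ ((q ⊕ (n ⊕ ((g ⊕ c) ⊕ h))) ⊕ s))) ≈-refl _ _ _ _ _ _ _ ⟩
            ⟦ c ⟧ -1F * ⟦ c ⟧ -1F * (Q * (Q * (N * (γ (d · e · a ⁻¹) * γ c * G)) * Σ√ S hyper))
              ≈⟨ trans (*-congʳ (χ[-1]²≈1 c)) (*-identityˡ _) ⟩
            Q * (Q * (N * (γ (d · e · a ⁻¹) * γ c * G)) * Σ√ S hyper) ∎)

        -- Of the factor q² produced in `root-summand`, one q cancels the factor in front of
        -- `whipple`; the other reflects 1/g(a) into the numerator.
        whipple-theorem :
          Σ̂ (λ ψ → ⟦ ψ ⟧ -1F * (pair d ψ * pair e ψ * (pair a ψ * pair c ψ))) * (κ d * κ e * (κ a * κ c)) ≈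
          N * - 1# * (γ (a ⁻¹) * γ (a ⁻¹ · d · e) * γ⁻¹ (a ⁻¹ · d) * γ⁻¹ (a ⁻¹ · e) *
                      Σ√ S λ R → hyper₃ (R · c ⁻¹) d e R (a · c ⁻¹))
        whipple-theorem = begin
          W * (κ d * κ e * (κ a * κ c))
            ≈⟨ *-cong (trans W-value (*-congʳ (*-congˡ (*-congˡ (*-congʳ (*-congʳ
                   (γ-solve (S ∷ d ∷ e ∷ []) ((x₁ ⊙ x₂) ⊙ (x₀ ⊙ x₀) ⁻) (((x₀ ⊙ x₀) ⁻ ⊙ x₁) ⊙ x₂))))))))
                 (*-cong (*-cong (*-congˡ (γ⁻¹-solve (S ∷ d ∷ []) (x₁ ⊙ (x₀ ⊙ x₀) ⁻) ((x₀ ⊙ x₀) ⁻ ⊙ x₁)))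
                                 (*-congˡ (γ⁻¹-solve (S ∷ e ∷ []) (x₁ ⊙ (x₀ ⊙ x₀) ⁻) ((x₀ ⊙ x₀) ⁻ ⊙ x₁))))
                         (*-cong κa (*-congˡ (γ⁻¹-solve (S ∷ c ∷ []) (x₁ ⊙ (x₀ ⊙ x₀) ⁻) (((x₀ ⊙ x₀) ⊙ x₁ ⁻) ⁻))))) ⟩
          Q * (N * (γ (a ⁻¹ · d · e) * γ c * (γ d * (γ e * γ ((a · c ⁻¹) ⁻¹))))) * Σ√ S hyper *
            (γ⁻¹ d * γ⁻¹ (a ⁻¹ · d) * (γ⁻¹ e * γ⁻¹ (a ⁻¹ · e)) * (γ⁻¹ a * - 1# * (γ⁻¹ c * γ⁻¹ ((a · c ⁻¹) ⁻¹))))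
            ≈⟨ CS.solve 16 (λ q n g c d e k s i₁ i₂ i₃ i₄ i₅ m i₆ i₇ →
                 ((q ⊕ (n ⊕ ((g ⊕ c) ⊕ (d ⊕ (e ⊕ k))))) ⊕ s) ⊕ (((i₁ ⊕ i₂) ⊕ (i₃ ⊕ i₄)) ⊕ ((i₅ ⊕ m) ⊕ (i₆ ⊕ i₇))) ⊜
                 c ⊕ (i₆ ⊕ (d ⊕ (i₁ ⊕ (e ⊕ (i₃ ⊕ (k ⊕ (i₇ ⊕ ((n ⊕ m) ⊕ (((((q ⊕ i₅) ⊕ g) ⊕ i₂) ⊕ i₄) ⊕ s))))))))))
                 ≈-refl _ _ _ _ _ _ _ _ _ _ _ _ _ _ _ _ ⟩
          γ c * (γ⁻¹ c * (γ d * (γ⁻¹ d * (γ e * (γ⁻¹ e * (γ ((a · c ⁻¹) ⁻¹) * (γ⁻¹ ((a · c ⁻¹) ⁻¹) *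
            (N * - 1# * (Q * γ⁻¹ a * γ (a ⁻¹ · d · e) * γ⁻¹ (a ⁻¹ · d) * γ⁻¹ (a ⁻¹ · e) * Σ√ S hyper)))))))))
            ≈⟨ trans (γ-*-γ⁻¹-cancel c _) (trans (γ-*-γ⁻¹-cancel d _) (trans (γ-*-γ⁻¹-cancel e _) (γ-*-γ⁻¹-cancel ((a · c ⁻¹) ⁻¹) _))) ⟩
          N * - 1# * (Q * γ⁻¹ a * γ (a ⁻¹ · d · e) * γ⁻¹ (a ⁻¹ · d) * γ⁻¹ (a ⁻¹ · e) * Σ√ S hyper)
            ≈⟨ *-congˡ (*-congʳ (*-congʳ (*-congʳ (*-congʳ (Q*γ⁻¹a a≢ε))))) ⟩
          N * - 1# * (γ (a ⁻¹) * γ (a ⁻¹ · d · e) * γ⁻¹ (a ⁻¹ · d) * γ⁻¹ (a ⁻¹ · e) * Σ√ S hyper) ∎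

  -- Unfolding the series and root sums of the statement

  if-yes : ∀ {p} {P : Set p} (P? : Dec P) {z w : ℂ} → P → (if does P? then z else w) ≈ z
  if-yes (yes _) _ = ≈-refl
  if-yes (no ¬p) p = contradiction p ¬p

  if-no : ∀ {p} {P : Set p} (P? : Dec P) {z w : ℂ} → ¬ P → (if does P? then z else w) ≈ w
  if-no (yes p) ¬p = contradiction p ¬p
  if-no (no _)  _  = ≈-refl

  δ̂ : Character → Character → ℂ
  δ̂ χ ψ = if does (χ ≟ ψ) then 1# else 0#

  Σ̂-δ̂ : ∀ {h} α → Congruent^ h → Σ̂ (λ χ → δ̂ χ α * h χ) ≈ h α
  Σ̂-δ̂ {h} α h-cong = trans
    (Σ̂-single α (λ χ ψ p → *-cong (δ̂-cong χ ψ p (ψ ≟ α)) (h-cong χ ψ p))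
      (λ χ χ≢α → trans (*-congʳ (if-no (χ ≟ α) χ≢α)) (zeroˡ _)))
    (trans (*-congʳ (if-yes (α ≟ α) (Ĝ.refl {α}))) (*-identityˡ _))
    where
    δ̂-cong : ∀ χ ψ → χ ≋ ψ → Dec (ψ ≋ α) → δ̂ χ α ≈ δ̂ ψ α
    δ̂-cong χ ψ p (yes r) = trans (if-yes (χ ≟ α) (Ĝ.trans {χ} {ψ} {α} p r)) (sym (if-yes (ψ ≟ α) r))
    δ̂-cong χ ψ p (no ¬r) = trans (if-no (χ ≟ α) (λ r → ¬r (Ĝ.trans {ψ} {χ} {α} (Ĝ.sym {χ} {ψ} p) r))) (sym (if-no (ψ ≟ α) ¬r))

  g≈ : ∀ χ ψ → χ ≋ ψ → g χ ≈ γ ψ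
  g≈ χ ψ p = trans (sym (γ≈g χ)) (γ-cong {χ} {ψ} p)

  /g≈ : ∀ {z w} χ ψ → χ ≋ ψ → z ≈ w → z /g χ ≈ w * γ⁻¹ ψ
  /g≈ {z} χ ψ p z≈w = trans (/g-def z χ) (*-cong z≈w (γ⁻¹-cong {χ} {ψ} p))

  χ[-1]^2k : ∀ χ z → ⟦ χ ⟧ -1F * (⟦ χ ⟧ -1F * z) ≈ z
  χ[-1]^2k χ z = trans (sym (*-assoc _ _ _)) (trans (*-congʳ (χ[-1]²≈1 χ)) (*-identityˡ z))

  ₃F₂≈hyper₃ : ∀ A₁ A₂ A₃ B₂ B₃ → ₃F₂ A₁ A₂ A₃ B₂ B₃ F.1# ≈ hyper₃ A₁ A₂ A₃ B₂ B₃
  ₃F₂≈hyper₃ A₁ A₂ A₃ B₂ B₃ = *-congˡ (trans (sym (Σ̂-def _)) (Σ̂-cong λ χ → begin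
    factor χ A₁ ε * (factor χ A₂ B₂ * (factor χ A₃ B₃ * 1#)) * (⟦ χ ⟧ -1F * (⟦ χ ⟧ -1F * (⟦ χ ⟧ -1F * 1#))) * ⟦ χ ⟧ F.1#
      ≈⟨ *-cong (*-cong (*-cong (factor≈term χ A₁ ε) (*-cong (factor≈term χ A₂ B₂) (trans (*-identityʳ _) (factor≈term χ A₃ B₃))))
           (trans (χ[-1]^2k χ _) (*-identityʳ _))) (Character.1-homo χ) ⟩
    term χ A₁ ε * (term χ A₂ B₂ * term χ A₃ B₃) * ⟦ χ ⟧ -1F * 1#
      ≈⟨ trans (*-identityʳ _) (*-comm _ _) ⟩
    ⟦ χ ⟧ -1F * (term χ A₁ ε * (term χ A₂ B₂ * term χ A₃ B₃)) ∎))

  -- The sign χ(-1)⁸ disappears, and the factors are bracketed in fours to fit `quadruplication`.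
  ₈F₈-sum : ∀ A₁ A₂ A₃ A₄ A₅ A₆ A₇ A₈ B₁ B₂ B₃ B₄ B₅ B₆ B₇ B₈ →
    ₘFₘ (A₁ ∷ A₂ ∷ A₃ ∷ A₄ ∷ A₅ ∷ A₆ ∷ A₇ ∷ A₈ ∷ []) (B₁ ∷ B₂ ∷ B₃ ∷ B₄ ∷ B₅ ∷ B₆ ∷ B₇ ∷ B₈ ∷ []) F.1# ≈
    -1/[q-1] * Σ̂ λ χ → term χ A₁ B₁ * term χ A₂ B₂ * (term χ A₃ B₃ * term χ A₄ B₄) *
                       (term χ A₅ B₅ * term χ A₆ B₆ * (term χ A₇ B₇ * term χ A₈ B₈))
  ₈F₈-sum A₁ A₂ A₃ A₄ A₅ A₆ A₇ A₈ B₁ B₂ B₃ B₄ B₅ B₆ B₇ B₈ = *-congˡ (trans (sym (Σ̂-def _)) (Σ̂-cong λ χ → trans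
    (*-cong (*-cong
      (*-cong (factor≈term χ A₁ B₁) (*-cong (factor≈term χ A₂ B₂) (*-cong (factor≈term χ A₃ B₃) (*-cong (factor≈term χ A₄ B₄)
        (*-cong (factor≈term χ A₅ B₅) (*-cong (factor≈term χ A₆ B₆) (*-cong (factor≈term χ A₇ B₇)
          (trans (*-identityʳ _) (factor≈term χ A₈ B₈)))))))))
      (trans (χ[-1]^2k χ _) (trans (χ[-1]^2k χ _) (trans (χ[-1]^2k χ _) (χ[-1]^2k χ _)))))
      (Character.1-homo χ))
    (trans (trans (*-identityʳ _) (*-identityʳ _))
      (CS.solve 8 (λ a b c d e f g h → a ⊕ (b ⊕ (c ⊕ (d ⊕ (e ⊕ (f ⊕ (g ⊕ h)))))) ⊜
                                       ((a ⊕ b) ⊕ (c ⊕ d)) ⊕ ((e ⊕ f) ⊕ (g ⊕ h))) ≈-refl _ _ _ _ _ _ _ _))))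

  hyper₃-cong : ∀ {A₁ A₁′ A₂ A₂′ A₃ A₃′ B₂ B₂′ B₃ B₃′} → A₁ ≋ A₁′ → A₂ ≋ A₂′ → A₃ ≋ A₃′ → B₂ ≋ B₂′ → B₃ ≋ B₃′ →
    hyper₃ A₁ A₂ A₃ B₂ B₃ ≈ hyper₃ A₁′ A₂′ A₃′ B₂′ B₃′
  hyper₃-cong {A₁} {A₁′} {A₂} {A₂′} {A₃} {A₃′} {B₂} {B₂′} {B₃} {B₃′} p₁ p₂ p₃ r₂ r₃ = *-congˡ (Σ̂-cong λ χ → *-congˡ (*-cong
    (term-cong {χ} {χ} {A₁} {A₁′} {ε} {ε} (Ĝ.refl {χ}) p₁ (Ĝ.refl {ε})) (*-cong
    (term-cong {χ} {χ} {A₂} {A₂′} {B₂} {B₂′} (Ĝ.refl {χ}) p₂ r₂)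
    (term-cong {χ} {χ} {A₃} {A₃′} {B₃} {B₃′} (Ĝ.refl {χ}) p₃ r₃))))

  -1/[q-1]-cancel : ∀ z → -1/[q-1] * (N * - 1# * z) ≈ z
  -1/[q-1]-cancel z = begin
    -1/[q-1] * (N * - 1# * z)      ≈⟨ CS.solve 4 (λ m n u z → m ⊕ ((n ⊕ u) ⊕ z) ⊜ ((m ⊕ n) ⊕ u) ⊕ z) ≈-refl _ _ _ _ ⟩
    -1/[q-1] * N * - 1# * z        ≈⟨ *-congʳ (trans (*-congʳ -1/[q-1]*N) -1*-1≈1) ⟩
    1# * z                         ≈⟨ *-identityˡ z ⟩
    z                              ∎

  -- From the ₈F₈ to series in χ² and χ⁴

  module Reduction (φ : Character) (φφ≋ε : φ · φ ≋ ε) (φ≢ε : ¬ (φ ≋ ε)) where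

    open WithQuadratic φ φφ≋ε φ≢ε
    open KummerSums φ φφ≋ε φ≢ε
    open Transformations φ φφ≋ε φ≢ε

    modulo-φφ : ∀ χ ψ → χ ≋ ψ · (φ · φ) → χ ≋ ψ
    modulo-φφ χ ψ p = Ĝ.trans {χ} {ψ · (φ · φ)} {ψ} p (drop-φφ ψ)

    -- R/S has trivial square, so it is ε or, by `quadratic-unique`, φ.
    square-roots^ : ∀ R S → R · R ≋ S · S → R ≋ S ⊎ R ≋ φ · S
    square-roots^ R S RR≋SS with (R · S ⁻¹) ≟ ε
    ... | yes R/S≋ε = inj₁ (Ĝ.trans {R} {R · S ⁻¹ · S} {S} (GS.solve (R ∷ S ∷ []) x₀ ((x₀ ⊙ x₁ ⁻) ⊙ x₁))
            (λ x → trans (*-congʳ (R/S≋ε x)) (Ĝ.identityˡ S x)))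
    ... | no R/S≢ε = inj₂ (Ĝ.trans {R} {R · S ⁻¹ · S} {φ · S} (GS.solve (R ∷ S ∷ []) x₀ ((x₀ ⊙ x₁ ⁻) ⊙ x₁))
            (λ x → *-congʳ (quadratic-unique (R · S ⁻¹) φ [R/S]²≋ε R/S≢ε φφ≋ε φ≢ε x)))
      where
      [R/S]²≋ε : R · S ⁻¹ · (R · S ⁻¹) ≋ ε
      [R/S]²≋ε = Ĝ.trans {R · S ⁻¹ · (R · S ⁻¹)} {R · R · (S · S) ⁻¹} {ε}
        (GS.solve (R ∷ S ∷ []) ((x₀ ⊙ x₁ ⁻) ⊙ (x₀ ⊙ x₁ ⁻)) ((x₀ ⊙ x₀) ⊙ (x₁ ⊙ x₁) ⁻))
        (λ x → trans (*-congʳ (RR≋SS x)) (GS.solve (S ∷ []) ((x₀ ⊙ x₀) ⊙ (x₀ ⊙ x₀) ⁻) GS.ι x))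

    -- The filter on the listing is the sum of the indicators of S and φS, which are distinct
    -- because φ ≠ ε.
    ∑√≈Σ√ : ∀ {f h} T S → T ≋ S · S → (∀ R → f R ≈ h R) → Congruent^ h → ∑√ T f ≈ Σ√ S h
    ∑√≈Σ√ {f} {h} T S T≋SS f≈h h-cong = begin
      ∑√ T f                                                       ≈⟨ trans (sym (Σ̂-def _)) (Σ̂-cong λ R → select R (R ≟ S) (R ≟ (φ · S))) ⟩
      Σ̂ (λ R → δ̂ R S * h R + δ̂ R (φ · S) * h R)                    ≈⟨ Σ̂-distrib-+ _ _ ⟩
      Σ̂ (λ R → δ̂ R S * h R) + Σ̂ (λ R → δ̂ R (φ · S) * h R)          ≈⟨ +-cong (Σ̂-δ̂ S h-cong) (Σ̂-δ̂ (φ · S) h-cong) ⟩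
      h S + h (φ · S)                                              ≈⟨ Σ√-def S h ⟨
      Σ√ S h                                                       ∎
      where
      root : ∀ R → R · R ≋ S · S → R ^ 2 ≋ T
      root R p = Ĝ.trans {R ^ 2} {S · S} {T} (Ĝ.trans {R ^ 2} {R · R} {S · S} (GS.solve (R ∷ []) (x₀ ↑ 2) (x₀ ⊙ x₀)) p)
        (Ĝ.sym {T} {S · S} T≋SS)
      one : ∀ R α → R ≋ α → δ̂ R α * h R ≈ h R
      one R α p = trans (*-congʳ (if-yes (R ≟ α) p)) (*-identityˡ _)
      none : ∀ R α → ¬ (R ≋ α) → δ̂ R α * h R ≈ 0#
      none R α ¬p = trans (*-congʳ (if-no (R ≟ α) ¬p)) (zeroˡ _)
      select : ∀ R → Dec (R ≋ S) → Dec (R ≋ φ · S) →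
        (if does (R ^ 2 ≟ T) then f R else 0#) ≈ δ̂ R S * h R + δ̂ R (φ · S) * h R
      select R (yes R≋S) (yes R≋φS) = contradiction (Ĝ.trans {φ} {φ · S · S ⁻¹} {ε}
        (GS.solve (φ ∷ S ∷ []) x₀ ((x₀ ⊙ x₁) ⊙ x₁ ⁻))
        (λ x → trans (*-congʳ (trans (sym (R≋φS x)) (R≋S x))) (GS.solve (S ∷ []) (x₀ ⊙ x₀ ⁻) GS.ι x))) φ≢ε
      select R (yes R≋S) (no R≢φS) = trans
        (trans (if-yes (R ^ 2 ≟ T) (root R λ x → *-cong (R≋S x) (R≋S x))) (f≈h R))
        (sym (trans (+-cong (one R S R≋S) (none R (φ · S) R≢φS)) (+-identityʳ _)))
      select R (no R≢S) (yes R≋φS) = trans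
        (trans (if-yes (R ^ 2 ≟ T) (root R (Ĝ.trans {R · R} {φ · S · (φ · S)} {S · S} (λ x → *-cong (R≋φS x) (R≋φS x))
          (modulo-φφ (φ · S · (φ · S)) (S · S) (GS.solve (φ ∷ S ∷ []) ((x₀ ⊙ x₁) ⊙ (x₀ ⊙ x₁)) ((x₁ ⊙ x₁) ⊙ (x₀ ⊙ x₀))))))) (f≈h R))
        (sym (trans (+-cong (none R S R≢S) (one R (φ · S) R≋φS)) (+-identityˡ _)))
      select R (no R≢S) (no R≢φS) = trans
        (if-no (R ^ 2 ≟ T) λ p → neither (square-roots^ R S (Ĝ.trans {R · R} {R ^ 2} {S · S} (GS.solve (R ∷ []) (x₀ ⊙ x₀) (x₀ ↑ 2))
          (Ĝ.trans {R ^ 2} {T} {S · S} p T≋SS))))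
        (sym (trans (+-cong (none R S R≢S) (none R (φ · S) R≢φS)) (+-identityˡ _)))
        where
        neither : ¬ (R ≋ S ⊎ R ≋ φ · S)
        neither (inj₁ p) = R≢S p
        neither (inj₂ p) = R≢φS p

    term² : Character → Character → Character → ℂ
    term² ψ X Y = term ψ X Y * term ψ (φ · X) (φ · Y)

    -- Since the inverse of χ₄ is φχ₄, the four twists form two φ-pairs, starting at X and χ₄X.
    -- Duplication turns these into X² and (χ₄X)² = φX², which is a φ-pair again and can be
    -- duplicated once more.
    quadruplication : ∀ χ₄ → χ₄ · χ₄ ≋ φ → ∀ χ X Y →
      term χ X Y * term χ (φ · X) (φ · Y) * (term χ (χ₄ · X) (χ₄ · Y) * term χ (χ₄ ⁻¹ · X) (χ₄ ⁻¹ · Y)) ≈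
      term² (χ · χ) (X · X) (Y · Y)
    quadruplication χ₄ χ₄²≋φ χ X Y = *-cong (term-duplication χ X Y) (begin
      term χ (χ₄ · X) (χ₄ · Y) * term χ (χ₄ ⁻¹ · X) (χ₄ ⁻¹ · Y)
        ≈⟨ *-congˡ (term-cong {χ} {χ} {χ₄ ⁻¹ · X} {φ · (χ₄ · X)} {χ₄ ⁻¹ · Y} {φ · (χ₄ · Y)} (Ĝ.refl {χ}) (inverse X) (inverse Y)) ⟩
      term χ (χ₄ · X) (χ₄ · Y) * term χ (φ · (χ₄ · X)) (φ · (χ₄ · Y))
        ≈⟨ term-duplication χ (χ₄ · X) (χ₄ · Y) ⟩
      term (χ · χ) (χ₄ · X · (χ₄ · X)) (χ₄ · Y · (χ₄ · Y))
        ≈⟨ term-cong {χ · χ} {χ · χ} {χ₄ · X · (χ₄ · X)} {φ · (X · X)} {χ₄ · Y · (χ₄ · Y)} {φ · (Y · Y)} (Ĝ.refl {χ · χ}) (twist X) (twist Y) ⟩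
      term (χ · χ) (φ · (X · X)) (φ · (Y · Y)) ∎)
      where
      inverse : ∀ X → χ₄ ⁻¹ · X ≋ φ · (χ₄ · X)
      inverse X = Ĝ.trans {χ₄ ⁻¹ · X} {φ · (χ₄ · X) · (χ₄ · χ₄) ⁻¹ · φ ⁻¹} {φ · (χ₄ · X)}
        (GS.solve (χ₄ ∷ φ ∷ X ∷ []) (x₀ ⁻ ⊙ x₂) (((x₁ ⊙ (x₀ ⊙ x₂)) ⊙ (x₀ ⊙ x₀) ⁻) ⊙ x₁ ⁻))
        (Ĝ.trans {φ · (χ₄ · X) · (χ₄ · χ₄) ⁻¹ · φ ⁻¹} {φ · (χ₄ · X) · φ · φ} {φ · (χ₄ · X)}
          (λ x → *-cong (*-congˡ (trans (χ₄²≋φ (x F.⁻¹)) (φ⁻¹≋φ x))) (φ⁻¹≋φ x))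
          (modulo-φφ (φ · (χ₄ · X) · φ · φ) (φ · (χ₄ · X)) (GS.solve (χ₄ ∷ φ ∷ X ∷ []) (((x₁ ⊙ (x₀ ⊙ x₂)) ⊙ x₁) ⊙ x₁) ((x₁ ⊙ (x₀ ⊙ x₂)) ⊙ (x₁ ⊙ x₁)))))
      twist : ∀ X → χ₄ · X · (χ₄ · X) ≋ φ · (X · X)
      twist X = Ĝ.trans {χ₄ · X · (χ₄ · X)} {χ₄ · χ₄ · (X · X)} {φ · (X · X)}
        (GS.solve (χ₄ ∷ X ∷ []) ((x₀ ⊙ x₁) ⊙ (x₀ ⊙ x₁)) ((x₀ ⊙ x₀) ⊙ (x₁ ⊙ x₁))) (λ x → *-congʳ (χ₄²≋φ x))

    module _ (A B : Character) where

      a b d : Character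
      a = A · A
      b = B · B
      d = A · B ⁻¹ · (A · B ⁻¹)

      -- Summands of the ₄F₃ with upper parameters A², φA², B², φB² and of the ₂F₁ with upper
      -- parameters A⁴, B⁴. The ₈F₈ has the summand `four (χ · χ)`.
      four two : Character → ℂ
      four ψ = term² ψ a (ε · ε) * term² ψ b d
      two η = term η (a · a) (ε · ε · (ε · ε)) * term η (b · b) (d · d)

      four≈two : ∀ ψ → four ψ ≈ two (ψ · ψ)
      four≈two ψ = *-cong (term-duplication ψ a (ε · ε)) (term-duplication ψ b d)

      four-cong : Congruent^ four
      four-cong χ ψ p = *-cong (term²-cong a (ε · ε)) (term²-cong b d)
        where
        term²-cong : ∀ X Y → term² χ X Y ≈ term² ψ X Y
        term²-cong X Y = *-cong (term-cong {χ} {ψ} {X} {X} {Y} {Y} p (Ĝ.refl {X}) (Ĝ.refl {Y}))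
          (term-cong {χ} {ψ} {φ · X} {φ · X} {φ · Y} {φ · Y} p (Ĝ.refl {φ · X}) (Ĝ.refl {φ · Y}))

      two-cong : Congruent^ two
      two-cong χ ψ p = *-cong
        (term-cong {χ} {ψ} {a · a} {a · a} {ε · ε · (ε · ε)} {ε · ε · (ε · ε)} p (Ĝ.refl {a · a}) (Ĝ.refl {ε · ε · (ε · ε)}))
        (term-cong {χ} {ψ} {b · b} {b · b} {d · d} {d · d} p (Ĝ.refl {b · b}) (Ĝ.refl {d · d}))

      quartic-sum : Σ̂ (λ χ → four (χ · χ)) ≈ Σ̂ two + Σ̂ (λ η → ⟦ η ⟧ -1F * two η) + Σ̂ (λ ψ → ⟦ ψ ⟧ -1F * four ψ)
      quartic-sum = trans (Σ̂-square four-cong) (+-congʳ (trans (Σ̂-cong four≈two) (Σ̂-square two-cong)))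

      private
        -- The ₂F₁ is well-poised with respect to A⁴, whose chosen root is A²; the ₄F₃ with respect
        -- to A², with root A.
        module W₂ = WellPoised φ φφ≋ε φ≢ε a
        module E₂ = Summations φ φφ≋ε φ≢ε a
        module W₄ = WellPoised φ φφ≋ε φ≢ε A
        module E₄ = Summations φ φφ≋ε φ≢ε A

      two-pairs : ∀ η → two η ≈ W₂.pair (a · a) η * W₂.pair (b · b) η * (E₂.κ (a · a) * E₂.κ (b · b))
      two-pairs η = trans (*-cong
        (E₂.term-pair η (a · a) (ε · ε · (ε · ε)) (GS.solve (A ∷ []) ((GS.ι ⊙ GS.ι) ⊙ (GS.ι ⊙ GS.ι)) (((x₀ ⊙ x₀) ⊙ (x₀ ⊙ x₀)) ⊙ ((x₀ ⊙ x₀) ⊙ (x₀ ⊙ x₀)) ⁻)))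
        (E₂.term-pair η (b · b) (d · d) (GS.solve (A ∷ B ∷ [])
          (((x₀ ⊙ x₁ ⁻) ⊙ (x₀ ⊙ x₁ ⁻)) ⊙ ((x₀ ⊙ x₁ ⁻) ⊙ (x₀ ⊙ x₁ ⁻)))
          (((x₀ ⊙ x₀) ⊙ (x₀ ⊙ x₀)) ⊙ ((x₁ ⊙ x₁) ⊙ (x₁ ⊙ x₁)) ⁻)))) (interchange _ _ _ _)

      four-pairs : ∀ ψ → four ψ ≈ W₄.pair b ψ * W₄.pair (φ · b) ψ * (W₄.pair a ψ * W₄.pair (φ · a) ψ) *
                                  (E₄.κ b * E₄.κ (φ · b) * (E₄.κ a * E₄.κ (φ · a)))
      four-pairs ψ = trans (*-cong
        (*-cong (E₄.term-pair ψ a (ε · ε) (GS.solve (A ∷ []) (GS.ι ⊙ GS.ι) ((x₀ ⊙ x₀) ⊙ (x₀ ⊙ x₀) ⁻)))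
                (E₄.term-pair ψ (φ · a) (φ · (ε · ε)) (modulo-φφ (φ · (ε · ε)) (a · (φ · a) ⁻¹) (GS.solve (φ ∷ A ∷ [])
                  (x₀ ⊙ (GS.ι ⊙ GS.ι)) (((x₁ ⊙ x₁) ⊙ (x₀ ⊙ (x₁ ⊙ x₁)) ⁻) ⊙ (x₀ ⊙ x₀))))))
        (*-cong (E₄.term-pair ψ b d (GS.solve (A ∷ B ∷ []) ((x₀ ⊙ x₁ ⁻) ⊙ (x₀ ⊙ x₁ ⁻)) ((x₀ ⊙ x₀) ⊙ (x₁ ⊙ x₁) ⁻)))
                (E₄.term-pair ψ (φ · b) (φ · d) (modulo-φφ (φ · d) (a · (φ · b) ⁻¹) (GS.solve (φ ∷ A ∷ B ∷ [])
                  (x₀ ⊙ ((x₁ ⊙ x₂ ⁻) ⊙ (x₁ ⊙ x₂ ⁻))) (((x₁ ⊙ x₁) ⊙ (x₀ ⊙ (x₂ ⊙ x₂)) ⁻) ⊙ (x₀ ⊙ x₀)))))))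
        (CS.solve 8 (λ p k q l r m s n → ((p ⊕ k) ⊕ (q ⊕ l)) ⊕ ((r ⊕ m) ⊕ (s ⊕ n)) ⊜ ((r ⊕ s) ⊕ (p ⊕ q)) ⊕ ((m ⊕ n) ⊕ (k ⊕ l))) ≈-refl _ _ _ _ _ _ _ _)

      gauss-part kummer-part whipple-part : ℂ
      gauss-part = γ (b · b) * γ ((a · a) ⁻¹ · (b · b · (b · b))) * γ⁻¹ ((a · a) ⁻¹ · (b · b)) * γ⁻¹ (b · b · (b · b))
      kummer-part = Σ√ a λ R → γ ((a · a) ⁻¹) * γ (R ⁻¹ · (b · b)) * γ⁻¹ (R ⁻¹) * γ⁻¹ ((a · a) ⁻¹ · (b · b))
      whipple-part = γ (a ⁻¹) * γ (a ⁻¹ · b · (φ · b)) * γ⁻¹ (a ⁻¹ · b) * γ⁻¹ (a ⁻¹ · (φ · b)) *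
        Σ√ A λ R → hyper₃ (R · (φ · a) ⁻¹) b (φ · b) R (a · (φ · a) ⁻¹)

      quartic-value : ¬ (A ^ 4 ≋ ε) → ¬ (B ^ 8 ≋ ε) → ¬ (A ^ 2 ≋ φ · B ^ 4) →
        -1/[q-1] * Σ̂ (λ χ → four (χ · χ)) ≈ gauss-part + kummer-part + whipple-part
      quartic-value A⁴≢ε B⁸≢ε A²≢φB⁴ = begin
        -1/[q-1] * Σ̂ (λ χ → four (χ · χ))
          ≈⟨ *-congˡ (trans quartic-sum (+-cong (+-cong
               (trans (Σ̂-cong two-pairs) (trans (sym (Σ̂-* _ _)) (E₂.gauss-theorem (b · b) bb²≢ε)))
               (trans (Σ̂-cong λ η → trans (*-congˡ (two-pairs η)) (sym (*-assoc _ _ _))) (trans (sym (Σ̂-* _ _)) (E₂.kummer-theorem (b · b) aa≢ε))))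
               (trans (Σ̂-cong λ ψ → trans (*-congˡ (four-pairs ψ)) (sym (*-assoc _ _ _))) (trans (sym (Σ̂-* _ _))
                 -- With c = φA² the equation c² = a would mean A⁴ = A², hence A² = ε, against A⁴ ≠
                 -- ε. With d = B² and e = φB² the quotient de/a is φB⁴/A², non-trivial by the last
                 -- hypothesis.
                 (E₄.whipple-theorem (φ · a) b (φ · b) a≢ε φa≢ε φaφa≢a de≢a))))) ⟩
        -1/[q-1] * (N * - 1# * gauss-part + N * - 1# * kummer-part + N * - 1# * whipple-part)
          ≈⟨ trans (distribˡ _ _ _) (+-cong (trans (distribˡ _ _ _) (+-cong (-1/[q-1]-cancel _) (-1/[q-1]-cancel _))) (-1/[q-1]-cancel _)) ⟩
        gauss-part + kummer-part + whipple-part ∎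
        where
        bb²≢ε : ¬ (b · b · (b · b) ≋ ε)
        bb²≢ε p = B⁸≢ε (Ĝ.trans {B ^ 8} {b · b · (b · b)} {ε}
          (GS.solve (B ∷ []) (x₀ ↑ 8) (((x₀ ⊙ x₀) ⊙ (x₀ ⊙ x₀)) ⊙ ((x₀ ⊙ x₀) ⊙ (x₀ ⊙ x₀)))) p)
        A⁴≋aa : A ^ 4 ≋ a · a
        A⁴≋aa = GS.solve (A ∷ []) (x₀ ↑ 4) ((x₀ ⊙ x₀) ⊙ (x₀ ⊙ x₀))
        aa≢ε : ¬ (a · a ≋ ε)
        aa≢ε p = A⁴≢ε (Ĝ.trans {A ^ 4} {a · a} {ε} A⁴≋aa p)
        a≢ε : ¬ (a ≋ ε)
        a≢ε p = aa≢ε (Ĝ.trans {a · a} {ε · ε} {ε} (λ x → *-cong (p x) (p x)) (Ĝ.identityˡ ε))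
        [φa]²≋aa : φ · a · (φ · a) ≋ a · a
        [φa]²≋aa = modulo-φφ (φ · a · (φ · a)) (a · a)
          (GS.solve (φ ∷ A ∷ []) ((x₀ ⊙ (x₁ ⊙ x₁)) ⊙ (x₀ ⊙ (x₁ ⊙ x₁))) (((x₁ ⊙ x₁) ⊙ (x₁ ⊙ x₁)) ⊙ (x₀ ⊙ x₀)))
        φa≢ε : ¬ (φ · a ≋ ε)
        φa≢ε p = aa≢ε (Ĝ.trans {a · a} {φ · a · (φ · a)} {ε} (Ĝ.sym {φ · a · (φ · a)} {a · a} [φa]²≋aa)
          (λ x → trans (*-cong (p x) (p x)) (Ĝ.identityˡ ε x)))
        φaφa≢a : ¬ (φ · a · (φ · a) ≋ a)
        φaφa≢a p = a≢ε (Ĝ.trans {a} {a · a · a ⁻¹} {ε} (GS.solve (A ∷ []) (x₀ ⊙ x₀) (((x₀ ⊙ x₀) ⊙ (x₀ ⊙ x₀)) ⊙ (x₀ ⊙ x₀) ⁻))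
          (λ x → trans (*-congʳ (trans (sym ([φa]²≋aa x)) (p x))) (GS.solve (A ∷ []) ((x₀ ⊙ x₀) ⊙ (x₀ ⊙ x₀) ⁻) GS.ι x)))
        de≢a : ¬ (b · (φ · b) · a ⁻¹ ≋ ε)
        de≢a p = A²≢φB⁴ (Ĝ.trans {A ^ 2} {(b · (φ · b) · a ⁻¹) ⁻¹ · (φ · B ^ 4)} {φ · B ^ 4}
          (GS.solve (φ ∷ A ∷ B ∷ []) (x₁ ↑ 2) ((((x₂ ⊙ x₂) ⊙ (x₀ ⊙ (x₂ ⊙ x₂))) ⊙ (x₁ ⊙ x₁) ⁻) ⁻ ⊙ (x₀ ⊙ x₂ ↑ 4)))
          (Ĝ.trans {(b · (φ · b) · a ⁻¹) ⁻¹ · (φ · B ^ 4)} {ε ⁻¹ · (φ · B ^ 4)} {φ · B ^ 4} (λ x → *-congʳ (p (x F.⁻¹)))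
            (GS.solve (φ ∷ B ∷ []) (GS.ι ⁻ ⊙ (x₀ ⊙ x₁ ↑ 4)) (x₀ ⊙ x₁ ↑ 4))))

      -- Matching the three terms of the right-hand side

      private
        a₂ b₂ a₄ b₄ b₈ : ∀ {n} → GS.Expr (suc (suc n))
        a₂ = x₀ ⊙ x₀
        b₂ = x₁ ⊙ x₁
        a₄ = a₂ ⊙ a₂
        b₄ = b₂ ⊙ b₂
        b₈ = b₄ ⊙ b₄

      gauss-part≈ : g (B ^ 4) * g (A ⁻¹ ^ 4 · B ^ 8) /g (A ⁻¹ ^ 4 · B ^ 4) /g (B ^ 8) ≈ gauss-part
      gauss-part≈ =
        /g≈ (B ^ 8) (b · b · (b · b)) (GS.solve (A ∷ B ∷ []) (x₁ ↑ 8) b₈)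
          (/g≈ (A ⁻¹ ^ 4 · B ^ 4) ((a · a) ⁻¹ · (b · b)) (GS.solve (A ∷ B ∷ []) (x₀ ⁻ ↑ 4 ⊙ x₁ ↑ 4) (a₄ ⁻ ⊙ b₄))
            (*-cong (g≈ (B ^ 4) (b · b) (GS.solve (A ∷ B ∷ []) (x₁ ↑ 4) b₄))
              (g≈ (A ⁻¹ ^ 4 · B ^ 8) ((a · a) ⁻¹ · (b · b · (b · b))) (GS.solve (A ∷ B ∷ []) (x₀ ⁻ ↑ 4 ⊙ x₁ ↑ 8) (a₄ ⁻ ⊙ b₈)))))

      kummer-part≈ : ∑[ R ²= A ^ 4 ] (g (A ⁻¹ ^ 4) * g (R ⁻¹ · B ^ 4) /g (R ⁻¹) /g (A ⁻¹ ^ 4 · B ^ 4)) ≈ kummer-part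
      kummer-part≈ = ∑√≈Σ√ (A ^ 4) a (GS.solve (A ∷ []) (x₀ ↑ 4) ((x₀ ⊙ x₀) ⊙ (x₀ ⊙ x₀)))
        (λ R → /g≈ (A ⁻¹ ^ 4 · B ^ 4) ((a · a) ⁻¹ · (b · b)) (GS.solve (A ∷ B ∷ []) (x₀ ⁻ ↑ 4 ⊙ x₁ ↑ 4) (a₄ ⁻ ⊙ b₄))
          (/g≈ (R ⁻¹) (R ⁻¹) (Ĝ.refl {R ⁻¹})
            (*-cong (g≈ (A ⁻¹ ^ 4) ((a · a) ⁻¹) (GS.solve (A ∷ B ∷ []) (x₀ ⁻ ↑ 4) (a₄ ⁻)))
              (g≈ (R ⁻¹ · B ^ 4) (R ⁻¹ · (b · b)) (GS.solve (A ∷ B ∷ R ∷ []) (x₂ ⁻ ⊙ x₁ ↑ 4) (x₂ ⁻ ⊙ b₄))))))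
        (λ R T p → *-congʳ (*-cong (*-congˡ (γ-cong {R ⁻¹ · (b · b)} {T ⁻¹ · (b · b)} λ x → *-congʳ (p (x F.⁻¹))))
          (γ⁻¹-cong {R ⁻¹} {T ⁻¹} λ x → p (x F.⁻¹))))

      whipple-part≈ : g (A ⁻¹ ^ 2) * g (A ⁻¹ ^ 2 · φ · B ^ 4) /g (A ⁻¹ ^ 2 · B ^ 2) /g (A ⁻¹ ^ 2 · φ · B ^ 2)
        * ∑[ R ²= A ^ 2 ] (₃F₂ (R · φ · A ⁻¹ ^ 2) (B ^ 2) (φ · B ^ 2) R φ F.1#) ≈ whipple-part
      whipple-part≈ = *-cong
        (/g≈ (A ⁻¹ ^ 2 · φ · B ^ 2) (a ⁻¹ · (φ · b)) (GS.solve ρ (x₀ ⁻ ↑ 2 ⊙ x₂ ⊙ x₁ ↑ 2) (a₂ ⁻ ⊙ (x₂ ⊙ b₂)))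
          (/g≈ (A ⁻¹ ^ 2 · B ^ 2) (a ⁻¹ · b) (GS.solve ρ (x₀ ⁻ ↑ 2 ⊙ x₁ ↑ 2) (a₂ ⁻ ⊙ b₂))
            (*-cong (g≈ (A ⁻¹ ^ 2) (a ⁻¹) (GS.solve ρ (x₀ ⁻ ↑ 2) (a₂ ⁻)))
              (g≈ (A ⁻¹ ^ 2 · φ · B ^ 4) (a ⁻¹ · b · (φ · b)) (GS.solve ρ (x₀ ⁻ ↑ 2 ⊙ x₂ ⊙ x₁ ↑ 4) (a₂ ⁻ ⊙ b₂ ⊙ (x₂ ⊙ b₂)))))))
        (∑√≈Σ√ (A ^ 2) A (GS.solve (A ∷ []) (x₀ ↑ 2) (x₀ ⊙ x₀))
          (λ R → trans (₃F₂≈hyper₃ (R · φ · A ⁻¹ ^ 2) (B ^ 2) (φ · B ^ 2) R φ)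
            (hyper₃-cong {R · φ · A ⁻¹ ^ 2} {R · (φ · a) ⁻¹} {B ^ 2} {b} {φ · B ^ 2} {φ · b} {R} {R} {φ} {a · (φ · a) ⁻¹}
              (modulo-φφ (R · φ · A ⁻¹ ^ 2) (R · (φ · a) ⁻¹)
                (GS.solve (A ∷ B ∷ φ ∷ R ∷ []) (x₃ ⊙ x₂ ⊙ x₀ ⁻ ↑ 2) (x₃ ⊙ (x₂ ⊙ a₂) ⁻ ⊙ (x₂ ⊙ x₂))))
              (GS.solve ρ (x₁ ↑ 2) b₂)
              (GS.solve ρ (x₂ ⊙ x₁ ↑ 2) (x₂ ⊙ b₂))
              (Ĝ.refl {R})
              (modulo-φφ φ (a · (φ · a) ⁻¹) (GS.solve ρ x₂ (a₂ ⊙ (x₂ ⊙ a₂) ⁻ ⊙ (x₂ ⊙ x₂))))))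
          (λ R T p → hyper₃-cong {R · (φ · a) ⁻¹} {T · (φ · a) ⁻¹} {b} {b} {φ · b} {φ · b} {R} {T} {a · (φ · a) ⁻¹} {a · (φ · a) ⁻¹}
            (λ x → *-congʳ (p x)) (Ĝ.refl {b}) (Ĝ.refl {φ · b}) p (Ĝ.refl {a · (φ · a) ⁻¹})))
        where
        ρ : Vec Character 3
        ρ = A ∷ B ∷ φ ∷ []

      ₈F₈≈quartic : ∀ χ₄ → χ₄ · χ₄ ≋ φ →
        ₘFₘ (A ∷ φ · A ∷ χ₄ · A ∷ χ₄ ⁻¹ · A ∷ B ∷ φ · B ∷ χ₄ · B ∷ χ₄ ⁻¹ · B ∷ [])
            (ε ∷ φ ∷ χ₄ ∷ χ₄ ⁻¹ ∷ A · B ⁻¹ ∷ φ · A · B ⁻¹ ∷ χ₄ · A · B ⁻¹ ∷ χ₄ ⁻¹ · A · B ⁻¹ ∷ []) F.1# ≈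
        -1/[q-1] * Σ̂ (λ χ → four (χ · χ))
      ₈F₈≈quartic χ₄ χ₄²≋φ = trans
        (₈F₈-sum A (φ · A) (χ₄ · A) (χ₄ ⁻¹ · A) B (φ · B) (χ₄ · B) (χ₄ ⁻¹ · B)
                 ε φ χ₄ (χ₄ ⁻¹) (A · B ⁻¹) (φ · A · B ⁻¹) (χ₄ · A · B ⁻¹) (χ₄ ⁻¹ · A · B ⁻¹))
        (*-congˡ (Σ̂-cong λ χ → *-cong
          (trans (*-cong (*-congˡ (padded χ φ)) (*-cong (padded χ χ₄) (padded χ (χ₄ ⁻¹)))) (quadruplication χ₄ χ₄²≋φ χ A ε))
          (trans (*-cong (*-congˡ (grouped χ φ)) (*-cong (grouped χ χ₄) (grouped χ (χ₄ ⁻¹)))) (quadruplication χ₄ χ₄²≋φ χ B (A · B ⁻¹)))))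
        where
        padded : ∀ χ ω → term χ (ω · A) ω ≈ term χ (ω · A) (ω · ε)
        padded χ ω = term-cong {χ} {χ} {ω · A} {ω · A} {ω} {ω · ε} (Ĝ.refl {χ}) (Ĝ.refl {ω · A}) (GS.solve (ω ∷ []) x₀ (x₀ ⊙ GS.ι))
        grouped : ∀ χ ω → term χ (ω · B) (ω · A · B ⁻¹) ≈ term χ (ω · B) (ω · (A · B ⁻¹))
        grouped χ ω = term-cong {χ} {χ} {ω · B} {ω · B} {ω · A · B ⁻¹} {ω · (A · B ⁻¹)} (Ĝ.refl {χ}) (Ĝ.refl {ω · B})
          (GS.solve (ω ∷ A ∷ B ∷ []) (x₀ ⊙ x₁ ⊙ x₂ ⁻) (x₀ ⊙ (x₁ ⊙ x₂ ⁻)))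

  ₈F₈-evaluation : (φ χ₄ A B : Character) → HasOrder φ 2 → HasOrder χ₄ 4 →
    ¬ (A ^ 4 ≋ ε) → ¬ (B ^ 8 ≋ ε) → ¬ (A ^ 2 ≋ φ · B ^ 4) →
    ₘFₘ (A ∷ φ · A ∷ χ₄ · A ∷ χ₄ ⁻¹ · A ∷ B ∷ φ · B ∷ χ₄ · B ∷ χ₄ ⁻¹ · B ∷ [])
        (ε ∷ φ ∷ χ₄ ∷ χ₄ ⁻¹ ∷ A · B ⁻¹ ∷ φ · A · B ⁻¹ ∷ χ₄ · A · B ⁻¹ ∷ χ₄ ⁻¹ · A · B ⁻¹ ∷ [])
        F.1#
    ≈ g (B ^ 4) * g (A ⁻¹ ^ 4 · B ^ 8) /g (A ⁻¹ ^ 4 · B ^ 4) /g (B ^ 8)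
      + ∑[ R ²= A ^ 4 ] (g (A ⁻¹ ^ 4) * g (R ⁻¹ · B ^ 4) /g (R ⁻¹) /g (A ⁻¹ ^ 4 · B ^ 4))
      + g (A ⁻¹ ^ 2) * g (A ⁻¹ ^ 2 · φ · B ^ 4) /g (A ⁻¹ ^ 2 · B ^ 2) /g (A ⁻¹ ^ 2 · φ · B ^ 2)
        * ∑[ R ²= A ^ 2 ] (₃F₂ (R · φ · A ⁻¹ ^ 2) (B ^ 2) (φ · B ^ 2) R φ F.1#)
  ₈F₈-evaluation φ χ₄ A B (φ²≋ε , φ-min) (χ₄⁴≋ε , χ₄-min) A⁴≢ε B⁸≢ε A²≢φB⁴ =
    trans (₈F₈≈quartic A B χ₄ χ₄²≋φ) (trans (quartic-value A B A⁴≢ε B⁸≢ε A²≢φB⁴)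
      (sym (+-cong (+-cong (gauss-part≈ A B) (kummer-part≈ A B)) (whipple-part≈ A B))))
    where
    φφ≋ε : φ · φ ≋ ε
    φφ≋ε = Ĝ.trans {φ · φ} {φ ^ 2} {ε} (GS.solve (φ ∷ []) (x₀ ⊙ x₀) (x₀ ↑ 2)) φ²≋ε
    φ≢ε : ¬ (φ ≋ ε)
    φ≢ε p = φ-min 1 (ℕ.s≤s ℕ.z≤n) (ℕ.s≤s (ℕ.s≤s ℕ.z≤n)) (Ĝ.trans {φ ^ 1} {φ} {ε} (GS.solve (φ ∷ []) (x₀ ↑ 1) x₀) p)
    χ₄²≋φ : χ₄ · χ₄ ≋ φ
    -- The order of χ₄ makes χ₄² a non-trivial character with trivial square, and there is only one.
    χ₄²≋φ = quadratic-unique (χ₄ · χ₄) φ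
      (Ĝ.trans {χ₄ · χ₄ · (χ₄ · χ₄)} {χ₄ ^ 4} {ε} (GS.solve (χ₄ ∷ []) ((x₀ ⊙ x₀) ⊙ (x₀ ⊙ x₀)) (x₀ ↑ 4)) χ₄⁴≋ε)
      (λ p → χ₄-min 2 (ℕ.s≤s ℕ.z≤n) (ℕ.s≤s (ℕ.s≤s (ℕ.s≤s ℕ.z≤n)))
        (Ĝ.trans {χ₄ ^ 2} {χ₄ · χ₄} {ε} (GS.solve (χ₄ ∷ []) (x₀ ↑ 2) (x₀ ⊙ x₀)) p))
      φφ≋ε φ≢ε
    open Reduction φ φφ≋ε φ≢ε

corollary5p3 : ∀ {c ℓ : Level} (q : ℕ) → IsPrimePower q → q % 4 ≡ 1 →
    (𝔽 : FiniteField c ℓ q) →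
    (let open Complex) (let open Characters 𝔽) →
    (listing : CharacterListing) (θ : AdditiveCharacter) (θ≢1 : NonTrivial θ) →
    (let open Hypergeometric 𝔽 listing θ θ≢1) (let open FiniteField 𝔽 using (1#)) →
    (φ χ₄ A B : Character) → HasOrder φ 2 → HasOrder χ₄ 4 →
    ¬ (A ^ 4 ≋ ε) → ¬ (B ^ 8 ≋ ε) → ¬ (A ^ 2 ≋ φ · B ^ 4) →
    ₘFₘ (A ∷ φ · A ∷ χ₄ · A ∷ χ₄ ⁻¹ · A ∷ B ∷ φ · B ∷ χ₄ · B ∷ χ₄ ⁻¹ · B ∷ [])
    (ε ∷ φ ∷ χ₄ ∷ χ₄ ⁻¹ ∷ A · B ⁻¹ ∷ φ · A · B ⁻¹ ∷ χ₄ · A · B ⁻¹ ∷ χ₄ ⁻¹ · A · B ⁻¹ ∷ [])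
    1#
    ≈ g (B ^ 4) * g (A ⁻¹ ^ 4 · B ^ 8) /g (A ⁻¹ ^ 4 · B ^ 4) /g (B ^ 8)
    + ∑[ R ²= A ^ 4 ] (g (A ⁻¹ ^ 4) * g (R ⁻¹ · B ^ 4) /g (R ⁻¹) /g (A ⁻¹ ^ 4 · B ^ 4))
    + g (A ⁻¹ ^ 2) * g (A ⁻¹ ^ 2 · φ · B ^ 4) /g (A ⁻¹ ^ 2 · B ^ 2) /g (A ⁻¹ ^ 2 · φ · B ^ 2)
    * ∑[ R ²= A ^ 2 ] (₃F₂ (R · φ · A ⁻¹ ^ 2) (B ^ 2) (φ · B ^ 2) R φ 1#)
corollary5p3 q _ _ 𝔽 listing θ θ≢1 = Proof.₈F₈-evaluation 𝔽 listing θ θ≢1
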